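{- Let $D_n=\langle a,b\mid a^n=b^2=1,\ bab=a^{ -1}\rangle$, let $H\subseteq D_n$ be a connecting set, and let $\Gamma={\rm Cay}(D_n,H)$ with vertex set $V=V'\cup V''$ where $V'=\{a,a^2,\dots,a^n\}=\langle a\rangle$ and $V''=D_n\setminus V'$. For $1\le i\le n$ let $u_i$ be the number of walks of length $2$ in $\Gamma$ from $a$ to $a^i$ whose intermediate vertex lies in $V'$, and $w_i$ the number of walks of length $2$ from $a$ to $a^i$ whose intermediate vertex lies in $V''$. Put $$\Psi'_\Gamma(x)=u_1+u_2x+\dots+u_nx^{n-1},\qquad \Psi''_\Gamma(x)=w_1+w_2x+\dots+w_nx^{n-1}.$$ Then $\Gamma$ is singular if and only if the cyclotomic polynomial $\Phi_d(x)$ divides $\Psi'_\Gamma(x)-\Psi''_\Gamma(x)$ for some positive divisor $d$ of $n$.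
   Context: A subset $H$ of a finite group $G$ is a connecting set if $H^{ -1}=H$, $1_G\notin H$, and $H$ generates $G$. The Cayley graph ${\rm Cay}(G,H)$ has vertex set $G$, with distinct $u,v$ adjacent iff $vu^{ -1}\in H$. A graph is singular if its adjacency matrix is singular. $\Phi_d(x)$ is the $d$-th cyclotomic polynomial. -}

module Defs where

open import Data.Nat as ℕ using (ℕ; zero; suc; NonZero)
open import Data.Nat.Divisibility using (_∣_)
open import Data.Nat.DivMod using (_mod_)
open import Data.Nat.Divisibility using (_∣?_)
open import Data.Fin as Fin using (Fin; toℕ; punchIn; splitAt)
open import Data.Bool as Bool using (Bool; true; false; if_then_else_; not; _∧_)
open import Data.Integer as ℤ using (ℤ; +_; -_; 0ℤ; 1ℤ; -1ℤ)
open import Data.List as List using (List; []; _∷_; _++_)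
open import Data.List.Relation.Unary.All using (All)
open import Data.Product using (_×_; _,_; ∃-syntax)
open import Data.Sum using ([_,_]′)
open import Relation.Binary.PropositionalEquality using (_≡_)
open import Relation.Nullary.Decidable using (does)

sumFin : ∀ m → (Fin m → ℤ) → ℤ
sumFin zero    f = 0ℤ
sumFin (suc m) f = f Fin.zero ℤ.+ sumFin m (λ i → f (Fin.suc i))

sgn : ℕ → ℤ
sgn zero    = 1ℤ
sgn (suc k) = - sgn k

det : ∀ m → (Fin m → Fin m → ℤ) → ℤ
det zero    A = 1ℤ
det (suc m) A = sumFin (suc m) λ j →
  sgn (toℕ j) ℤ.* A Fin.zero j ℤ.* det m (λ r c → A (Fin.suc r) (punchIn j c))

Singular : ∀ {m} → (Fin m → Fin m → ℤ) → Set
Singular {m} A = det m A ≡ 0ℤ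

Poly : Set
Poly = List ℤ

coeff : Poly → ℕ → ℤ
coeff []      _       = 0ℤ
coeff (c ∷ _) zero    = c
coeff (_ ∷ p) (suc k) = coeff p k

infixl 6 _+ₚ_ _-ₚ_
infixl 7 _*ₚ_
infix 4 _≈ₚ_ _∣ₚ_

_+ₚ_ : Poly → Poly → Poly
[]      +ₚ q       = q
(a ∷ p) +ₚ []      = a ∷ p
(a ∷ p) +ₚ (b ∷ q) = (a ℤ.+ b) ∷ (p +ₚ q)

negₚ : Poly → Poly
negₚ = List.map -_

_-ₚ_ : Poly → Poly → Poly
p -ₚ q = p +ₚ negₚ q

scaleₚ : ℤ → Poly → Poly
scaleₚ c = List.map (c ℤ.*_)

_*ₚ_ : Poly → Poly → Poly
[]      *ₚ q = []
(a ∷ p) *ₚ q = scaleₚ a q +ₚ (0ℤ ∷ (p *ₚ q))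

_≈ₚ_ : Poly → Poly → Set
p ≈ₚ q = ∀ k → coeff p k ≡ coeff q k

_∣ₚ_ : Poly → Poly → Set
p ∣ₚ q = ∃[ r ] (p *ₚ r ≈ₚ q)

xpow : ℕ → Poly
xpow zero    = 1ℤ ∷ []
xpow (suc k) = 0ℤ ∷ xpow k

strip : Poly → Poly
strip []      = []
strip (c ∷ p) with strip p
... | []    = if does (c ℤ.≟ 0ℤ) then [] else c ∷ []
... | q     = c ∷ q

lastℤ : Poly → ℤ
lastℤ []           = 0ℤ
lastℤ (c ∷ [])     = c
lastℤ (_ ∷ c ∷ p)  = lastℤ (c ∷ p)

-- quotient of long division of f by a monic (stripped) polynomial g,
-- with a fuel argument bounding the number of steps
divMonic : ℕ → Poly → Poly → Poly
divMonic zero       f g = []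
divMonic (suc fuel) f g with List.length (strip f) ℕ.<ᵇ List.length g
... | true  = []
... | false =
  let f′ = strip f
      t  = scaleₚ (lastℤ f′) (xpow (List.length f′ ℕ.∸ List.length g))
  in t +ₚ divMonic fuel (strip (f′ -ₚ t *ₚ g)) g

-- Cyclotomic polynomials, via the standard recursion
--   Φ_d = (x^d - 1) / ∏_{e ∣ d, e < d} Φ_e .
-- cycloTable k lists the pairs (e , Φ_e) for 1 ≤ e ≤ k.
cycloTable : ℕ → List (ℕ × Poly)
cycloTable zero    = []
cycloTable (suc k) =
  let T = cycloTable k
      d = suc k
      D = strip (List.foldr (λ { (e , φ) acc → if does (e ∣? d) then φ *ₚ acc else acc })
                            (1ℤ ∷ []) T)
  in T ++ ((d , divMonic (suc (suc d)) (xpow d -ₚ (1ℤ ∷ [])) D) ∷ [])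

lookupCyclo : ℕ → List (ℕ × Poly) → Poly
lookupCyclo d []             = []
lookupCyclo d ((e , φ) ∷ T) = if does (e ℕ.≟ d) then φ else lookupCyclo d T

Φ : ℕ → Poly
Φ d = lookupCyclo d (cycloTable d)

-- The dihedral group D_n = ⟨a, b ∣ a^n = b^2 = 1, bab = a⁻¹⟩ of order 2n,
-- concretely: ⟨ i , s ⟩ stands for a^i b^s  (i mod n, s ∈ {0,1}).

record Dih (n : ℕ) : Set where
  constructor ⟨_,_⟩
  field
    rot : Fin n
    ref : Bool

_==D_ : ∀ {n} → Dih n → Dih n → Bool
⟨ i , s ⟩ ==D ⟨ j , t ⟩ = does (i Fin.≟ j) ∧ does (s Bool.≟ t)

module _ {n : ℕ} .{{_ : NonZero n}} where

  addF : Fin n → Fin n → Fin n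
  addF i j = (toℕ i ℕ.+ toℕ j) mod n

  negF : Fin n → Fin n
  negF i = (n ℕ.∸ toℕ i) mod n

  infixl 7 _·_
  _·_ : Dih n → Dih n → Dih n
  ⟨ i , false ⟩ · ⟨ j , t ⟩ = ⟨ addF i j , t ⟩
  ⟨ i , true  ⟩ · ⟨ j , t ⟩ = ⟨ addF i (negF j) , not t ⟩

  inv : Dih n → Dih n
  inv ⟨ i , false ⟩ = ⟨ negF i , false ⟩
  inv ⟨ i , true  ⟩ = ⟨ i , true ⟩

  e : Dih n
  e = ⟨ 0 mod n , false ⟩

  aPow : ℕ → Dih n
  aPow k = ⟨ k mod n , false ⟩

  bD : Dih n
  bD = ⟨ 0 mod n , true ⟩

  prodD : List (Dih n) → Dih n
  prodD = List.foldr _·_ e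

  -- H is a connecting set: H⁻¹ = H, 1 ∉ H, and H generates D_n
  -- (every element is a finite product of elements of H; since H⁻¹ = H
  -- this is the subgroup generated by H).
  record IsConnectingSet (H : Dih n → Bool) : Set where
    field
      symmetric  : ∀ g → H (inv g) ≡ H g
      noIdentity : H e ≡ false
      generates  : ∀ g → ∃[ hs ] (All (λ h → H h ≡ true) hs × prodD hs ≡ g)

  cayAdj : (Dih n → Bool) → Dih n → Dih n → ℤ
  cayAdj H u v = if u ==D v then 0ℤ else (if H (v · inv u) then 1ℤ else 0ℤ)

  vertex : Fin (n ℕ.+ n) → Dih n
  vertex k = [ (λ i → ⟨ i , false ⟩) , (λ i → ⟨ i , true ⟩) ]′ (splitAt n k)

  adjMatrix : (Dih n → Bool) → Fin (n ℕ.+ n) → Fin (n ℕ.+ n) → ℤ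
  adjMatrix H k l = cayAdj H (vertex k) (vertex l)

  uWalks : (Dih n → Bool) → ℕ → ℤ
  uWalks H i = sumFin n λ k →
    cayAdj H (aPow 1) ⟨ k , false ⟩ ℤ.* cayAdj H ⟨ k , false ⟩ (aPow i)

  wWalks : (Dih n → Bool) → ℕ → ℤ
  wWalks H i = sumFin n λ k →
    cayAdj H (aPow 1) ⟨ k , true ⟩ ℤ.* cayAdj H ⟨ k , true ⟩ (aPow i)

  Ψ′ : (Dih n → Bool) → Poly
  Ψ′ H = List.tabulate {n = n} λ j → uWalks H (suc (toℕ j))

  Ψ″ : (Dih n → Bool) → Poly
  Ψ″ H = List.tabulate {n = n} λ j → wWalks H (suc (toℕ j))

{-# OPTIONS --safe #-}

-- A polynomial p acts on sequences ℕ → ℤ by p • φ = Σ p_j S^j φ, S being the shift. Write C and B for the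
-- action of the rotations and of the reflections in H on n-periodic sequences. The adjacency matrix is
-- [[C, B], [B, C]], where C and B commute, and f = Ψ′ - Ψ″ acts on n-periodic sequences as C² - B² = (C - B)(C + B).
-- Hence Γ is singular iff f kills a nonzero n-periodic sequence. As xⁿ - 1 = ∏ Φ_d kills all of these, f then
-- kills a nonzero sequence φ which is also killed by some Φ_d, d ∣ n, and it remains to see that this forces Φ_d ∣ f.
--
-- This is the irreducibility of Φ_d, obtained after Landau: f(x^q) φ ≡ f(x)^q φ = 0 modulo a prime q, while
-- f(x^q) φ is bounded independently of q, so f(x^q) φ = 0 for all large q, thus f(x^k) φ = 0 whenever k is prime to d.
-- Summation over such k replaces φ by the Ramanujan sums c_d, whose shifts span rationally all sequences killed by Φ_d.
module Submission where

open import Defs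
open import Algebra.Bundles using (CommutativeRing)
open import Data.Bool as Bool using (Bool; true; false; if_then_else_; not; _∧_)
open import Data.Bool.Properties using (∧-zeroʳ)
open import Data.Nat as ℕ using (ℕ; zero; suc; z≤n; s≤s; NonZero; _>_; _!)
import Data.Nat.Properties as ℕ
open import Data.Nat.Combinatorics using (nCk≡nC[n∸k]; nCn≡1; nCk≡n!/k![n-k]!; k![n∸k]!∣n!) renaming (_C_ to _choose_)
open import Data.Nat.Divisibility as ℕ using (_∣_; _∤_; _∣?_)
open import Data.Nat.DivMod as ℕ using (_/_; _%_; _mod_)
open import Data.Nat.GCD using (gcd; gcd-GCD; gcd-greatest; gcd[m,n]∣m; gcd[m,n]∣n; module Bézout)
open import Data.Nat.Induction using (<-rec)
open import Data.Nat.LCM using (lcm; m∣lcm[m,n]; n∣lcm[m,n]; lcm-least)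
open import Data.Nat.ListAction using (product)
open import Data.Nat.Primality using (Prime; prime?; euclidsLemma; prime⇒irreducible; ¬prime[0]; ¬prime[1])
open import Data.Nat.Primality.Factorisation using (factorise; PrimeFactorisation)
import Data.Nat.Tactic.RingSolver as ℕ-Solver
open import Data.Fin as Fin
  using (Fin; zero; suc; toℕ; fromℕ; fromℕ<; inject₁; punchIn; punchOut; splitAt; join; _↑ˡ_; _↑ʳ_)
import Data.Fin.Properties as Fin
open import Data.Integer as ℤ using (ℤ; -_; 0ℤ; 1ℤ; -1ℤ; _+_; _*_; _-_; ∣_∣)
import Data.Integer.Properties as ℤ
open import Data.Integer.Tactic.RingSolver using (solve-∀)
open import Algebra.Properties.AbelianGroup ℤ.+-0-abelianGroup using (∙-cancelˡ)
open import Data.List as List using (List; []; _∷_; _++_)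
import Data.List.Properties as List
open import Data.List.Relation.Unary.All as All using (All; []; _∷_)
import Data.List.Relation.Unary.All.Properties as All
open import Data.Product using (_×_; _,_; Σ-syntax; ∃-syntax; proj₁; proj₂)
open import Data.Sum using (_⊎_; inj₁; inj₂; [_,_]′)
open import Data.Empty using (⊥-elim)
open import Function using (_∘_)
open import Function.Bundles using (_⇔_; mk⇔)
open import Level using (0ℓ)
open import Relation.Binary using (tri<; tri≈; tri>)
open import Relation.Binary.PropositionalEquality hiding (setoid)
open import Relation.Nullary using (yes; no; does)
open import Relation.Nullary.Decidable using (dec-true; dec-false)

-- Determinants and kernels of integer matrices

-- No complex numbers and no field extensions occur: integer sequences killed by `Φ d` take the
-- place of the field of d-th roots of unity. Three obstacles shape the proof. `Φ` is the output of
-- a long division in ℤ[x], which has to be shown exact. This rests on the coprimality of different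
-- cyclotomic polynomials, but ℤ[x] has no Bézout identity; coprimality is therefore expressed on
-- sequences: one that is killed by `Φ c` and has a period not divisible by c vanishes. The passage
-- from large primes to all k prime to d must do without Dirichlet's theorem. Instead k is replaced
-- by k + T d, with T chosen so that all prime factors of this number are large, and these factors
-- are treated one after another. For the converse, `Φ d` must not be 1, as 1 would divide every f.
-- Hence a nonzero sequence killed by `Φ d` is constructed explicitly.

sumFin-cong : ∀ m {f g : Fin m → ℤ} → (∀ i → f i ≡ g i) → sumFin m f ≡ sumFin m g
sumFin-cong zero    f≗g = refl
sumFin-cong (suc m) f≗g = cong₂ _+_ (f≗g zero) (sumFin-cong m (f≗g ∘ suc))

sumFin-0 : ∀ m → sumFin m (λ _ → 0ℤ) ≡ 0ℤ
sumFin-0 zero    = refl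
sumFin-0 (suc m) = trans (ℤ.+-identityˡ _) (sumFin-0 m)

sumFin-zero : ∀ m {f : Fin m → ℤ} → (∀ i → f i ≡ 0ℤ) → sumFin m f ≡ 0ℤ
sumFin-zero m f≗0 = trans (sumFin-cong m f≗0) (sumFin-0 m)

+-interchange : ∀ a b c d → (a + b) + (c + d) ≡ (a + c) + (b + d)
+-interchange = solve-∀

sumFin-+ : ∀ m (f g : Fin m → ℤ) → sumFin m (λ i → f i + g i) ≡ sumFin m f + sumFin m g
sumFin-+ zero    f g = refl
sumFin-+ (suc m) f g =
  trans (cong (f zero + g zero +_) (sumFin-+ m (f ∘ suc) (g ∘ suc))) (+-interchange (f zero) _ _ _)

sumFin-*ˡ : ∀ m x (f : Fin m → ℤ) → sumFin m (λ i → x * f i) ≡ x * sumFin m f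
sumFin-*ˡ zero    x f = sym (ℤ.*-zeroʳ x)
sumFin-*ˡ (suc m) x f =
  trans (cong (x * f zero +_) (sumFin-*ˡ m x (f ∘ suc))) (sym (ℤ.*-distribˡ-+ x _ _))

sumFin-*ʳ : ∀ m x (f : Fin m → ℤ) → sumFin m (λ i → f i * x) ≡ sumFin m f * x
sumFin-*ʳ m x f = trans (sumFin-cong m λ i → ℤ.*-comm (f i) x)
  (trans (sumFin-*ˡ m x f) (ℤ.*-comm x _))

sumFin-neg : ∀ m (f : Fin m → ℤ) → sumFin m (λ i → - f i) ≡ - sumFin m f
sumFin-neg zero    f = refl
sumFin-neg (suc m) f =
  trans (cong (- f zero +_) (sumFin-neg m (f ∘ suc))) (sym (ℤ.neg-distrib-+ (f zero) _))

sumFin-exchange : ∀ m k (f : Fin m → Fin k → ℤ) →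
  sumFin m (λ i → sumFin k (f i)) ≡ sumFin k (λ j → sumFin m (λ i → f i j))
sumFin-exchange zero    k f = sym (sumFin-0 k)
sumFin-exchange (suc m) k f =
  trans (cong (sumFin k (f zero) +_) (sumFin-exchange m k (f ∘ suc))) (sym (sumFin-+ k (f zero) _))

+-swapˡ : ∀ a b c → a + (b + c) ≡ b + (a + c)
+-swapˡ = solve-∀

sumFin-punchIn : ∀ m c (f : Fin (suc m) → ℤ) →
  sumFin (suc m) f ≡ f c + sumFin m (f ∘ punchIn c)
sumFin-punchIn m       zero    f = refl
sumFin-punchIn (suc m) (suc c) f =
  trans (cong (f zero +_) (sumFin-punchIn m c (f ∘ suc))) (+-swapˡ (f zero) (f (suc c)) _)

neg-self⇒0 : ∀ x → x ≡ - x → x ≡ 0ℤ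
neg-self⇒0 ℤ.+0     _ = refl
neg-self⇒0 ℤ.+[1+ n ]   ()
neg-self⇒0 ℤ.-[1+ n ]   ()

cancel-nonzero : ∀ {x y} → x ≢ 0ℤ → x * y ≡ 0ℤ → y ≡ 0ℤ
cancel-nonzero {x} x≢0 xy≡0 with ℤ.i*j≡0⇒i≡0∨j≡0 x xy≡0
... | inj₁ x≡0 = ⊥-elim (x≢0 x≡0)
... | inj₂ y≡0 = y≡0

allZero⊎nonzero : ∀ m (f : Fin m → ℤ) → (∀ i → f i ≡ 0ℤ) ⊎ (∃[ i ] f i ≢ 0ℤ)
allZero⊎nonzero zero f = inj₁ λ ()
allZero⊎nonzero (suc m) f with f zero ℤ.≟ 0ℤ
... | no f0≢0 = inj₂ (zero , f0≢0)
... | yes f0≡0 with allZero⊎nonzero m (f ∘ suc)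
...   | inj₁ f≗0 = inj₁ λ { zero → f0≡0 ; (suc i) → f≗0 i }
...   | inj₂ (i , fi≢0) = inj₂ (suc i , fi≢0)

-- The determinant as an alternating multilinear function of the columns

Matrix : ℕ → ℕ → Set
Matrix m k = Fin m → Fin k → ℤ

minor : ∀ {m} → Matrix (suc m) (suc m) → Fin (suc m) → Matrix m m
minor A j r c = A (suc r) (punchIn j c)

det-cong : ∀ m {A B : Matrix m m} → (∀ r c → A r c ≡ B r c) → det m A ≡ det m B
det-cong zero    A≗B = refl
det-cong (suc m) A≗B = sumFin-cong (suc m) λ j →
  cong₂ (λ a d → sgn (toℕ j) * a * d) (A≗B zero j) (det-cong m λ r c → A≗B (suc r) (punchIn j c))

-- Transposition of the adjacent positions i and i + 1. Adjacent transpositions are the ones that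
-- behave well under passing to minors.
swap : ∀ {m} → Fin m → Fin (suc m) → Fin (suc m)
swap zero    zero          = suc zero
swap zero    (suc zero)    = zero
swap zero    (suc (suc j)) = suc (suc j)
swap (suc i) zero          = zero
swap (suc i) (suc j)       = suc (swap i j)

sumFin-swap : ∀ {m} (i : Fin m) (f : Fin (suc m) → ℤ) →
  sumFin (suc m) (f ∘ swap i) ≡ sumFin (suc m) f
sumFin-swap zero    f = +-swapˡ (f (suc zero)) (f zero) _
sumFin-swap (suc i) f = cong (f zero +_) (sumFin-swap i (f ∘ suc))

-- A position l of the first-row expansion is either one of the two exchanged, and then the sign
-- flips and the minor is that of the other position, or it is fixed, and the swap restricts to an
-- adjacent swap inside the minor.
swap-punchIn : ∀ {m} (i : Fin (suc m)) (l : Fin (suc (suc m))) →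
  (sgn (toℕ l) ≡ - sgn (toℕ (swap i l)) × (∀ c → swap i (punchIn l c) ≡ punchIn (swap i l) c)) ⊎
  (swap i l ≡ l × ∃[ i′ ] (∀ c → swap i (punchIn l c) ≡ punchIn l (swap i′ c)))
swap-punchIn zero zero = inj₁ (refl , λ { zero → refl ; (suc c) → refl })
swap-punchIn zero (suc zero) = inj₁ (refl , λ { zero → refl ; (suc c) → refl })
swap-punchIn {suc m} zero (suc (suc l)) =
  inj₂ (refl , zero , λ { zero → refl ; (suc zero) → refl ; (suc (suc c)) → refl })
swap-punchIn {suc m} (suc i) zero = inj₂ (refl , i , λ c → refl)
swap-punchIn {suc m} (suc i) (suc l) with swap-punchIn i l
... | inj₁ (s , p) = inj₁ (cong -_ s , λ { zero → refl ; (suc c) → cong suc (p c) })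
... | inj₂ (s , i′ , p) = inj₂ (cong suc s , suc i′ , λ { zero → refl ; (suc c) → cong suc (p c) })

neg-*-left : ∀ a b d → (- a) * b * d ≡ - (a * b * d)
neg-*-left = solve-∀

neg-*-right : ∀ a b d → a * b * (- d) ≡ - (a * b * d)
neg-*-right = solve-∀

det-swap : ∀ {m} (i : Fin m) (A : Matrix (suc m) (suc m)) →
  det (suc m) (λ r c → A r (swap i c)) ≡ - det (suc m) A
det-swap {suc m} i A = begin
  sumFin (suc (suc m)) F
    ≡⟨ sumFin-cong (suc (suc m)) F≗-G ⟩
  sumFin (suc (suc m)) (λ l → - G (swap i l))
    ≡⟨ sumFin-neg (suc (suc m)) (G ∘ swap i) ⟩
  - sumFin (suc (suc m)) (G ∘ swap i)
    ≡⟨ cong -_ (sumFin-swap i G) ⟩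
  - sumFin (suc (suc m)) G ∎
  where
  open ≡-Reasoning
  F G : Fin (suc (suc m)) → ℤ
  F l = sgn (toℕ l) * A zero (swap i l) * det (suc m) (λ r c → A (suc r) (swap i (punchIn l c)))
  G l = sgn (toℕ l) * A zero l * det (suc m) (minor A l)
  F≗-G : ∀ l → F l ≡ - G (swap i l)
  F≗-G l with swap-punchIn i l
  ... | inj₁ (s , p) = trans
    (cong₂ (λ σ d → σ * A zero (swap i l) * d) s
      (det-cong (suc m) λ r c → cong (A (suc r)) (p c)))
    (neg-*-left (sgn (toℕ (swap i l))) (A zero (swap i l)) _)
  ... | inj₂ (s , i′ , p) rewrite s = trans
    (cong (sgn (toℕ l) * A zero l *_)
      (trans (det-cong (suc m) λ r c → cong (A (suc r)) (p c)) (det-swap i′ (minor A l))))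
    (neg-*-right (sgn (toℕ l)) (A zero l) _)

swap-invariant : ∀ {m} {X : Set} (i : Fin m) (f : Fin (suc m) → X) →
  f (inject₁ i) ≡ f (suc i) → ∀ c → f (swap i c) ≡ f c
swap-invariant zero    f e zero          = sym e
swap-invariant zero    f e (suc zero)    = e
swap-invariant zero    f e (suc (suc c)) = refl
swap-invariant (suc i) f e zero          = refl
swap-invariant (suc i) f e (suc c)       = swap-invariant i (f ∘ suc) e c

swap-suc : ∀ {m} (i : Fin m) → swap i (suc i) ≡ inject₁ i
swap-suc zero    = refl
swap-suc (suc i) = cong suc (swap-suc i)

swap-> : ∀ {m} (i : Fin m) (j : Fin (suc m)) → suc (toℕ i) ℕ.< toℕ j → swap i j ≡ j
swap-> zero    (suc zero)    (s≤s ())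
swap-> zero    (suc (suc j)) _       = refl
swap-> (suc i) (suc j)       (s≤s p) = cong suc (swap-> i j p)

-- Exchanging equal adjacent columns fixes the matrix and negates the determinant. Otherwise a swap
-- moves column i one place towards j, so the induction is on the distance.
det-equalColumns< : ∀ k {m} (A : Matrix m m) (i j : Fin m) → toℕ j ≡ suc (k ℕ.+ toℕ i) →
  (∀ r → A r i ≡ A r j) → det m A ≡ 0ℤ
det-equalColumns< k {suc m} A i j j≡ Ai≗Aj = go k j≡
  where
  i<m : toℕ i ℕ.< m
  i<m = ℕ.≤-trans (s≤s (ℕ.m≤n+m (toℕ i) k))
    (ℕ.≤-trans (ℕ.≤-reflexive (sym j≡)) (ℕ.≤-pred (Fin.toℕ<n j)))
  i₀ : Fin m
  i₀ = fromℕ< i<m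
  i₀≡i : inject₁ i₀ ≡ i
  i₀≡i = Fin.toℕ-injective (trans (Fin.toℕ-inject₁ i₀) (Fin.toℕ-fromℕ< i<m))
  go : ∀ k → toℕ j ≡ suc (k ℕ.+ toℕ i) → det (suc m) A ≡ 0ℤ
  go zero j≡ = neg-self⇒0 _ (trans (sym (det-cong (suc m) λ r → swap-invariant i₀ (A r)
      (trans (cong (A r) i₀≡i) (trans (Ai≗Aj r) (cong (A r) j≡si₀))))) (det-swap i₀ A))
    where
    j≡si₀ : j ≡ suc i₀
    j≡si₀ = Fin.toℕ-injective (trans j≡ (cong suc (sym (Fin.toℕ-fromℕ< i<m))))
  go (suc k) j≡ = ℤ.neg-injective (trans (sym (det-swap i₀ A))
    (det-equalColumns< k (λ r c → A r (swap i₀ c)) (suc i₀) j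
      (trans j≡ (cong suc (trans (sym (ℕ.+-suc k _))
        (cong (λ t → k ℕ.+ suc t) (sym (Fin.toℕ-fromℕ< i<m))))))
      λ r → trans (cong (A r) (trans (swap-suc i₀) i₀≡i))
        (trans (Ai≗Aj r) (cong (A r) (sym (swap-> i₀ j i<j))))))
    where
    i<j : suc (toℕ i₀) ℕ.< toℕ j
    i<j = subst₂ ℕ._≤_ (cong (λ t → suc (suc t)) (sym (Fin.toℕ-fromℕ< i<m))) (sym j≡)
      (s≤s (s≤s (ℕ.m≤n+m (toℕ i) k)))

det-equalColumns : ∀ {m} (A : Matrix m m) (i j : Fin m) → i ≢ j →
  (∀ r → A r i ≡ A r j) → det m A ≡ 0ℤ
det-equalColumns A i j i≢j Ai≗Aj with ℕ.<-cmp (toℕ i) (toℕ j)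
... | tri≈ _ i≡j _ = ⊥-elim (i≢j (Fin.toℕ-injective i≡j))
... | tri< i<j _ _ = det-equalColumns< (toℕ j ℕ.∸ suc (toℕ i)) A i j
  (sym (trans (sym (ℕ.+-suc _ _)) (ℕ.m∸n+n≡m i<j))) Ai≗Aj
... | tri> _ _ j<i = det-equalColumns< (toℕ i ℕ.∸ suc (toℕ j)) A j i
  (sym (trans (sym (ℕ.+-suc _ _)) (ℕ.m∸n+n≡m j<i))) (sym ∘ Ai≗Aj)

distrib-middle : ∀ s x a y b d → s * (x * a + y * b) * d ≡ x * (s * a * d) + y * (s * b * d)
distrib-middle = solve-∀

distrib-right : ∀ s x a y b d → s * d * (x * a + y * b) ≡ x * (s * d * a) + y * (s * d * b)
distrib-right = solve-∀

-- In the first-row expansion, position c is linear through its entry and every other position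
-- through its minor. Special scalars cover further rules: x = y = 0 with three equal matrices says
-- that a zero column gives determinant zero.
det-linear : ∀ m (c : Fin m) (A B C : Matrix m m) x y →
  (∀ r j → j ≢ c → A r j ≡ C r j) → (∀ r j → j ≢ c → B r j ≡ C r j) →
  (∀ r → C r c ≡ x * A r c + y * B r c) → det m C ≡ x * det m A + y * det m B
det-linear (suc m) c A B C x y A≗C B≗C Cc =
  trans (sumFin-cong (suc m) term)
  (trans (sumFin-+ (suc m) (λ l → x * T A l) (λ l → y * T B l))
    (cong₂ _+_ (sumFin-*ˡ (suc m) x (T A)) (sumFin-*ˡ (suc m) y (T B))))
  where
  T : Matrix (suc m) (suc m) → Fin (suc m) → ℤ
  T M l = sgn (toℕ l) * M zero l * det m (minor M l)
  term : ∀ l → T C l ≡ x * T A l + y * T B l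
  term l with l Fin.≟ c
  ... | yes refl = trans
    (cong (λ z → sgn (toℕ l) * z * det m (minor C l)) (Cc zero))
    (trans (distrib-middle (sgn (toℕ l)) x (A zero l) y (B zero l) _)
      (cong₂ (λ d d′ → x * (sgn (toℕ l) * A zero l * d) + y * (sgn (toℕ l) * B zero l * d′))
        (det-cong m λ r j → sym (A≗C (suc r) (punchIn l j) (Fin.punchInᵢ≢i l j)))
        (det-cong m λ r j → sym (B≗C (suc r) (punchIn l j) (Fin.punchInᵢ≢i l j)))))
  ... | no l≢c = trans
    (cong (sgn (toℕ l) * C zero l *_)
      (det-linear m (punchOut l≢c) (minor A l) (minor B l) (minor C l) x y
        (λ r j j≢ → A≗C (suc r) (punchIn l j) (≢c j≢))
        (λ r j j≢ → B≗C (suc r) (punchIn l j) (≢c j≢))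
        λ r → subst (λ k → C (suc r) k ≡ x * A (suc r) k + y * B (suc r) k)
          (sym (Fin.punchIn-punchOut l≢c)) (Cc (suc r))))
    (trans (distrib-right (sgn (toℕ l)) x _ y _ (C zero l))
      (cong₂ (λ a b → x * (sgn (toℕ l) * a * det m (minor A l)) + y * (sgn (toℕ l) * b * det m (minor B l)))
        (sym (A≗C zero l l≢c)) (sym (B≗C zero l l≢c))))
    where
    ≢c : ∀ {j} → j ≢ punchOut l≢c → punchIn l j ≢ c
    ≢c j≢ eq = j≢ (Fin.punchIn-injective l _ _ (trans eq (sym (Fin.punchIn-punchOut l≢c))))

-- The multiple of column c contributes a matrix with two equal columns. The scalar s on column j
-- itself is what makes elimination possible without fractions.
det-columnOp : ∀ {m} (A B : Matrix m m) (c j : Fin m) s t → c ≢ j →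
  (∀ r k → k ≢ j → B r k ≡ A r k) → (∀ r → B r j ≡ s * A r j + t * A r c) →
  det m B ≡ s * det m A
det-columnOp {m} A B c j s t c≢j B≗A Bj =
  trans (det-linear m j A A′ B s t
      (λ r k k≢j → sym (B≗A r k k≢j))
      (λ r k k≢j → trans (A′-other r k k≢j) (sym (B≗A r k k≢j)))
      (λ r → trans (Bj r) (cong (λ z → s * A r j + t * z) (sym (A′-j r)))))
    (trans (cong (λ z → s * det m A + t * z) detA′≡0)
      (trans (cong (s * det m A +_) (ℤ.*-zeroʳ t)) (ℤ.+-identityʳ _)))
  where
  A′ : Matrix m m
  A′ r k with k Fin.≟ j
  ... | yes _ = A r c
  ... | no  _ = A r k
  A′-j : ∀ r → A′ r j ≡ A r c
  A′-j r with j Fin.≟ j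
  ... | yes _ = refl
  ... | no j≢j = ⊥-elim (j≢j refl)
  A′-other : ∀ r k → k ≢ j → A′ r k ≡ A r k
  A′-other r k k≢j with k Fin.≟ j
  ... | yes k≡j = ⊥-elim (k≢j k≡j)
  ... | no  _   = refl
  detA′≡0 : det m A′ ≡ 0ℤ
  detA′≡0 = det-equalColumns A′ c j c≢j λ r → trans (A′-other r c c≢j) (sym (A′-j r))

-- Fraction-free Gaussian elimination

NonzeroKernel : ∀ {m k} → Matrix m k → Set
NonzeroKernel {m} {k} A =
  Σ[ v ∈ (Fin k → ℤ) ] ((∃[ i ] v i ≢ 0ℤ) × (∀ r → sumFin k (λ j → A r j * v j) ≡ 0ℤ))

-- The entries can be read in two ways: as row r times the pivot minus a multiple of row zero, or as
-- column j times the pivot minus a multiple of column c. The first reading serves kernels, the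
-- second determinants.
eliminate : ∀ {m k} → Matrix (suc m) (suc k) → Fin (suc k) → Matrix m k
eliminate A c r j =
  A zero c * A (suc r) (punchIn c j) + - A zero (punchIn c j) * A (suc r) c

module _ {m k} (A : Matrix (suc m) (suc k)) (c : Fin (suc k)) (pivot : A zero c ≢ 0ℤ) where

  -- Back substitution without division: u is scaled by the pivot, so the coordinate at c that makes
  -- row zero vanish is an integer.
  eliminate-kernel : NonzeroKernel (eliminate A c) → NonzeroKernel A
  eliminate-kernel (u , (i , ui≢0) , Eu≡0) = v , (punchIn c i , v≢0) , Av≡0
    where
    s = A zero c
    v : Fin (suc k) → ℤ
    v j with c Fin.≟ j
    ... | yes _ = - sumFin k (λ j → A zero (punchIn c j) * u j)
    ... | no c≢j = s * u (punchOut c≢j)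
    v-c : v c ≡ - sumFin k (λ j → A zero (punchIn c j) * u j)
    v-c with c Fin.≟ c
    ... | yes _ = refl
    ... | no c≢c = ⊥-elim (c≢c refl)
    v-punchIn : ∀ j → v (punchIn c j) ≡ s * u j
    v-punchIn j with c Fin.≟ punchIn c j
    ... | yes c≡ = ⊥-elim (Fin.punchInᵢ≢i c j (sym c≡))
    ... | no c≢ = cong (λ z → s * u z) (Fin.punchOut-punchIn c)
    v≢0 : v (punchIn c i) ≢ 0ℤ
    v≢0 vi≡0 = ui≢0 (cancel-nonzero pivot (trans (sym (v-punchIn i)) vi≡0))
    row : ∀ r → sumFin (suc k) (λ j → A r j * v j) ≡
      sumFin k (λ j → (s * A r (punchIn c j) + - A zero (punchIn c j) * A r c) * u j)
    row r = begin
      sumFin (suc k) (λ j → A r j * v j)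
        ≡⟨ sumFin-punchIn k c (λ j → A r j * v j) ⟩
      A r c * v c + sumFin k (λ j → A r (punchIn c j) * v (punchIn c j))
        ≡⟨ cong₂ _+_ (cong (A r c *_) (trans v-c (sym (sumFin-neg k _))))
             (sumFin-cong k λ j → cong (A r (punchIn c j) *_) (v-punchIn j)) ⟩
      A r c * sumFin k (λ j → - (A zero (punchIn c j) * u j)) +
        sumFin k (λ j → A r (punchIn c j) * (s * u j))
        ≡⟨ cong (λ z → z + sumFin k (λ j → A r (punchIn c j) * (s * u j))) (sym (sumFin-*ˡ k (A r c) _)) ⟩
      sumFin k (λ j → A r c * - (A zero (punchIn c j) * u j)) +
        sumFin k (λ j → A r (punchIn c j) * (s * u j))
        ≡⟨ sym (sumFin-+ k _ _) ⟩
      sumFin k (λ j → A r c * - (A zero (punchIn c j) * u j) + A r (punchIn c j) * (s * u j))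
        ≡⟨ sumFin-cong k (λ j → regroup (A r c) (A zero (punchIn c j)) (u j) (A r (punchIn c j)) s) ⟩
      sumFin k (λ j → (s * A r (punchIn c j) + - A zero (punchIn c j) * A r c) * u j) ∎
      where
      open ≡-Reasoning
      regroup : ∀ a b w d s → a * - (b * w) + d * (s * w) ≡ (s * d + - b * a) * w
      regroup = solve-∀
    Av≡0 : ∀ r → sumFin (suc k) (λ j → A r j * v j) ≡ 0ℤ
    Av≡0 zero    = trans (row zero) (sumFin-zero k λ j → vanish s (A zero (punchIn c j)) (u j))
      where
      vanish : ∀ s b w → (s * b + - b * s) * w ≡ 0ℤ
      vanish = solve-∀
    Av≡0 (suc r) = trans (row (suc r)) (Eu≡0 r)

wide⇒kernel : ∀ m (A : Matrix m (suc m)) → NonzeroKernel A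
wide⇒kernel zero    A = (λ _ → 1ℤ) , (zero , λ ()) , λ ()
wide⇒kernel (suc m) A with allZero⊎nonzero (suc (suc m)) (A zero)
... | inj₂ (c , pivot) = eliminate-kernel A c pivot (wide⇒kernel m (eliminate A c))
-- A zero row imposes no condition, so it is dropped together with one column, whose coordinate is
-- set to 0.
... | inj₁ row≗0 with wide⇒kernel m (λ r j → A (suc r) (suc j))
...   | u , (i , ui≢0) , Eu≡0 = v , (suc i , ui≢0) , Av≡0
  where
  v : Fin (suc (suc m)) → ℤ
  v zero    = 0ℤ
  v (suc j) = u j
  Av≡0 : ∀ r → sumFin (suc (suc m)) (λ j → A r j * v j) ≡ 0ℤ
  Av≡0 zero    = sumFin-zero (suc (suc m)) λ j → cong (_* v j) (row≗0 j)
  Av≡0 (suc r) = cong₂ _+_ (ℤ.*-zeroʳ (A (suc r) zero)) (Eu≡0 r)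

module _ {m} (A : Matrix (suc m) (suc m)) (c : Fin (suc m)) where

  private
    -- The column operations carried out on the columns before k, column c excepted. Each one
    -- multiplies the determinant by the pivot; only its vanishing is tracked.
    partial : ℕ → Matrix (suc m) (suc m)
    partial k r j with c Fin.≟ j | toℕ j ℕ.<? k
    ... | yes _ | _     = A r j
    ... | no _  | yes _ = A zero c * A r j + - A zero j * A r c
    ... | no _  | no _  = A r j

    partial-c : ∀ k r → partial k r c ≡ A r c
    partial-c k r with c Fin.≟ c | toℕ c ℕ.<? k
    ... | yes _  | _ = refl
    ... | no c≢c | _ = ⊥-elim (c≢c refl)

    partial-< : ∀ k r j → c ≢ j → toℕ j ℕ.< k →
      partial k r j ≡ A zero c * A r j + - A zero j * A r c
    partial-< k r j c≢j j<k with c Fin.≟ j | toℕ j ℕ.<? k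
    ... | yes c≡j | _      = ⊥-elim (c≢j c≡j)
    ... | no _    | yes _  = refl
    ... | no _    | no j≮k = ⊥-elim (j≮k j<k)

    partial-≥ : ∀ k r j → k ℕ.≤ toℕ j → partial k r j ≡ A r j
    partial-≥ k r j k≤j with c Fin.≟ j | toℕ j ℕ.<? k
    ... | yes _ | _       = refl
    ... | no _  | yes j<k = ⊥-elim (ℕ.<⇒≱ j<k k≤j)
    ... | no _  | no _    = refl

    partial-other : ∀ k r j → toℕ j ≢ k → partial (suc k) r j ≡ partial k r j
    partial-other k r j j≢k with c Fin.≟ j | toℕ j ℕ.<? suc k | toℕ j ℕ.<? k
    ... | yes _ | _        | _       = refl
    ... | no _  | yes _    | yes _   = refl
    ... | no _  | no _     | no _    = refl
    ... | no _  | yes j<sk | no j≮k  = ⊥-elim (j≢k (ℕ.≤-antisym (ℕ.≤-pred j<sk) (ℕ.≮⇒≥ j≮k)))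
    ... | no _  | no j≮sk  | yes j<k = ⊥-elim (j≮sk (ℕ.m≤n⇒m≤1+n j<k))

    det-partial : det (suc m) A ≡ 0ℤ → ∀ k → k ℕ.≤ suc m → det (suc m) (partial k) ≡ 0ℤ
    det-partial detA≡0 zero _ = trans (det-cong (suc m) λ r j → partial-≥ 0 r j z≤n) detA≡0
    det-partial detA≡0 (suc k) k<m with c Fin.≟ fromℕ< k<m | det-partial detA≡0 k (ℕ.<⇒≤ k<m)
    ... | yes c≡k | IH = trans (det-cong (suc m) same) IH
      where
      same : ∀ r j → partial (suc k) r j ≡ partial k r j
      same r j with toℕ j ℕ.≟ k
      ... | no j≢k = partial-other k r j j≢k
      ... | yes j≡k rewrite Fin.toℕ-injective {i = j} {j = c}
                      (trans j≡k (sym (trans (cong toℕ c≡k) (Fin.toℕ-fromℕ< k<m)))) =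
        trans (partial-c (suc k) r) (sym (partial-c k r))
    ... | no c≢k | IH = trans
      (det-columnOp (partial k) (partial (suc k)) c k′ (A zero c) (- A zero k′) c≢k
        (λ r j j≢k′ → partial-other k r j λ j≡k → j≢k′ (Fin.toℕ-injective (trans j≡k (sym k′≡k))))
        λ r → trans (partial-< (suc k) r k′ c≢k (ℕ.≤-reflexive (cong suc k′≡k)))
          (cong₂ (λ a b → A zero c * a + - A zero k′ * b)
            (sym (partial-≥ k r k′ (ℕ.≤-reflexive (sym k′≡k)))) (sym (partial-c k r))))
      (trans (cong (A zero c *_) IH) (ℤ.*-zeroʳ (A zero c)))
      where
      k′ = fromℕ< k<m
      k′≡k : toℕ k′ ≡ k
      k′≡k = Fin.toℕ-fromℕ< k<m

  -- After all column operations row zero vanishes off c, so its expansion has a single term: a sign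
  -- times the pivot times the determinant of the eliminated matrix.
  det-eliminate : A zero c ≢ 0ℤ → det (suc m) A ≡ 0ℤ → det m (eliminate A c) ≡ 0ℤ
  det-eliminate pivot detA≡0 = cancel-nonzero sgn*pivot≢0 (begin
    sgn (toℕ c) * A zero c * det m (eliminate A c)
      ≡⟨ cong₂ (λ a d → sgn (toℕ c) * a * d) (sym (partial-c (suc m) zero))
           (det-cong m λ r j → sym (partial-< (suc m) (suc r) (punchIn c j)
             (Fin.punchInᵢ≢i c j ∘ sym) (Fin.toℕ<n (punchIn c j)))) ⟩
    T c
      ≡⟨ sym (ℤ.+-identityʳ (T c)) ⟩
    T c + 0ℤ
      ≡⟨ cong (T c +_) (sym (sumFin-zero m T-other)) ⟩
    T c + sumFin m (T ∘ punchIn c)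
      ≡⟨ sym (sumFin-punchIn m c T) ⟩
    det (suc m) M
      ≡⟨ det-partial detA≡0 (suc m) ℕ.≤-refl ⟩
    0ℤ ∎)
    where
    open ≡-Reasoning
    M = partial (suc m)
    T : Fin (suc m) → ℤ
    T l = sgn (toℕ l) * M zero l * det m (minor M l)
    cross : ∀ a b → a * b + - b * a ≡ 0ℤ
    cross = solve-∀
    T-other : ∀ j → T (punchIn c j) ≡ 0ℤ
    T-other j = trans
      (cong (λ z → sgn (toℕ (punchIn c j)) * z * det m (minor M (punchIn c j)))
        (trans (partial-< (suc m) zero (punchIn c j) (Fin.punchInᵢ≢i c j ∘ sym) (Fin.toℕ<n (punchIn c j)))
          (cross (A zero c) (A zero (punchIn c j)))))
      (cong (_* det m (minor M (punchIn c j))) (ℤ.*-zeroʳ (sgn (toℕ (punchIn c j)))))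
    sgn≢0 : ∀ k → sgn k ≢ 0ℤ
    sgn≢0 zero    ()
    sgn≢0 (suc k) s≡0 = sgn≢0 k (ℤ.neg-injective s≡0)
    sgn*pivot≢0 : sgn (toℕ c) * A zero c ≢ 0ℤ
    sgn*pivot≢0 eq = pivot (cancel-nonzero (sgn≢0 (toℕ c)) eq)

singular⇒kernel : ∀ m (A : Matrix m m) → Singular A → NonzeroKernel A
singular⇒kernel (suc m) A detA≡0 with allZero⊎nonzero (suc m) (A zero)
... | inj₂ (c , pivot) =
  eliminate-kernel A c pivot (singular⇒kernel m (eliminate A c) (det-eliminate A c pivot detA≡0))
-- Without its zero row the system has more unknowns than equations.
... | inj₁ row≗0 with wide⇒kernel m (A ∘ suc)
...   | v , v≢0 , Av≡0 = v , v≢0 , λ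
  { zero → sumFin-zero (suc m) λ j → cong (_* v j) (row≗0 j)
  ; (suc r) → Av≡0 r }

module _ {m} (A : Matrix (suc m) (suc m)) (v : Fin (suc m) → ℤ) (c : Fin (suc m)) where

  private
    combination : ∀ {k} → (Fin k → Fin m) → Fin (suc m) → ℤ
    combination {k} ι r = v c * A r c +
      sumFin k (λ j → v (punchIn c (ι j)) * A r (punchIn c (ι j)))

    replaced : ∀ {k} → (Fin k → Fin m) → Matrix (suc m) (suc m)
    replaced ι r j with j Fin.≟ c
    ... | yes _ = combination ι r
    ... | no  _ = A r j

    replaced-c : ∀ {k} (ι : Fin k → Fin m) r → replaced ι r c ≡ combination ι r
    replaced-c ι r with c Fin.≟ c
    ... | yes _ = refl
    ... | no c≢c = ⊥-elim (c≢c refl)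

    replaced-other : ∀ {k} (ι : Fin k → Fin m) r j → j ≢ c → replaced ι r j ≡ A r j
    replaced-other ι r j j≢c with j Fin.≟ c
    ... | yes j≡c = ⊥-elim (j≢c j≡c)
    ... | no _ = refl

    -- Column c becomes v c times itself plus multiples of other columns, which leave the
    -- determinant unchanged. The family ι of added columns is arbitrary so that the induction can
    -- drop its first member; for the identity the new column is A v.
    det-replaced : ∀ {k} (ι : Fin k → Fin m) → det (suc m) (replaced ι) ≡ v c * det (suc m) A
    det-replaced {zero} ι = trans
      (det-linear (suc m) c A A (replaced ι) (v c) 0ℤ
        (λ r j j≢c → sym (replaced-other ι r j j≢c))
        (λ r j j≢c → sym (replaced-other ι r j j≢c))
        (λ r → replaced-c ι r))
      (ℤ.+-identityʳ _)
    det-replaced {suc k} ι =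
      trans (det-linear (suc m) c (replaced (ι ∘ suc)) X (replaced ι) 1ℤ (v p)
        (λ r j j≢c → trans (replaced-other (ι ∘ suc) r j j≢c) (sym (replaced-other ι r j j≢c)))
        (λ r j j≢c → trans (X-other r j j≢c) (sym (replaced-other ι r j j≢c)))
        λ r → trans (replaced-c ι r) (trans
          (regroup (v c * A r c) (v p) (A r p) _)
          (cong₂ (λ a b → 1ℤ * a + v p * b) (sym (replaced-c (ι ∘ suc) r)) (sym (X-c r)))))
        (trans (cong₂ (λ a b → 1ℤ * a + v p * b) (det-replaced (ι ∘ suc)) detX≡0)
          (trans (cong (λ z → 1ℤ * (v c * det (suc m) A) + z) (ℤ.*-zeroʳ (v p))) (trans (ℤ.+-identityʳ _) (ℤ.*-identityˡ _))))
      where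
      p = punchIn c (ι zero)
      p≢c : p ≢ c
      p≢c = Fin.punchInᵢ≢i c (ι zero)
      regroup : ∀ a b d s → a + (b * d + s) ≡ 1ℤ * (a + s) + b * d
      regroup = solve-∀
      X : Matrix (suc m) (suc m)
      X r j with j Fin.≟ c
      ... | yes _ = A r p
      ... | no  _ = A r j
      X-c : ∀ r → X r c ≡ A r p
      X-c r with c Fin.≟ c
      ... | yes _ = refl
      ... | no c≢c = ⊥-elim (c≢c refl)
      X-other : ∀ r j → j ≢ c → X r j ≡ A r j
      X-other r j j≢c with j Fin.≟ c
      ... | yes j≡c = ⊥-elim (j≢c j≡c)
      ... | no _ = refl
      detX≡0 : det (suc m) X ≡ 0ℤ
      detX≡0 = det-equalColumns X c p (p≢c ∘ sym) λ r → trans (X-c r) (sym (X-other r p p≢c))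

  kernel-scales-det : (∀ r → sumFin (suc m) (λ j → A r j * v j) ≡ 0ℤ) → v c * det (suc m) A ≡ 0ℤ
  kernel-scales-det Av≡0 = trans (sym (det-replaced (λ j → j)))
    (det-linear (suc m) c M M M 0ℤ 0ℤ (λ _ _ _ → refl) (λ _ _ _ → refl) zeroColumn)
    where
    M = replaced (λ j → j)
    zeroColumn : ∀ r → M r c ≡ 0ℤ * M r c + 0ℤ * M r c
    zeroColumn r = begin
      M r c ≡⟨ replaced-c (λ j → j) r ⟩
      v c * A r c + sumFin m (λ j → v (punchIn c j) * A r (punchIn c j))
        ≡⟨ sym (sumFin-punchIn m c (λ j → v j * A r j)) ⟩
      sumFin (suc m) (λ j → v j * A r j)
        ≡⟨ sumFin-cong (suc m) (λ j → ℤ.*-comm (v j) (A r j)) ⟩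
      sumFin (suc m) (λ j → A r j * v j)
        ≡⟨ Av≡0 r ⟩
      0ℤ ∎
      where open ≡-Reasoning

kernel⇒singular : ∀ m (A : Matrix m m) → NonzeroKernel A → Singular A
kernel⇒singular zero A (v , (() , _) , _)
kernel⇒singular (suc m) A (v , (c , vc≢0) , Av≡0) =
  cancel-nonzero vc≢0 (kernel-scales-det A v c Av≡0)

-- Polynomials acting on sequences

Seq : Set
Seq = ℕ → ℤ

-- act k p φ is p(Sᵏ) φ, where S is the shift (S φ) i = φ (i + 1).
act : ℕ → Poly → Seq → Seq
act k []      φ i = 0ℤ
act k (a ∷ p) φ i = a * φ i + act k p φ (k ℕ.+ i)

infixr 8 _•_
_•_ : Poly → Seq → Seq
p • φ = act 1 p φ

act-cong : ∀ k p {φ ψ : Seq} → (∀ i → φ i ≡ ψ i) → ∀ i → act k p φ i ≡ act k p ψ i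
act-cong k []      φ≗ψ i = refl
act-cong k (a ∷ p) φ≗ψ i = cong₂ (λ x y → a * x + y) (φ≗ψ i) (act-cong k p φ≗ψ (k ℕ.+ i))

act-zero : ∀ k p {φ : Seq} → (∀ i → φ i ≡ 0ℤ) → ∀ i → act k p φ i ≡ 0ℤ
act-zero k []      φ≗0 i = refl
act-zero k (a ∷ p) φ≗0 i =
  cong₂ _+_ (trans (cong (a *_) (φ≗0 i)) (ℤ.*-zeroʳ a)) (act-zero k p φ≗0 (k ℕ.+ i))

act-+ˢ : ∀ k p (φ ψ : Seq) i → act k p (λ j → φ j + ψ j) i ≡ act k p φ i + act k p ψ i
act-+ˢ k []      φ ψ i = refl
act-+ˢ k (a ∷ p) φ ψ i = trans
  (cong (a * (φ i + ψ i) +_) (act-+ˢ k p φ ψ (k ℕ.+ i)))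
  (regroup a (φ i) (ψ i) (act k p φ (k ℕ.+ i)) (act k p ψ (k ℕ.+ i)))
  where
  regroup : ∀ a x y s t → a * (x + y) + (s + t) ≡ (a * x + s) + (a * y + t)
  regroup = solve-∀

act-*ˢ : ∀ k p c (φ : Seq) i → act k p (λ j → c * φ j) i ≡ c * act k p φ i
act-*ˢ k []      c φ i = sym (ℤ.*-zeroʳ c)
act-*ˢ k (a ∷ p) c φ i = trans
  (cong (a * (c * φ i) +_) (act-*ˢ k p c φ (k ℕ.+ i)))
  (regroup a c (φ i) (act k p φ (k ℕ.+ i)))
  where
  regroup : ∀ a c x s → a * (c * x) + c * s ≡ c * (a * x + s)
  regroup = solve-∀

act-shift : ∀ k p (φ : Seq) s i → act k p (λ t → φ (s ℕ.+ t)) i ≡ act k p φ (s ℕ.+ i)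
act-shift k []      φ s i = refl
act-shift k (a ∷ p) φ s i = cong (a * φ (s ℕ.+ i) +_)
  (trans (act-shift k p φ s (k ℕ.+ i)) (cong (act k p φ) s+k+i))
  where
  s+k+i : s ℕ.+ (k ℕ.+ i) ≡ k ℕ.+ (s ℕ.+ i)
  s+k+i = trans (sym (ℕ.+-assoc s k i)) (trans (cong (ℕ._+ i) (ℕ.+-comm s k)) (ℕ.+-assoc k s i))

act-+ : ∀ k p q (φ : Seq) i → act k (p +ₚ q) φ i ≡ act k p φ i + act k q φ i
act-+ k []      q       φ i = sym (ℤ.+-identityˡ _)
act-+ k (a ∷ p) []      φ i = sym (ℤ.+-identityʳ _)
act-+ k (a ∷ p) (b ∷ q) φ i = trans
  (cong ((a + b) * φ i +_) (act-+ k p q φ (k ℕ.+ i)))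
  (regroup a b (φ i) (act k p φ (k ℕ.+ i)) (act k q φ (k ℕ.+ i)))
  where
  regroup : ∀ a b x s t → (a + b) * x + (s + t) ≡ (a * x + s) + (b * x + t)
  regroup = solve-∀

act-scale : ∀ k c p (φ : Seq) i → act k (scaleₚ c p) φ i ≡ c * act k p φ i
act-scale k c []      φ i = sym (ℤ.*-zeroʳ c)
act-scale k c (a ∷ p) φ i = trans
  (cong (c * a * φ i +_) (act-scale k c p φ (k ℕ.+ i)))
  (regroup c a (φ i) (act k p φ (k ℕ.+ i)))
  where
  regroup : ∀ c a x s → c * a * x + c * s ≡ c * (a * x + s)
  regroup = solve-∀

act-neg : ∀ k p (φ : Seq) i → act k (negₚ p) φ i ≡ - act k p φ i
act-neg k []      φ i = refl
act-neg k (a ∷ p) φ i = trans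
  (cong (- a * φ i +_) (act-neg k p φ (k ℕ.+ i)))
  (regroup a (φ i) (act k p φ (k ℕ.+ i)))
  where
  regroup : ∀ a x s → - a * x + - s ≡ - (a * x + s)
  regroup = solve-∀

act-- : ∀ k p q (φ : Seq) i → act k (p -ₚ q) φ i ≡ act k p φ i - act k q φ i
act-- k p q φ i = trans (act-+ k p (negₚ q) φ i) (cong (act k p φ i +_) (act-neg k q φ i))

act-* : ∀ k p q (φ : Seq) i → act k (p *ₚ q) φ i ≡ act k p (act k q φ) i
act-* k []      q φ i = refl
act-* k (a ∷ p) q φ i = trans (act-+ k (scaleₚ a q) (0ℤ ∷ p *ₚ q) φ i)
  (cong₂ _+_ (act-scale k a q φ i)
    (trans (ℤ.+-identityˡ _) (act-* k p q φ (k ℕ.+ i))))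

act-comm : ∀ k l p q (φ : Seq) i → act k p (act l q φ) i ≡ act l q (act k p φ) i
act-comm k l []      q φ i = sym (act-zero l q (λ _ → refl) i)
act-comm k l (a ∷ p) q φ i = sym (begin
  act l q (λ j → a * φ j + act k p φ (k ℕ.+ j)) i
    ≡⟨ act-+ˢ l q (λ j → a * φ j) (λ j → act k p φ (k ℕ.+ j)) i ⟩
  act l q (λ j → a * φ j) i + act l q (λ j → act k p φ (k ℕ.+ j)) i
    ≡⟨ cong₂ _+_ (act-*ˢ l q a φ i) (act-shift l q (act k p φ) k i) ⟩
  a * act l q φ i + act l q (act k p φ) (k ℕ.+ i)
    ≡⟨ cong (a * act l q φ i +_) (sym (act-comm k l p q φ (k ℕ.+ i))) ⟩
  a * act l q φ i + act k p (act l q φ) (k ℕ.+ i) ∎)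
  where open ≡-Reasoning

act-kills : ∀ k p l q (φ : Seq) → (∀ i → act k p φ i ≡ 0ℤ) → ∀ i → act k p (act l q φ) i ≡ 0ℤ
act-kills k p l q φ pφ≗0 i = trans (act-comm k l p q φ i) (act-zero l q pφ≗0 i)

-- The ring of integer polynomials

pulse : ℕ → Seq
pulse zero    zero    = 1ℤ
pulse zero    (suc j) = 0ℤ
pulse (suc k) zero    = 0ℤ
pulse (suc k) (suc j) = pulse k j

pulse-act : ∀ p k → (p • pulse k) 0 ≡ coeff p k
pulse-act []      k       = refl
pulse-act (a ∷ p) zero    = trans
  (cong₂ _+_ (ℤ.*-identityʳ a) (trans (sym (act-shift 1 p (pulse 0) 1 0)) (act-zero 1 p (λ _ → refl) 0)))
  (ℤ.+-identityʳ a)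
pulse-act (a ∷ p) (suc k) = trans
  (cong₂ _+_ (ℤ.*-zeroʳ a) (trans (sym (act-shift 1 p (pulse (suc k)) 1 0)) (pulse-act p k)))
  (ℤ.+-identityˡ _)

-- Acting on `pulse k` and evaluating at 0 reads off coefficient k. So the multiplicative laws of
-- ℤ[x] can be checked on operators, where the product is composition.
•-faithful : ∀ p q → (∀ φ i → (p • φ) i ≡ (q • φ) i) → p ≈ₚ q
•-faithful p q p•≗q• k =
  trans (sym (pulse-act p k)) (trans (p•≗q• (pulse k) 0) (pulse-act q k))

act-≈0 : ∀ k p → p ≈ₚ [] → ∀ φ i → act k p φ i ≡ 0ℤ
act-≈0 k []      p≈0 φ i = refl
act-≈0 k (a ∷ p) p≈0 φ i =
  cong₂ _+_ (cong (_* φ i) (p≈0 0)) (act-≈0 k p (p≈0 ∘ suc) φ (k ℕ.+ i))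

act-≈ : ∀ k p q → p ≈ₚ q → ∀ φ i → act k p φ i ≡ act k q φ i
act-≈ k []      q       p≈q φ i = sym (act-≈0 k q (sym ∘ p≈q) φ i)
act-≈ k (a ∷ p) []      p≈q φ i = act-≈0 k (a ∷ p) p≈q φ i
act-≈ k (a ∷ p) (b ∷ q) p≈q φ i =
  cong₂ (λ x y → x * φ i + y) (p≈q 0) (act-≈ k p q (p≈q ∘ suc) φ (k ℕ.+ i))

coeff-+ : ∀ p q k → coeff (p +ₚ q) k ≡ coeff p k + coeff q k
coeff-+ []      q       k       = sym (ℤ.+-identityˡ _)
coeff-+ (a ∷ p) []      k       = sym (ℤ.+-identityʳ _)
coeff-+ (a ∷ p) (b ∷ q) zero    = refl
coeff-+ (a ∷ p) (b ∷ q) (suc k) = coeff-+ p q k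

coeff-scale : ∀ c p k → coeff (scaleₚ c p) k ≡ c * coeff p k
coeff-scale c []      k       = sym (ℤ.*-zeroʳ c)
coeff-scale c (a ∷ p) zero    = refl
coeff-scale c (a ∷ p) (suc k) = coeff-scale c p k

coeff-neg : ∀ p k → coeff (negₚ p) k ≡ - coeff p k
coeff-neg []      k       = refl
coeff-neg (a ∷ p) zero    = refl
coeff-neg (a ∷ p) (suc k) = coeff-neg p k

-- A record, so that p and q can be inferred from a proof of p ≋ q.
infix 4 _≋_
record _≋_ (p q : Poly) : Set where
  constructor mk≋
  field at : p ≈ₚ q
open _≋_ public

1ₚ : Poly
1ₚ = 1ℤ ∷ []

by-action : ∀ {p q} → (∀ φ i → (p • φ) i ≡ (q • φ) i) → p ≋ q
by-action {p} {q} p•≗q• = mk≋ (•-faithful p q p•≗q•)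

action : ∀ {p q} → p ≋ q → ∀ φ i → (p • φ) i ≡ (q • φ) i
action {p} {q} p≋q = act-≈ 1 p q (at p≋q)

polyRing : CommutativeRing 0ℓ 0ℓ
polyRing = record
  { Carrier = Poly ; _≈_ = _≋_ ; _+_ = _+ₚ_ ; _*_ = _*ₚ_ ; -_ = negₚ ; 0# = [] ; 1# = 1ₚ
  ; isCommutativeRing = record
    { isRing = record
      { +-isAbelianGroup = record
        { isGroup = record
          { isMonoid = record
            { isSemigroup = record
              { isMagma = record
                { isEquivalence = record
                  { refl  = mk≋ λ _ → refl
                  ; sym   = λ p≋q → mk≋ (sym ∘ at p≋q)
                  ; trans = λ p≋q q≋r → mk≋ λ k → trans (at p≋q k) (at q≋r k) }
                ; ∙-cong = λ {p} {q} {r} {s} p≋q r≋s → mk≋ λ k →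
                    trans (coeff-+ p r k) (trans (cong₂ _+_ (at p≋q k) (at r≋s k)) (sym (coeff-+ q s k))) }
              ; assoc = λ p q r → mk≋ λ k → trans (coeff-+ (p +ₚ q) r k)
                  (trans (cong (_+ coeff r k) (coeff-+ p q k))
                  (trans (ℤ.+-assoc (coeff p k) (coeff q k) (coeff r k))
                  (sym (trans (coeff-+ p (q +ₚ r) k) (cong (coeff p k +_) (coeff-+ q r k)))))) }
            ; identity = (λ p → mk≋ λ _ → refl)
                       , (λ p → mk≋ λ k → trans (coeff-+ p [] k) (ℤ.+-identityʳ _)) }
          ; inverse = (λ p → mk≋ λ k → trans (coeff-+ (negₚ p) p k)
                        (trans (cong (_+ coeff p k) (coeff-neg p k)) (ℤ.+-inverseˡ (coeff p k))))
                    , (λ p → mk≋ λ k → trans (coeff-+ p (negₚ p) k)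
                        (trans (cong (coeff p k +_) (coeff-neg p k)) (ℤ.+-inverseʳ (coeff p k))))
          ; ⁻¹-cong = λ {p} {q} p≋q → mk≋ λ k →
              trans (coeff-neg p k) (trans (cong -_ (at p≋q k)) (sym (coeff-neg q k))) }
        ; comm = λ p q → mk≋ λ k → trans (coeff-+ p q k)
            (trans (ℤ.+-comm (coeff p k) (coeff q k)) (sym (coeff-+ q p k))) }
      ; *-cong = λ {p} {q} {r} {s} p≋q r≋s → by-action λ φ i →
          trans (act-* 1 p r φ i) (trans (act-cong 1 p (action r≋s φ) i)
          (trans (action p≋q (s • φ) i) (sym (act-* 1 q s φ i))))
      ; *-assoc = λ p q r → by-action λ φ i → trans (act-* 1 (p *ₚ q) r φ i)
          (trans (act-* 1 p q (r • φ) i)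
          (sym (trans (act-* 1 p (q *ₚ r) φ i) (act-cong 1 p (act-* 1 q r φ) i))))
      ; *-identity = identityˡ
                   , (λ p → by-action λ φ i → trans (trans (act-* 1 p 1ₚ φ i) (act-comm 1 1 p 1ₚ φ i))
                       (trans (sym (act-* 1 1ₚ p φ i)) (action (identityˡ p) φ i)))
      ; distrib = (λ p q r → by-action λ φ i → trans (act-* 1 p (q +ₚ r) φ i)
                    (trans (act-cong 1 p (act-+ 1 q r φ) i)
                    (trans (act-+ˢ 1 p (q • φ) (r • φ) i)
                    (sym (trans (act-+ 1 (p *ₚ q) (p *ₚ r) φ i)
                      (cong₂ _+_ (act-* 1 p q φ i) (act-* 1 p r φ i)))))))
                , (λ p q r → by-action λ φ i → trans (act-* 1 (q +ₚ r) p φ i)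
                    (trans (act-+ 1 q r (p • φ) i)
                    (sym (trans (act-+ 1 (q *ₚ p) (r *ₚ p) φ i)
                      (cong₂ _+_ (act-* 1 q p φ i) (act-* 1 r p φ i)))))) }
    ; *-comm = λ p q → by-action λ φ i →
        trans (act-* 1 p q φ i) (trans (act-comm 1 1 p q φ i) (sym (act-* 1 q p φ i))) } }
  where
  identityˡ : ∀ p → 1ₚ *ₚ p ≋ p
  identityˡ p = by-action λ φ i → trans (act-* 1 1ₚ p φ i)
    (trans (ℤ.+-identityʳ _) (ℤ.*-identityˡ _))

module ℤ[x] = CommutativeRing polyRing

*ₚ-congˡ : ∀ p {q r} → q ≋ r → p *ₚ q ≋ p *ₚ r
*ₚ-congˡ p {q} {r} = ℤ[x].*-cong {p} {p} {q} {r} ℤ[x].refl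

*ₚ-congʳ : ∀ r {p q} → p ≋ q → p *ₚ r ≋ q *ₚ r
*ₚ-congʳ r {p} {q} p≋q = ℤ[x].*-cong {p} {q} {r} {r} p≋q ℤ[x].refl

-- Degrees, leading terms and division with remainder

Below : ℕ → Poly → Set
Below m p = ∀ k → m ℕ.≤ k → coeff p k ≡ 0ℤ

Monic : ℕ → Poly → Set
Monic m p = Below (suc m) p × coeff p m ≡ 1ℤ

coeff-*-leading : ∀ p q m k → Below (suc m) p → Below (suc k) q →
  Below (suc (m ℕ.+ k)) (p *ₚ q) × coeff (p *ₚ q) (m ℕ.+ k) ≡ coeff p m * coeff q k
coeff-*-leading [] q m k p< q< = (λ _ _ → refl) , refl
coeff-*-leading (a ∷ p) q zero k p< q< =
    (λ j k<j → trans (coeff-ap*q j) (trans (cong (a *_) (q< j k<j)) (ℤ.*-zeroʳ a)))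
  , coeff-ap*q k
  where
  p*q≈0 : p *ₚ q ≋ []
  p*q≈0 = by-action λ φ i → trans (act-* 1 p q φ i) (act-≈0 1 p (λ j → p< (suc j) (s≤s z≤n)) (q • φ) i)
  coeff-ap*q : ∀ j → coeff ((a ∷ p) *ₚ q) j ≡ a * coeff q j
  coeff-ap*q j = trans (coeff-+ (scaleₚ a q) (0ℤ ∷ p *ₚ q) j)
    (trans (cong₂ _+_ (coeff-scale a q j) (tail j)) (ℤ.+-identityʳ _))
    where
    tail : ∀ j → coeff (0ℤ ∷ p *ₚ q) j ≡ 0ℤ
    tail zero    = refl
    tail (suc j) = at p*q≈0 j
coeff-*-leading (a ∷ p) q (suc m) k p< q<
  with coeff-*-leading p q m k (λ j m<j → p< (suc j) (s≤s m<j)) q<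
... | pq< , pq-top = below , trans (coeff-suc (m ℕ.+ k) (s≤s (ℕ.m≤n+m k m))) pq-top
  where
  coeff-suc : ∀ j → suc k ℕ.≤ suc j → coeff ((a ∷ p) *ₚ q) (suc j) ≡ coeff (p *ₚ q) j
  coeff-suc j k<j = trans (coeff-+ (scaleₚ a q) (0ℤ ∷ p *ₚ q) (suc j))
    (trans (cong (_+ coeff (p *ₚ q) j)
      (trans (coeff-scale a q (suc j)) (trans (cong (a *_) (q< (suc j) k<j)) (ℤ.*-zeroʳ a))))
      (ℤ.+-identityˡ _))
  below : Below (suc (suc m ℕ.+ k)) ((a ∷ p) *ₚ q)
  below (suc j) (s≤s m+k<j) =
    trans (coeff-suc j (s≤s (ℕ.≤-trans (ℕ.m≤n+m k (suc m)) m+k<j))) (pq< j m+k<j)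

monic-* : ∀ {p q m k} → Monic m p → Monic k q → Monic (m ℕ.+ k) (p *ₚ q)
monic-* {p} {q} {m} {k} (p< , p-top) (q< , q-top) with coeff-*-leading p q m k p< q<
... | pq< , pq-top = pq< , trans pq-top (cong₂ _*_ p-top q-top)

monic-≋ : ∀ {p q m} → p ≋ q → Monic m p → Monic m q
monic-≋ p≋q (p< , p-top) = (λ k m<k → trans (sym (at p≋q k)) (p< k m<k)) , trans (sym (at p≋q _)) p-top

monic-unique : ∀ {p m k} → Monic m p → Monic k p → m ≡ k
monic-unique {p} {m} {k} (m< , m-top) (k< , k-top) with ℕ.<-cmp m k
... | tri≈ _ m≡k _ = m≡k
... | tri< m<k _ _ = ⊥-elim (absurd (trans (sym k-top) (m< k m<k)))
  where
  absurd : 1ℤ ≢ 0ℤ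
  absurd ()
... | tri> _ _ k<m = ⊥-elim (absurd (trans (sym m-top) (k< m k<m)))
  where
  absurd : 1ℤ ≢ 0ℤ
  absurd ()

LeadingTerm : Poly → ℕ → ℤ → Set
LeadingTerm p m l = Below (suc m) p × coeff p m ≡ l × l ≢ 0ℤ

zero⊎leadingTerm : ∀ p → p ≈ₚ [] ⊎ (∃[ m ] ∃[ l ] LeadingTerm p m l)
zero⊎leadingTerm [] = inj₁ λ _ → refl
zero⊎leadingTerm (a ∷ p) with zero⊎leadingTerm p
... | inj₂ (m , l , p< , p-top , l≢0) =
  inj₂ (suc m , l , (λ { (suc k) (s≤s m<k) → p< k m<k }) , p-top , l≢0)
... | inj₁ p≈0 with a ℤ.≟ 0ℤ
...   | yes a≡0 = inj₁ λ { zero → a≡0 ; (suc k) → p≈0 k }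
...   | no a≢0  = inj₂ (0 , a , (λ { (suc k) _ → p≈0 k }) , refl , a≢0)

leadingTerm-* : ∀ {p q m k l} → Monic m p → LeadingTerm q k l → LeadingTerm (p *ₚ q) (m ℕ.+ k) l
leadingTerm-* {p} {q} {m} {k} {l} (p< , p-top) (q< , q-top , l≢0)
  with coeff-*-leading p q m k p< q<
... | pq< , pq-top = pq< , trans pq-top (trans (cong₂ _*_ p-top q-top) (ℤ.*-identityˡ l)) , l≢0

monic-cancel : ∀ {p q m} → Monic m p → p *ₚ q ≈ₚ [] → q ≈ₚ []
monic-cancel {p} {q} {m} p-monic pq≈0 with zero⊎leadingTerm q
... | inj₁ q≈0 = q≈0
... | inj₂ (k , l , q-top) with leadingTerm-* {p} {q} p-monic q-top
...   | _ , pq-top , l≢0 = ⊥-elim (l≢0 (trans (sym pq-top) (pq≈0 _)))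

*-cons : ∀ p b q → p *ₚ (b ∷ q) ≋ scaleₚ b p +ₚ (0ℤ ∷ p *ₚ q)
*-cons p b q = by-action λ φ i → begin
  ((p *ₚ (b ∷ q)) • φ) i
    ≡⟨ act-* 1 p (b ∷ q) φ i ⟩
  (p • (λ j → b * φ j + (q • φ) (suc j))) i
    ≡⟨ act-+ˢ 1 p (λ j → b * φ j) (λ j → (q • φ) (suc j)) i ⟩
  (p • (λ j → b * φ j)) i + (p • (λ j → (q • φ) (suc j))) i
    ≡⟨ cong₂ _+_ (act-*ˢ 1 p b φ i) (act-shift 1 p (q • φ) 1 i) ⟩
  b * (p • φ) i + (p • (q • φ)) (suc i)
    ≡⟨ cong₂ _+_ (sym (act-scale 1 b p φ i)) (sym (trans (ℤ.+-identityˡ _) (act-* 1 p q φ (suc i)))) ⟩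
  (scaleₚ b p • φ) i + ((0ℤ ∷ p *ₚ q) • φ) i
    ≡⟨ sym (act-+ 1 (scaleₚ b p) (0ℤ ∷ p *ₚ q) φ i) ⟩
  ((scaleₚ b p +ₚ (0ℤ ∷ p *ₚ q)) • φ) i ∎
  where open ≡-Reasoning

-- Horner's scheme: if the tail p is M q + r, then a + x r has degree at most m, and subtracting a
-- multiple of M lowers it. As M is monic, that multiple is the coefficient at m itself.
divMod-monic : ∀ {m M} → Monic m M → ∀ p → ∃[ q ] ∃[ r ] (p ≋ M *ₚ q +ₚ r × Below m r)
divMod-monic {m} {M} _ [] = [] , [] , by-action (λ φ i → sym (trans (act-+ 1 (M *ₚ []) [] φ i)
  (trans (ℤ.+-identityʳ _) (trans (act-* 1 M [] φ i) (act-zero 1 M (λ _ → refl) i))))) , λ _ _ → refl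
divMod-monic {m} {M} (M< , M-top) (a ∷ p) with divMod-monic {m} {M} (M< , M-top) p
... | q , r , p≋ , r< = (c ∷ q) , s -ₚ scaleₚ c M , mk≋ eq , below
  where
  open ≡-Reasoning
  s = a ∷ r
  c = coeff s m
  s< : Below (suc m) s
  s< (suc k) (s≤s m≤k) = r< k m≤k
  coeff-rem : ∀ k → coeff (s -ₚ scaleₚ c M) k ≡ coeff s k + - (c * coeff M k)
  coeff-rem k = trans (coeff-+ s (negₚ (scaleₚ c M)) k)
    (cong (coeff s k +_) (trans (coeff-neg (scaleₚ c M) k) (cong -_ (coeff-scale c M k))))
  below : Below m (s -ₚ scaleₚ c M)
  below k m≤k with ℕ.m≤n⇒m<n∨m≡n m≤k
  ... | inj₁ m<k  = trans (coeff-rem k)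
    (cong₂ (λ x y → x + - y) (s< k m<k) (trans (cong (c *_) (M< k m<k)) (ℤ.*-zeroʳ c)))
  ... | inj₂ refl = trans (coeff-rem m)
    (trans (cong (λ x → c + - x) (trans (cong (c *_) M-top) (ℤ.*-identityʳ c))) (ℤ.+-inverseʳ c))
  cancel : ∀ x y z → (x + y) + (z + - x) ≡ y + z
  cancel = solve-∀
  parts : ∀ k → coeff (0ℤ ∷ M *ₚ q) k + coeff s k ≡ coeff (a ∷ p) k
  parts zero    = ℤ.+-identityˡ a
  parts (suc k) = sym (trans (at p≋ k) (coeff-+ (M *ₚ q) r k))
  eq : (a ∷ p) ≈ₚ M *ₚ (c ∷ q) +ₚ (s -ₚ scaleₚ c M)
  eq k = sym (begin
    coeff (M *ₚ (c ∷ q) +ₚ (s -ₚ scaleₚ c M)) k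
      ≡⟨ coeff-+ (M *ₚ (c ∷ q)) (s -ₚ scaleₚ c M) k ⟩
    coeff (M *ₚ (c ∷ q)) k + coeff (s -ₚ scaleₚ c M) k
      ≡⟨ cong₂ _+_ (trans (at (*-cons M c q) k) (coeff-+ (scaleₚ c M) (0ℤ ∷ M *ₚ q) k)) (coeff-rem k) ⟩
    (coeff (scaleₚ c M) k + coeff (0ℤ ∷ M *ₚ q) k) + (coeff s k + - (c * coeff M k))
      ≡⟨ cong (λ x → (x + coeff (0ℤ ∷ M *ₚ q) k) + (coeff s k + - (c * coeff M k))) (coeff-scale c M k) ⟩
    (c * coeff M k + coeff (0ℤ ∷ M *ₚ q) k) + (coeff s k + - (c * coeff M k))
      ≡⟨ cancel (c * coeff M k) _ (coeff s k) ⟩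
    coeff (0ℤ ∷ M *ₚ q) k + coeff s k
      ≡⟨ parts k ⟩
    coeff (a ∷ p) k ∎)

strip-≈ : ∀ p → strip p ≋ p
strip-≈ [] = mk≋ λ _ → refl
strip-≈ (c ∷ p) with strip p | strip-≈ p
... | a ∷ q | q≋p = mk≋ λ { zero → refl ; (suc k) → at q≋p k }
... | []    | q≋p with c ℤ.≟ 0ℤ
...   | yes c≡0 = mk≋ λ { zero → sym c≡0 ; (suc k) → at q≋p k }
...   | no  _   = mk≋ λ { zero → refl ; (suc k) → at q≋p k }

strip-zero : ∀ p → p ≈ₚ [] → strip p ≡ []
strip-zero [] _ = refl
strip-zero (c ∷ p) p≈0 rewrite strip-zero p (p≈0 ∘ suc) with c ℤ.≟ 0ℤ
... | yes _  = refl
... | no c≢0 = ⊥-elim (c≢0 (p≈0 0))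

strip-leading : ∀ p {m l} → LeadingTerm p m l →
  List.length (strip p) ≡ suc m × lastℤ (strip p) ≡ l
strip-leading [] (_ , 0≡l , l≢0) = ⊥-elim (l≢0 (sym 0≡l))
strip-leading (c ∷ p) {zero} (p< , c≡l , l≢0)
  rewrite strip-zero p (λ k → p< (suc k) (s≤s z≤n)) with c ℤ.≟ 0ℤ
... | yes c≡0 = ⊥-elim (l≢0 (trans (sym c≡l) c≡0))
... | no _    = refl , c≡l
strip-leading (c ∷ p) {suc m} (p< , p-top , l≢0)
  with strip p | strip-leading p ((λ k m<k → p< (suc k) (s≤s m<k)) , p-top , l≢0)
... | a ∷ q | len , last = cong suc len , last

-- Cyclotomic polynomials

Periodic : ℕ → Seq → Set
Periodic n φ = ∀ i → φ (n ℕ.+ i) ≡ φ i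

infix 4 _kills_
_kills_ : Poly → Seq → Set
p kills φ = ∀ i → (p • φ) i ≡ 0ℤ

kills-• : ∀ {p φ} q → p kills φ → p kills (q • φ)
kills-• {p} {φ} q = act-kills 1 p 1 q φ

*-kills : ∀ p q {φ} → p kills (q • φ) → (p *ₚ q) kills φ
*-kills p q {φ} pqφ≗0 i = trans (act-* 1 p q φ i) (pqφ≗0 i)

*-kills⁻¹ : ∀ p q {φ} → (p *ₚ q) kills φ → p kills (q • φ)
*-kills⁻¹ p q {φ} pqφ≗0 i = trans (sym (act-* 1 p q φ i)) (pqφ≗0 i)

kills-≋ : ∀ {p q φ} → p ≋ q → p kills φ → q kills φ
kills-≋ p≋q pφ≗0 i = trans (sym (action p≋q _ i)) (pφ≗0 i)

-- Divisibility as a record, for the same reason as _≋_.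
infix 4 _∣ᵖ_
record _∣ᵖ_ (p q : Poly) : Set where
  constructor divides
  field
    quotient : Poly
    equality : p *ₚ quotient ≋ q

∣-kills : ∀ {p q φ} → p ∣ᵖ q → p kills φ → q kills φ
∣-kills {p} {q} {φ} (divides r pr≋q) pφ≗0 =
  kills-≋ {p *ₚ r} {q} {φ} pr≋q (*-kills p r {φ} (kills-• {p} {φ} r pφ≗0))

periodic-∣ : ∀ {m n φ} → m ∣ n → Periodic m φ → Periodic n φ
periodic-∣ {m} {_} {φ} (ℕ.divides q refl) φ-periodic = go q
  where
  go : ∀ q → Periodic (q ℕ.* m) φ
  go zero    i = refl
  go (suc q) i = trans (cong φ (ℕ.+-assoc m (q ℕ.* m) i)) (trans (φ-periodic (q ℕ.* m ℕ.+ i)) (go q i))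

periodic-∸ : ∀ {d m n φ} → d ℕ.+ m ≡ n → Periodic m φ → Periodic n φ → Periodic d φ
periodic-∸ {d} {m} {_} {φ} refl φm φn i = trans (sym (φm (d ℕ.+ i)))
  (trans (cong φ (trans (sym (ℕ.+-assoc m d i)) (cong (ℕ._+ i) (ℕ.+-comm m d)))) (φn i))

periodic-gcd : ∀ {m n φ} → Periodic m φ → Periodic n φ → Periodic (gcd m n) φ
periodic-gcd {m} {n} {φ} φm φn with Bézout.identity (gcd-GCD m n)
... | Bézout.+- x y eq = periodic-∸ {φ = φ} eq (periodic-∣ {φ = φ} (ℕ.n∣m*n y) φn) (periodic-∣ {φ = φ} (ℕ.n∣m*n x) φm)
... | Bézout.-+ x y eq = periodic-∸ {φ = φ} eq (periodic-∣ {φ = φ} (ℕ.n∣m*n x) φm) (periodic-∣ {φ = φ} (ℕ.n∣m*n y) φn)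

periodic-• : ∀ {n φ} p → Periodic n φ → Periodic n (p • φ)
periodic-• {n} {φ} p φn i = trans (sym (act-shift 1 p φ n i)) (act-cong 1 p φn i)

opaque
  xⁿ-1 : ℕ → Poly
  xⁿ-1 n = xpow n -ₚ 1ₚ

  xⁿ-1-≡ : ∀ n → xⁿ-1 n ≡ xpow n -ₚ 1ₚ
  xⁿ-1-≡ n = refl

xpow-act : ∀ n φ i → (xpow n • φ) i ≡ φ (n ℕ.+ i)
xpow-act zero    φ i = trans (ℤ.+-identityʳ _) (ℤ.*-identityˡ _)
xpow-act (suc n) φ i = trans (ℤ.+-identityˡ _) (trans (xpow-act n φ (suc i)) (cong φ (ℕ.+-suc n i)))

xⁿ-1-act : ∀ n φ i → (xⁿ-1 n • φ) i ≡ φ (n ℕ.+ i) - φ i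
xⁿ-1-act n φ i = trans (cong (λ p → (p • φ) i) (xⁿ-1-≡ n)) (trans (act-- 1 (xpow n) 1ₚ φ i)
  (cong₂ _-_ (xpow-act n φ i) (xpow-act 0 φ i)))

xⁿ-1-kills⇒periodic : ∀ n {φ} → xⁿ-1 n kills φ → Periodic n φ
xⁿ-1-kills⇒periodic n {φ} kills i =
  ℤ.i-j≡0⇒i≡j (φ (n ℕ.+ i)) (φ i) (trans (sym (xⁿ-1-act n φ i)) (kills i))

periodic⇒xⁿ-1-kills : ∀ n {φ} → Periodic n φ → xⁿ-1 n kills φ
periodic⇒xⁿ-1-kills n {φ} φn i = trans (xⁿ-1-act n φ i) (ℤ.i≡j⇒i-j≡0 (φn i))

coeff-xpow : ∀ n → Monic n (xpow n)
coeff-xpow zero    = (λ { (suc k) _ → refl }) , refl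
coeff-xpow (suc n) = (λ { (suc k) (s≤s n<k) → proj₁ (coeff-xpow n) k n<k }) , proj₂ (coeff-xpow n)

xⁿ-1-monic : ∀ n → Monic (suc n) (xⁿ-1 (suc n))
xⁿ-1-monic n = (λ { (suc k) (s≤s n<k) → trans (same k) (proj₁ (coeff-xpow n) k n<k) })
             , trans (same n) (proj₂ (coeff-xpow n))
  where
  same : ∀ k → coeff (xⁿ-1 (suc n)) (suc k) ≡ coeff (xpow n) k
  same k = trans (cong (λ p → coeff p (suc k)) (xⁿ-1-≡ (suc n))) (trans (coeff-+ (xpow n) [] k) (ℤ.+-identityʳ _))

-- Exactness of the division that defines cyclotomic polynomials

divMonic-step : ∀ fuel f g {k l} → (List.length (strip f) ℕ.<ᵇ List.length g) ≡ false →
  List.length (strip f) ℕ.∸ List.length g ≡ k → lastℤ (strip f) ≡ l →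
  divMonic (suc fuel) f g ≡
    scaleₚ l (xpow k) +ₚ divMonic fuel (strip (strip f -ₚ scaleₚ l (xpow k) *ₚ g)) g
divMonic-step fuel f g f≮g refl refl with List.length (strip f) ℕ.<ᵇ List.length g | f≮g
... | false | refl = refl

<ᵇ-false : ∀ a b → (suc (a ℕ.+ b) ℕ.<ᵇ suc a) ≡ false
<ᵇ-false zero    b = refl
<ᵇ-false (suc a) b = <ᵇ-false a b

-- Since g is monic, the leading term of f is that of h up to a shift, so each step of `divMonic`
-- removes the leading term of the true quotient h. It is enough that the fuel exceeds the degree of
-- h.
divMonic-exact : ∀ fuel f g h {a} → Monic a g → List.length g ≡ suc a →
  f ≋ g *ₚ h → Below fuel h → divMonic fuel f g ≋ h
divMonic-exact zero f g h g-monic len f≋gh h< = mk≋ λ k → sym (h< k z≤n)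
divMonic-exact (suc fuel) f g h {a} g-monic len f≋gh h< with zero⊎leadingTerm h
... | inj₁ h≈0 rewrite strip-zero f (at (ℤ[x].trans f≋gh (ℤ[x].trans (*ₚ-congˡ g (mk≋ h≈0)) (ℤ[x].zeroʳ g)))) | len = mk≋ (sym ∘ h≈0)
... | inj₂ (b , l , h-top) = ℤ[x].trans (ℤ[x].reflexive step)
  (ℤ[x].trans (ℤ[x].+-congˡ (divMonic-exact fuel f′ g (h -ₚ t) g-monic len f′≋ h-t<))
    (mk≋ λ k → trans (coeff-+ t (h -ₚ t) k) (trans (cong (coeff t k +_) (coeff-h-t k))
      (add-sub (coeff t k) (coeff h k)))))
  where
  add-sub : ∀ x y → x + (y + - x) ≡ y
  add-sub = solve-∀
  t = scaleₚ l (xpow b)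
  f′ = strip (strip f -ₚ t *ₚ g)
  f-top : LeadingTerm f (a ℕ.+ b) l
  f-top with leadingTerm-* {g} {h} g-monic h-top
  ... | gh< , gh-top , l≢0 = (λ k lt → trans (at f≋gh k) (gh< k lt)) , trans (at f≋gh _) gh-top , l≢0
  f-len = proj₁ (strip-leading f f-top)
  f-last = proj₂ (strip-leading f f-top)
  step : divMonic (suc fuel) f g ≡ t +ₚ divMonic fuel f′ g
  step = divMonic-step fuel f g
    (trans (cong₂ ℕ._<ᵇ_ f-len len) (<ᵇ-false a b))
    (trans (cong₂ ℕ._∸_ f-len len) (ℕ.m+n∸m≡n a b)) f-last
  f′≋ : f′ ≋ g *ₚ (h -ₚ t)
  f′≋ = by-action λ φ i → begin
    (f′ • φ) i
      ≡⟨ action (strip-≈ (strip f -ₚ t *ₚ g)) φ i ⟩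
    ((strip f -ₚ t *ₚ g) • φ) i
      ≡⟨ act-- 1 (strip f) (t *ₚ g) φ i ⟩
    (strip f • φ) i - ((t *ₚ g) • φ) i
      ≡⟨ cong₂ _-_ (action (ℤ[x].trans (strip-≈ f) f≋gh) φ i) (action (ℤ[x].*-comm t g) φ i) ⟩
    ((g *ₚ h) • φ) i - ((g *ₚ t) • φ) i
      ≡⟨ sym (act-- 1 (g *ₚ h) (g *ₚ t) φ i) ⟩
    ((g *ₚ h -ₚ g *ₚ t) • φ) i
      ≡⟨ action (ℤ[x].sym (distrib-- g h t)) φ i ⟩
    ((g *ₚ (h -ₚ t)) • φ) i ∎
    where
    open ≡-Reasoning
    open import Algebra.Properties.Ring ℤ[x].ring using (-‿distribʳ-*)
    distrib-- : ∀ x y z → x *ₚ (y -ₚ z) ≋ x *ₚ y -ₚ x *ₚ z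
    distrib-- x y z = ℤ[x].trans (ℤ[x].distribˡ x y (negₚ z)) (ℤ[x].+-congˡ (ℤ[x].sym (-‿distribʳ-* x z)))
  coeff-h-t : ∀ k → coeff (h -ₚ t) k ≡ coeff h k + - coeff t k
  coeff-h-t k = trans (coeff-+ h (negₚ t) k) (cong (coeff h k +_) (coeff-neg t k))
  b≤fuel : b ℕ.≤ fuel
  b≤fuel with b ℕ.≤? fuel
  ... | yes b≤fuel = b≤fuel
  ... | no b≰fuel  = ⊥-elim (proj₂ (proj₂ h-top)
    (trans (sym (proj₁ (proj₂ h-top))) (h< b (ℕ.≰⇒> b≰fuel))))
  h-t< : Below fuel (h -ₚ t)
  h-t< k fuel≤k with ℕ.m≤n⇒m<n∨m≡n (ℕ.≤-trans b≤fuel fuel≤k)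
  ... | inj₁ b<k = trans (coeff-h-t k) (cong₂ (λ x y → x + - y) (proj₁ h-top k b<k)
    (trans (coeff-scale l (xpow b) k) (trans (cong (l *_) (proj₁ (coeff-xpow b) k b<k)) (ℤ.*-zeroʳ l))))
  ... | inj₂ refl = trans (coeff-h-t k) (trans (cong₂ (λ x y → x + - y) (proj₁ (proj₂ h-top))
    (trans (coeff-scale l (xpow b) b) (trans (cong (l *_) (proj₂ (coeff-xpow b))) (ℤ.*-identityʳ l))))
    (ℤ.+-inverseʳ l))

cycloTable-keys : ∀ k → All (λ entry → proj₁ entry ℕ.≤ k) (cycloTable k)
cycloTable-keys zero    = []
cycloTable-keys (suc k) =
  All.++⁺ (All.map ℕ.m≤n⇒m≤1+n (cycloTable-keys k)) (ℕ.≤-refl ∷ [])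

lookupCyclo-++ : ∀ d T v → All (λ entry → proj₁ entry ≢ d) T → lookupCyclo d (T ++ (d , v) ∷ []) ≡ v
lookupCyclo-++ d [] v [] rewrite dec-true (d ℕ.≟ d) refl = refl
lookupCyclo-++ d ((e , φ) ∷ T) v (e≢d ∷ T≢d) rewrite dec-false (e ℕ.≟ d) e≢d = lookupCyclo-++ d T v T≢d

opaque
  -- Φ, kept from unfolding into its table.
  cyclotomic : ℕ → Poly
  cyclotomic = Φ

  cyclotomic≡Φ : ∀ d → cyclotomic d ≡ Φ d
  cyclotomic≡Φ d = refl

-- The product of the `Φ e` over the divisors e ≤ k of d. At k = d - 1 it is the denominator in the
-- recursion for `Φ d`, at k = d it will turn out to be x^d - 1.
Φ∏ : ℕ → ℕ → Poly
Φ∏ d zero    = 1ₚ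
Φ∏ d (suc k) = if does (suc k ∣? d) then Φ∏ d k *ₚ cyclotomic (suc k) else Φ∏ d k

Φ∏-∣ : ∀ d k → suc k ∣ d → Φ∏ d (suc k) ≡ Φ∏ d k *ₚ cyclotomic (suc k)
Φ∏-∣ d k k∣d rewrite dec-true (suc k ∣? d) k∣d = refl

Φ∏-∤ : ∀ d k → suc k ∤ d → Φ∏ d (suc k) ≡ Φ∏ d k
Φ∏-∤ d k k∤d rewrite dec-false (suc k ∣? d) k∤d = refl

Φ-last : ∀ k {v} → cycloTable (suc k) ≡ cycloTable k ++ (suc k , v) ∷ [] → cyclotomic (suc k) ≡ v
Φ-last k {v} eq = trans (cyclotomic≡Φ (suc k)) (trans (cong (lookupCyclo (suc k)) eq) (lookupCyclo-++ (suc k) (cycloTable k) v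
  (All.map (λ e≤k e≡ → ℕ.<-irrefl e≡ (s≤s e≤k)) (cycloTable-keys k))))

-- Here f stands for the anonymous function that `cycloTable` folds with, known through its
-- equation.
foldr-cycloTable : ∀ d (f : ℕ × Poly → Poly → Poly) →
  (∀ e φ acc → f (e , φ) acc ≡ (if does (e ∣? d) then φ *ₚ acc else acc)) →
  ∀ k acc → List.foldr f acc (cycloTable k) ≋ Φ∏ d k *ₚ acc
foldr-cycloTable d f f≡ zero acc = ℤ[x].sym (ℤ[x].*-identityˡ acc)
foldr-cycloTable d f f≡ (suc k) acc = ℤ[x].trans
  (ℤ[x].reflexive (List.foldr-++ f acc (cycloTable k) _))
  (ℤ[x].trans (foldr-cycloTable d f f≡ k _) (last _ (Φ-last k refl)))
  where
  last : ∀ v → cyclotomic (suc k) ≡ v → Φ∏ d k *ₚ f (suc k , v) acc ≋ Φ∏ d (suc k) *ₚ acc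
  last v refl rewrite f≡ (suc k) v acc with does (suc k ∣? d)
  ... | true  = ℤ[x].sym (ℤ[x].*-assoc (Φ∏ d k) (cyclotomic (suc k)) acc)
  ... | false = ℤ[x].refl

Φ-unfold : ∀ k → ∃[ D ] (D ≋ Φ∏ (suc k) k ×
  cyclotomic (suc k) ≡ divMonic (suc (suc (suc k))) (xⁿ-1 (suc k)) (strip D))
Φ-unfold k rewrite xⁿ-1-≡ (suc k) =
  _ , ℤ[x].trans (foldr-cycloTable (suc k) _ (λ _ _ _ → refl) k 1ₚ) (ℤ[x].*-identityʳ _) , Φ-last k refl

∣ᵖ-refl : ∀ {p} → p ∣ᵖ p
∣ᵖ-refl {p} = divides 1ₚ (ℤ[x].*-identityʳ p)

∣ᵖ-trans : ∀ {p q r} → p ∣ᵖ q → q ∣ᵖ r → p ∣ᵖ r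
∣ᵖ-trans {p} (divides s ps≋q) (divides t qt≋r) = divides (s *ₚ t)
  (ℤ[x].trans (ℤ[x].sym (ℤ[x].*-assoc p s t)) (ℤ[x].trans (*ₚ-congʳ t ps≋q) qt≋r))

∣ᵖ-*ʳ : ∀ p q → p ∣ᵖ p *ₚ q
∣ᵖ-*ʳ p q = divides q ℤ[x].refl

∣ᵖ-respˡ : ∀ {p p′ q} → p ≋ p′ → p ∣ᵖ q → p′ ∣ᵖ q
∣ᵖ-respˡ p≋p′ (divides r pr≋q) = divides r (ℤ[x].trans (*ₚ-congʳ r (ℤ[x].sym p≋p′)) pr≋q)

∣ᵖ-*-mono : ∀ {p q} r → p ∣ᵖ q → p *ₚ r ∣ᵖ q *ₚ r
∣ᵖ-*-mono {p} {q} r (divides s ps≋q) = divides s (begin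
  p *ₚ r *ₚ s   ≈⟨ ℤ[x].*-assoc p r s ⟩
  p *ₚ (r *ₚ s) ≈⟨ *ₚ-congˡ p (ℤ[x].*-comm r s) ⟩
  p *ₚ (s *ₚ r) ≈⟨ ℤ[x].sym (ℤ[x].*-assoc p s r) ⟩
  p *ₚ s *ₚ r   ≈⟨ *ₚ-congʳ r ps≋q ⟩
  q *ₚ r        ∎)
  where open import Relation.Binary.Reasoning.Setoid ℤ[x].setoid

Φ∏-mono : ∀ d {i j} → i ℕ.≤′ j → Φ∏ d i ∣ᵖ Φ∏ d j
Φ∏-mono d ℕ.≤′-refl = ∣ᵖ-refl
Φ∏-mono d {i} (ℕ.≤′-step {j} i≤j) with suc j ∣? d
... | yes j∣d rewrite Φ∏-∣ d j j∣d =
  ∣ᵖ-trans (Φ∏-mono d i≤j) (∣ᵖ-*ʳ (Φ∏ d j) (cyclotomic (suc j)))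
... | no  j∤d rewrite Φ∏-∤ d j j∤d = Φ∏-mono d i≤j

Φ∏-divisor : ∀ {g d} → g ∣ d → ∀ k → Φ∏ g k ∣ᵖ Φ∏ d k
Φ∏-divisor g∣d zero = ∣ᵖ-refl
Φ∏-divisor {g} {d} g∣d (suc k) with suc k ∣? g
... | yes k∣g rewrite Φ∏-∣ g k k∣g | Φ∏-∣ d k (ℕ.∣-trans k∣g g∣d) =
  ∣ᵖ-*-mono (cyclotomic (suc k)) (Φ∏-divisor g∣d k)
... | no k∤g rewrite Φ∏-∤ g k k∤g =
  ∣ᵖ-trans (Φ∏-divisor g∣d k) (Φ∏-mono d (ℕ.≤′-step ℕ.≤′-refl))

-- Indexed by k = d - 1, which keeps d positive.
record Factorised (k : ℕ) : Set where
  field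
    degree  : ℕ
    monic   : Monic degree (cyclotomic (suc k))
    Φ*Φ∏    : cyclotomic (suc k) *ₚ Φ∏ (suc k) k ≋ xⁿ-1 (suc k)

  Φ∏≋xⁿ-1 : Φ∏ (suc k) (suc k) ≋ xⁿ-1 (suc k)
  Φ∏≋xⁿ-1 rewrite Φ∏-∣ (suc k) k ℕ.∣-refl = ℤ[x].trans (ℤ[x].*-comm (Φ∏ (suc k) k) (cyclotomic (suc k))) Φ*Φ∏

  killed⇒periodic : ∀ {φ} → cyclotomic (suc k) kills φ → Periodic (suc k) φ
  killed⇒periodic {φ} Φφ≗0 = xⁿ-1-kills⇒periodic (suc k)
    (∣-kills {cyclotomic (suc k)} {xⁿ-1 (suc k)} {φ} (divides (Φ∏ (suc k) k) Φ*Φ∏) Φφ≗0)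

-- The divisors of a proper divisor g of c are among the proper divisors of c, so x^g - 1 divides
-- the product that complements `Φ c` in x^c - 1.
cofactor : ∀ k g′ → Factorised k → Factorised g′ → suc g′ ∣ suc k → g′ ℕ.< k →
  ∃[ R ] (cyclotomic (suc k) *ₚ R *ₚ xⁿ-1 (suc g′) ≋ xⁿ-1 (suc k))
cofactor k g′ Fk Fg g∣c g<c with ∣ᵖ-respˡ (Factorised.Φ∏≋xⁿ-1 Fg)
  (∣ᵖ-trans (Φ∏-divisor g∣c (suc g′)) (Φ∏-mono (suc k) (ℕ.≤⇒≤′ g<c)))
... | divides R XR≋ = R , (begin
  cyclotomic (suc k) *ₚ R *ₚ xⁿ-1 (suc g′)   ≈⟨ ℤ[x].*-assoc (cyclotomic (suc k)) R _ ⟩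
  cyclotomic (suc k) *ₚ (R *ₚ xⁿ-1 (suc g′)) ≈⟨ *ₚ-congˡ (cyclotomic (suc k)) (ℤ[x].trans (ℤ[x].*-comm R (xⁿ-1 (suc g′)))
    XR≋) ⟩
  cyclotomic (suc k) *ₚ Φ∏ (suc k) k         ≈⟨ Factorised.Φ*Φ∏ Fk ⟩
  xⁿ-1 (suc k)                      ∎)
  where open import Relation.Binary.Reasoning.Setoid ℤ[x].setoid

-- A g-periodic ψ is (S^g - 1) θ for θ i = ⌊i / g⌋ ψ i, so for g ∣ c the sequence (S^c - 1) θ
-- is both (c / g) ψ and, when g < c, a sequence killed by a multiple of cyclotomic c.
killed∧periodic-divisor⇒zero : ∀ k g′ {ψ} → Factorised k → Factorised g′ → suc g′ ∣ suc k → g′ ℕ.< k →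
  cyclotomic (suc k) kills ψ → Periodic (suc g′) ψ → ∀ i → ψ i ≡ 0ℤ
killed∧periodic-divisor⇒zero k g′ {ψ} Fk Fg g∣c@(ℕ.divides q c≡qg) g<c Φψ≗0 ψg i =
  cancel-nonzero q≢0 (begin
    ℤ.+ q * ψ i
      ≡⟨ regroup (ℤ.+ q) (ℤ.+ (i / g)) (ψ i) ⟩
    (ℤ.+ q + ℤ.+ (i / g)) * ψ i - θ i
      ≡⟨ cong₂ (λ a b → a * b - θ i) (cong ℤ.+_ (sym c+i/g)) (sym (periodic-∣ {φ = ψ} g∣c ψg i)) ⟩
    θ (c ℕ.+ i) - θ i
      ≡⟨ sym (xⁿ-1-act c θ i) ⟩
    (xⁿ-1 c • θ) i
      ≡⟨ sym (action (proj₂ cof) θ i) ⟩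
    ((cyclotomic c *ₚ R *ₚ xⁿ-1 g) • θ) i
      ≡⟨ trans (act-* 1 (cyclotomic c *ₚ R) (xⁿ-1 g) θ i) (act-cong 1 (cyclotomic c *ₚ R) Xθ i) ⟩
    ((cyclotomic c *ₚ R) • ψ) i
      ≡⟨ *-kills (cyclotomic c) R {ψ} (kills-• {cyclotomic c} {ψ} R Φψ≗0) i ⟩
    0ℤ ∎)
  where
  open ≡-Reasoning
  c = suc k
  g = suc g′
  θ : Seq
  θ i = ℤ.+ (i / g) * ψ i
  cof = cofactor k g′ Fk Fg g∣c g<c
  R = proj₁ cof
  q≢0 : ℤ.+ q ≢ 0ℤ
  q≢0 q≡0 = ℕ.1+n≢0 (trans c≡qg (cong (ℕ._* g) (ℤ.+-injective q≡0)))
  c+i/g : (c ℕ.+ i) / g ≡ q ℕ.+ i / g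
  c+i/g = trans (ℕ.+-distrib-/-∣ˡ i g∣c)
    (cong (ℕ._+ i / g) (trans (cong (_/ g) c≡qg) (ℕ.m*n/n≡m q g)))
  regroup : ∀ a b x → a * x ≡ (a + b) * x - b * x
  regroup = solve-∀
  Xθ : ∀ j → (xⁿ-1 g • θ) j ≡ ψ j
  Xθ j = trans (xⁿ-1-act g θ j) (trans
    (cong₂ (λ a b → ℤ.+ a * b - θ j)
      (trans (ℕ.+-distrib-/-∣ˡ j (ℕ.∣-refl {g})) (cong (ℕ._+ j / g) (ℕ.n/n≡1 g))) (ψg j))
    (trans (sym (regroup 1ℤ (ℤ.+ (j / g)) (ψ j))) (ℤ.*-identityˡ (ψ j))))

-- Stands in for the coprimality of `Φ c` and x^j - 1, where c = k + 1. The sequence has period c as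
-- well, hence period gcd c j, a proper divisor of c.
killed∧periodic⇒zero : ∀ k {ψ} j → (∀ i → i ℕ.≤ k → Factorised i) → cyclotomic (suc k) kills ψ →
  Periodic j ψ → suc k ∤ j → ∀ i → ψ i ≡ 0ℤ
killed∧periodic⇒zero k {ψ} j F Φψ≗0 ψj c∤j
  with gcd (suc k) j | gcd[m,n]∣m (suc k) j | gcd[m,n]∣n (suc k) j
     | periodic-gcd {suc k} {j} {ψ} (Factorised.killed⇒periodic (F k ℕ.≤-refl) Φψ≗0) ψj
... | zero   | 0∣c | _ | _ = ⊥-elim (ℕ.1+n≢0 (ℕ.0∣⇒≡0 0∣c))
... | suc g′ | g∣c | g∣j | ψg = killed∧periodic-divisor⇒zero k g′ (F k ℕ.≤-refl) (F g′ (ℕ.<⇒≤ g<c)) g∣c g<c Φψ≗0 ψg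
  where
  g<c : g′ ℕ.< k
  g<c = ℕ.≤∧≢⇒< (ℕ.≤-pred (ℕ.∣⇒≤ g∣c)) λ g′≡k → c∤j (subst (λ t → suc t ∣ j) g′≡k g∣j)

-- Factors are removed one at a time: what `Φ e` kills is e-periodic, so V need only contain no
-- nonzero sequence with one of these periods. V is abstract for two uses, the sequences killed by
-- one cyclotomic polynomial and the primitive ones below.
Φ∏-injective : ∀ (V : Seq → Set) d k →
  (∀ {χ} p → V χ → V (p • χ)) →
  (∀ e → e ℕ.< k → suc e ∣ d → Factorised e) →
  (∀ e {χ} → e ℕ.< k → suc e ∣ d → V χ → Periodic (suc e) χ → ∀ i → χ i ≡ 0ℤ) →
  ∀ {χ} → V χ → Φ∏ d k kills χ → ∀ i → χ i ≡ 0ℤ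
Φ∏-injective V d zero V-• F V-periodic {χ} Vχ 1χ≗0 i = trans (sym (xpow-act 0 χ i)) (1χ≗0 i)
Φ∏-injective V d (suc k) V-• F V-periodic {χ} Vχ Pχ≗0 with suc k ∣? d
... | no k∤d rewrite Φ∏-∤ d k k∤d =
  Φ∏-injective V d k V-• (λ e e<k → F e (ℕ.m≤n⇒m≤1+n e<k))
    (λ e e<k → V-periodic e (ℕ.m≤n⇒m≤1+n e<k)) Vχ Pχ≗0
... | yes k∣d rewrite Φ∏-∣ d k k∣d =
  V-periodic k ℕ.≤-refl k∣d Vχ (Factorised.killed⇒periodic (F k ℕ.≤-refl k∣d)
    (Φ∏-injective V d k V-• (λ e e<k → F e (ℕ.m≤n⇒m≤1+n e<k))
      (λ e e<k → V-periodic e (ℕ.m≤n⇒m≤1+n e<k)) (V-• (cyclotomic (suc k)) Vχ)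
      (*-kills⁻¹ (Φ∏ d k) (cyclotomic (suc k)) {χ} Pχ≗0)))

Φ∏-monic : ∀ d k → (∀ e → e ℕ.< k → suc e ∣ d → Factorised e) → ∃[ m ] Monic m (Φ∏ d k)
Φ∏-monic d zero F = 0 , coeff-xpow 0
Φ∏-monic d (suc k) F with suc k ∣? d | Φ∏-monic d k (λ e e<k → F e (ℕ.m≤n⇒m≤1+n e<k))
... | no k∤d  | m , P-monic rewrite Φ∏-∤ d k k∤d = m , P-monic
... | yes k∣d | m , P-monic rewrite Φ∏-∣ d k k∣d =
  _ , monic-* {Φ∏ d k} {cyclotomic (suc k)} P-monic (Factorised.monic (F k ℕ.≤-refl k∣d))

-- The sequence whose shifts span all c-periodic sequences. It serves again as a weight, the
-- indicator of the multiples of a divisor.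
comb : ℕ → Seq
comb c i = if does (c ∣? i) then 1ℤ else 0ℤ

comb-∣ : ∀ {c i} → c ∣ i → comb c i ≡ 1ℤ
comb-∣ {c} {i} c∣i rewrite dec-true (c ∣? i) c∣i = refl

comb-∤ : ∀ {c i} → c ∤ i → comb c i ≡ 0ℤ
comb-∤ {c} {i} c∤i rewrite dec-false (c ∣? i) c∤i = refl

comb-periodic : ∀ c {m} → c ∣ m → Periodic m (comb c)
comb-periodic c {m} c∣m i with c ∣? i
... | yes c∣i = comb-∣ (ℕ.∣m∣n⇒∣m+n c∣m c∣i)
... | no c∤i  = comb-∤ λ c∣m+i → c∤i (ℕ.∣m+n∣m⇒∣n c∣m+i c∣m)

pulse-refl : ∀ j → pulse j j ≡ 1ℤ
pulse-refl zero    = refl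
pulse-refl (suc j) = pulse-refl j

pulse-≢ : ∀ j t → j ≢ t → pulse j t ≡ 0ℤ
pulse-≢ zero    zero    j≢t = ⊥-elim (j≢t refl)
pulse-≢ zero    (suc t) j≢t = refl
pulse-≢ (suc j) zero    j≢t = refl
pulse-≢ (suc j) (suc t) j≢t = pulse-≢ j t (j≢t ∘ cong suc)

∣-<2c : ∀ {c s} → c ∣ s → s ≢ 0 → s ℕ.< c ℕ.+ c → s ≡ c
∣-<2c (ℕ.divides zero refl) s≢0 _ = ⊥-elim (s≢0 refl)
∣-<2c {c} (ℕ.divides (suc zero) refl) _ _ = ℕ.+-identityʳ c
∣-<2c {c} (ℕ.divides (suc (suc q)) refl) _ s<2c = ⊥-elim (ℕ.<⇒≱ s<2c
  (ℕ.+-monoʳ-≤ c (ℕ.m≤m+n c (q ℕ.* c))))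

comb-window : ∀ c j t → j ℕ.< c → t ℕ.< c → comb c ((c ℕ.∸ j) ℕ.+ t) ≡ pulse j t
comb-window c j t j<c t<c with j ℕ.≟ t
... | yes refl rewrite ℕ.m∸n+n≡m (ℕ.<⇒≤ j<c) | pulse-refl j = comb-∣ (ℕ.∣-refl {c})
... | no j≢t = trans (comb-∤ λ c∣s → j≢t (ℕ.+-cancelˡ-≡ (c ℕ.∸ j) j t
    (trans (ℕ.m∸n+n≡m (ℕ.<⇒≤ j<c)) (sym (∣-<2c c∣s s≢0 s<2c))))) (sym (pulse-≢ j t j≢t))
  where
  s≢0 : (c ℕ.∸ j) ℕ.+ t ≢ 0
  s≢0 s≡0 = ℕ.<⇒≱ j<c (ℕ.m∸n≡0⇒m≤n (ℕ.m+n≡0⇒m≡0 (c ℕ.∸ j) s≡0))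
  s<2c : (c ℕ.∸ j) ℕ.+ t ℕ.< c ℕ.+ c
  s<2c = ℕ.+-mono-≤-< (ℕ.m∸n≤m c j) t<c

act-local : ∀ p m {φ ψ : Seq} i → Below m p → (∀ t → t ℕ.< m → φ (t ℕ.+ i) ≡ ψ (t ℕ.+ i)) →
  (p • φ) i ≡ (p • ψ) i
act-local p zero {φ} {ψ} i p< φ≗ψ =
  trans (act-≈0 1 p (λ k → p< k z≤n) φ i) (sym (act-≈0 1 p (λ k → p< k z≤n) ψ i))
act-local [] (suc m) i p< φ≗ψ = refl
act-local (a ∷ p) (suc m) {φ} {ψ} i p< φ≗ψ = cong₂ (λ x y → a * x + y) (φ≗ψ 0 (s≤s z≤n))
  (act-local p m (suc i) (λ k m≤k → p< (suc k) (s≤s m≤k))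
    λ t t<m → subst (λ s → φ s ≡ ψ s) (sym (ℕ.+-suc t i)) (φ≗ψ (suc t) (s≤s t<m)))

-- A polynomial of degree below c sees a window of c consecutive values only, and in a suitable
-- window the comb is `pulse j`, which reads off coefficient j.
comb-detects : ∀ p c → Below c p → p kills comb c → p ≈ₚ []
comb-detects p c p< p-kills j with j ℕ.<? c
... | no j≮c  = p< j (ℕ.≮⇒≥ j≮c)
... | yes j<c = begin
  coeff p j
    ≡⟨ sym (pulse-act p j) ⟩
  (p • pulse j) 0
    ≡⟨ act-local p c 0 p< (λ t t<c → sym (trans (cong (comb c ∘ (c ℕ.∸ j ℕ.+_)) (ℕ.+-identityʳ t))
         (trans (comb-window c j t j<c t<c) (cong (pulse j) (sym (ℕ.+-identityʳ t)))))) ⟩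
  (p • (λ t → comb c ((c ℕ.∸ j) ℕ.+ t))) 0
    ≡⟨ act-shift 1 p (comb c) (c ℕ.∸ j) 0 ⟩
  (p • comb c) ((c ℕ.∸ j) ℕ.+ 0)
    ≡⟨ p-kills _ ⟩
  0ℤ ∎
  where open ≡-Reasoning

-- A generator of the module of integer sequences killed by Φ (k + 1).
generator : ℕ → Seq
generator k = Φ∏ (suc k) k • comb (suc k)

generator-killed : ∀ k → Factorised k → cyclotomic (suc k) kills generator k
generator-killed k Fk = *-kills⁻¹ (cyclotomic (suc k)) (Φ∏ (suc k) k) {comb (suc k)}
  (kills-≋ (ℤ[x].sym (Factorised.Φ*Φ∏ Fk))
    (periodic⇒xⁿ-1-kills (suc k) {comb (suc k)} (comb-periodic (suc k) ℕ.∣-refl)))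

-- If r is the remainder of p modulo Φ and P the complementary product, then P r kills the comb and
-- has degree below k + 1. So P r = 0, and r = 0 because P is monic.
kills-generator⇒∣ : ∀ k → (∀ e → e ℕ.≤ k → Factorised e) → ∀ p → p kills generator k → cyclotomic (suc k) ∣ᵖ p
kills-generator⇒∣ k F p p-kills
  with Factorised.degree (F k ℕ.≤-refl) | Factorised.monic (F k ℕ.≤-refl)
     | Φ∏-monic (suc k) k (λ e e<k _ → F e (ℕ.<⇒≤ e<k))
... | a | Φ-monic | b , P-monic with divMod-monic {a} {cyclotomic (suc k)} Φ-monic p
... | q , r , p≋ , r< = divides q (ℤ[x].sym (ℤ[x].trans p≋ (mk≋ Mq+r≈Mq)))
  where
  P = Φ∏ (suc k) k
  M = cyclotomic (suc k)
  a+b≡c : a ℕ.+ b ≡ suc k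
  a+b≡c = monic-unique {xⁿ-1 (suc k)}
    (monic-≋ (Factorised.Φ*Φ∏ (F k ℕ.≤-refl)) (monic-* {M} {P} Φ-monic P-monic)) (xⁿ-1-monic k)
  r-kills : r kills generator k
  r-kills i = begin
    (r • generator k) i
      ≡⟨ sym (ℤ.+-identityˡ _) ⟩
    0ℤ + (r • generator k) i
      ≡⟨ cong (_+ (r • generator k) i) (sym (∣-kills {M} {M *ₚ q} {generator k} (∣ᵖ-*ʳ M q)
           (generator-killed k (F k ℕ.≤-refl)) i)) ⟩
    ((M *ₚ q) • generator k) i + (r • generator k) i
      ≡⟨ sym (act-+ 1 (M *ₚ q) r (generator k) i) ⟩
    ((M *ₚ q +ₚ r) • generator k) i
      ≡⟨ sym (action p≋ (generator k) i) ⟩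
    (p • generator k) i
      ≡⟨ p-kills i ⟩
    0ℤ ∎
    where open ≡-Reasoning
  Pr< : ∀ {a} → a ℕ.+ b ≡ suc k → Below a r → Below (suc k) (P *ₚ r)
  Pr< {zero} _ r< j _ = at (ℤ[x].trans (*ₚ-congˡ P (mk≋ {r} {[]} λ k → r< k z≤n)) (ℤ[x].zeroʳ P)) j
  Pr< {suc a} a+b≡c r< = subst (λ m → Below m (P *ₚ r)) (trans (cong suc (ℕ.+-comm b a)) a+b≡c)
    (proj₁ (coeff-*-leading P r b a (proj₁ P-monic) r<))
  r≈0 : r ≈ₚ []
  r≈0 = monic-cancel {P} {r} P-monic (comb-detects (P *ₚ r) (suc k) (Pr< a+b≡c r<)
    (kills-≋ (ℤ[x].*-comm r P) (*-kills r P {comb (suc k)} r-kills)))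
  Mq+r≈Mq : M *ₚ q +ₚ r ≈ₚ M *ₚ q
  Mq+r≈Mq j = trans (coeff-+ (M *ₚ q) r j) (trans (cong (coeff (M *ₚ q) j +_) (r≈0 j)) (ℤ.+-identityʳ _))

-- Let x^d - 1 = P q with P the product so far, and let k be the next divisor of d. As the generator
-- for k is d-periodic, P q kills it; P is injective on sequences killed by `Φ k`, so q alone kills
-- the generator, and `Φ k` divides q.
Φ∏-∣-xⁿ-1 : ∀ d → (∀ e → suc e ℕ.< suc d → Factorised e) → ∀ k → k ℕ.≤ d → Φ∏ (suc d) k ∣ᵖ xⁿ-1 (suc d)
Φ∏-∣-xⁿ-1 d F zero _ = divides (xⁿ-1 (suc d)) (ℤ[x].*-identityˡ (xⁿ-1 (suc d)))
Φ∏-∣-xⁿ-1 d F (suc k) k<d with suc k ∣? suc d | Φ∏-∣-xⁿ-1 d F k (ℕ.<⇒≤ k<d)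
... | no k∤d  | P∣X rewrite Φ∏-∤ (suc d) k k∤d = P∣X
... | yes k∣d | divides q Pq≋X rewrite Φ∏-∣ (suc d) k k∣d = absorb
  (kills-generator⇒∣ k (λ e e≤k → F e (s≤s (ℕ.≤-<-trans e≤k k<d))) q
    (Φ∏-injective (λ χ → cyclotomic (suc k) kills χ) (suc d) k
      (λ {χ} p → kills-• {cyclotomic (suc k)} {χ} p)
      (λ e e<k _ → F e (s≤s (ℕ.<-trans e<k k<d)))
      (λ e {χ} e<k _ Φχ≗0 χe → killed∧periodic⇒zero k {χ} (suc e)
        (λ i i≤k → F i (s≤s (ℕ.≤-<-trans i≤k k<d))) Φχ≗0 χe
        λ k∣e → ℕ.<⇒≱ (s≤s e<k) (ℕ.∣⇒≤ k∣e))
      (kills-• {cyclotomic (suc k)} {generator k} q (generator-killed k Fk))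
      (*-kills⁻¹ (Φ∏ (suc d) k) q {generator k} (kills-≋ {φ = generator k} (ℤ[x].sym Pq≋X)
        (periodic⇒xⁿ-1-kills (suc d) {generator k}
          (periodic-∣ {φ = generator k} k∣d (Factorised.killed⇒periodic Fk (generator-killed k Fk))))))))
  where
  Fk = F k (s≤s k<d)
  absorb : cyclotomic (suc k) ∣ᵖ q → Φ∏ (suc d) k *ₚ cyclotomic (suc k) ∣ᵖ xⁿ-1 (suc d)
  absorb (divides s Φs≋q) = divides s (ℤ[x].trans (ℤ[x].*-assoc (Φ∏ (suc d) k) (cyclotomic (suc k)) s)
    (ℤ[x].trans (*ₚ-congˡ (Φ∏ (suc d) k) Φs≋q) Pq≋X))

factorised : ∀ k → Factorised k
factorised = <-rec Factorised step
  where
  step : ∀ k → (∀ {j} → j ℕ.< k → Factorised j) → Factorised k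
  step k F with Φ-unfold k | Φ∏-∣-xⁿ-1 k (λ e e<k → F (ℕ.≤-pred e<k)) k ℕ.≤-refl
     | Φ∏-monic (suc k) k (λ e e<k _ → F e<k)
  ... | D , D≋P , Φ≡ | divides q Pq≋X | b , P-monic with zero⊎leadingTerm q
  ... | inj₁ q≈0 = ⊥-elim (1≢0 (trans (sym (proj₂ (xⁿ-1-monic k)))
      (trans (sym (at Pq≋X (suc k))) (at (ℤ[x].trans (*ₚ-congˡ (Φ∏ (suc k) k) (mk≋ {q} {[]} q≈0)) (ℤ[x].zeroʳ (Φ∏ (suc k) k))) (suc k)))))
    where
    1≢0 : 1ℤ ≢ 0ℤ
    1≢0 ()
  ... | inj₂ (m , l , q-top) = record
    { degree  = m
    ; monic   = monic-≋ (ℤ[x].sym Φ≋q) (proj₁ q-top , trans (proj₁ (proj₂ q-top)) l≡1)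
    ; Φ*Φ∏    = ℤ[x].trans (ℤ[x].*-comm (cyclotomic (suc k)) (Φ∏ (suc k) k)) (ℤ[x].trans (*ₚ-congˡ (Φ∏ (suc k) k) Φ≋q) Pq≋X) }
    where
    top = leadingTerm-* {Φ∏ (suc k) k} {q} P-monic q-top
    b+m≡ : b ℕ.+ m ≡ suc k
    b+m≡ with ℕ.<-cmp (b ℕ.+ m) (suc k)
    ... | tri≈ _ eq _ = eq
    ... | tri< lt _ _ = ⊥-elim (1≢0 (trans (sym (proj₂ (xⁿ-1-monic k)))
      (trans (sym (at Pq≋X (suc k))) (proj₁ top (suc k) lt))))
      where
      1≢0 : 1ℤ ≢ 0ℤ
      1≢0 ()
    ... | tri> _ _ gt = ⊥-elim (proj₂ (proj₂ top) (trans (sym (proj₁ (proj₂ top)))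
      (trans (at Pq≋X (b ℕ.+ m)) (proj₁ (xⁿ-1-monic k) (b ℕ.+ m) gt))))
    l≡1 : l ≡ 1ℤ
    l≡1 = trans (sym (proj₁ (proj₂ top))) (trans (at Pq≋X (b ℕ.+ m))
      (trans (cong (coeff (xⁿ-1 (suc k))) b+m≡) (proj₂ (xⁿ-1-monic k))))
    g≋P : strip D ≋ Φ∏ (suc k) k
    g≋P = ℤ[x].trans (strip-≈ D) D≋P
    D-monic : Monic b D
    D-monic = monic-≋ (ℤ[x].sym D≋P) P-monic
    m≤ : m ℕ.≤ suc k
    m≤ = ℕ.≤-trans (ℕ.m≤n+m m b) (ℕ.≤-reflexive b+m≡)
    Φ≋q : cyclotomic (suc k) ≋ q
    -- The fuel k + 3 exceeds the degree m ≤ k + 1 of the quotient.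
    Φ≋q rewrite Φ≡ = divMonic-exact (suc (suc (suc k))) (xⁿ-1 (suc k)) (strip D) q
      (monic-≋ (ℤ[x].sym g≋P) P-monic)
      (proj₁ (strip-leading D (proj₁ D-monic , proj₂ D-monic , λ ())))
      (ℤ[x].trans (ℤ[x].sym Pq≋X) (*ₚ-congʳ q (ℤ[x].sym g≋P)))
      (λ j 3+k≤j → proj₁ q-top j (ℕ.≤-trans (s≤s m≤) (ℕ.≤-trans (ℕ.n≤1+n _) 3+k≤j)))

-- Irreducibility of cyclotomic polynomials

prime∤! : ∀ {q} → Prime q → ∀ m → m ℕ.< q → q ∤ m !
prime∤! {q} q-prime zero _ q∣1 = ¬prime[1] (subst Prime (ℕ.∣1⇒≡1 q∣1) q-prime)
prime∤! {q} q-prime (suc m) m<q q∣m! with euclidsLemma (suc m) (m !) q-prime q∣m!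
... | inj₁ q∣m = ℕ.<⇒≱ m<q (ℕ.∣⇒≤ q∣m)
... | inj₂ q∣m! = prime∤! q-prime m (ℕ.<⇒≤ m<q) q∣m!

n!≡nCk*k![n∸k]! : ∀ n k → k ℕ.≤ n → (n choose k) ℕ.* (k ! ℕ.* (n ℕ.∸ k) !) ≡ n !
n!≡nCk*k![n∸k]! n k k≤n = trans (cong (ℕ._* (k ! ℕ.* (n ℕ.∸ k) !)) (nCk≡n!/k![n-k]! k≤n))
  (ℕ.m/n*n≡m (k![n∸k]!∣n! k≤n))
  where instance _ = k ℕ.!* (n ℕ.∸ k) !≢0

prime∣C : ∀ {q} → Prime q → ∀ k → 0 ℕ.< k → k ℕ.< q → q ∣ q choose k
prime∣C {zero}  q-prime k 0<k ()
prime∣C {suc q} q-prime k 0<k k<q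
  with euclidsLemma (suc q choose k) (k ! ℕ.* (suc q ℕ.∸ k) !) q-prime
    (subst (suc q ∣_) (sym (n!≡nCk*k![n∸k]! (suc q) k (ℕ.<⇒≤ k<q))) (ℕ.m∣m*n (q !)))
... | inj₁ q∣C = q∣C
... | inj₂ q∣k!l! with euclidsLemma (k !) ((suc q ℕ.∸ k) !) q-prime q∣k!l!
...   | inj₁ q∣k! = ⊥-elim (prime∤! q-prime k k<q q∣k!)
...   | inj₂ q∣l! = ⊥-elim (prime∤! q-prime (suc q ℕ.∸ k) (ℕ.∸-monoʳ-< 0<k (ℕ.<⇒≤ k<q)) q∣l!)

-- Used over two rings: ℤ yields Fermat's little theorem for coefficients, ℤ[x] yields f(x)^q ≡
-- f(x^q) modulo q.
module Frobenius (R : CommutativeRing 0ℓ 0ℓ) where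

  open CommutativeRing R hiding (zero) renaming (Carrier to A; _+_ to _⊕_; _*_ to _⊗_; refl to ≈-refl; sym to ≈-sym; trans to ≈-trans)
  open import Algebra.Properties.CommutativeSemiring.Binomial commutativeSemiring
    renaming (theorem to binomial-theorem)
  open import Algebra.Properties.Semiring.Exp semiring public using (_^_)
  open import Algebra.Properties.Monoid.Mult +-monoid public using () renaming (_×_ to _·ₙ_)
  open import Algebra.Properties.Monoid.Mult +-monoid using (×-assocˡ; ×-congˡ; ×-congʳ; ×-homo-1)
  open import Algebra.Properties.CommutativeMonoid.Mult +-commutativeMonoid using (×-distrib-+)
  open import Algebra.Properties.Monoid.Sum +-monoid using (sum; sum-init-last)
  open import Relation.Binary.Reasoning.Setoid setoid

  Multiple : ℕ → A → Set
  Multiple q z = ∃[ h ] z ≈ q ·ₙ h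

  multiple-sum : ∀ q {n} (t : Fin n → A) → (∀ i → Multiple q (t i)) → Multiple q (sum t)
  multiple-sum q {zero}  t t-multiple = 0# , ≈-sym (zero-multiple q)
    where
    zero-multiple : ∀ q → q ·ₙ 0# ≈ 0#
    zero-multiple zero    = ≈-refl
    zero-multiple (suc q) = ≈-trans (+-identityˡ _) (zero-multiple q)
  multiple-sum q {suc n} t t-multiple with t-multiple zero | multiple-sum q (t ∘ suc) (t-multiple ∘ suc)
  ... | h , t₀≈ | h′ , s≈ = h ⊕ h′ , ≈-trans (+-cong t₀≈ s≈) (≈-sym (×-distrib-+ h h′ q))

  frobenius : ∀ {q} → Prime q → ∀ x y → ∃[ h ] (x ⊕ y) ^ q ≈ (x ^ q ⊕ y ^ q) ⊕ q ·ₙ h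
  frobenius {zero}  q-prime x y = ⊥-elim (¬prime[0] q-prime)
  frobenius {suc q} q-prime x y = proj₁ middle , (begin
    (x ⊕ y) ^ suc q
      ≈⟨ binomial-theorem (suc q) x y ⟩
    t zero ⊕ sum (t ∘ suc)
      ≈⟨ +-cong t-first (≈-trans (sum-init-last (t ∘ suc)) (+-cong (proj₂ middle) t-last)) ⟩
    y ^ suc q ⊕ (suc q ·ₙ proj₁ middle ⊕ x ^ suc q)
      ≈⟨ +-congˡ (+-comm _ _) ⟩
    y ^ suc q ⊕ (x ^ suc q ⊕ suc q ·ₙ proj₁ middle)
      ≈⟨ ≈-sym (+-assoc _ _ _) ⟩
    (y ^ suc q ⊕ x ^ suc q) ⊕ suc q ·ₙ proj₁ middle
      ≈⟨ +-congʳ (+-comm _ _) ⟩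
    (x ^ suc q ⊕ y ^ suc q) ⊕ suc q ·ₙ proj₁ middle ∎)
    where
    t : Fin (suc (suc q)) → A
    t = binomialTerm x y (suc q)
    C0≡1 : suc q choose 0 ≡ 1
    C0≡1 = trans (nCk≡nC[n∸k] {0} {suc q} z≤n) (nCn≡1 (suc q))
    t-first : t zero ≈ y ^ suc q
    t-first = ≈-trans (×-congˡ C0≡1) (≈-trans (×-homo-1 _) (*-identityˡ _))
    middle = multiple-sum (suc q) (λ i → t (suc (inject₁ i))) λ i →
      let k = suc (toℕ (inject₁ i))
          k<q = s≤s (ℕ.≤-trans (ℕ.≤-reflexive (cong suc (Fin.toℕ-inject₁ i))) (Fin.toℕ<n i))
          c = ℕ._∣_.quotient (prime∣C q-prime k (s≤s z≤n) k<q)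
      in _ , ≈-trans (×-congˡ (trans (ℕ._∣_.equality (prime∣C q-prime k (s≤s z≤n) k<q)) (ℕ.*-comm c (suc q))))
               (≈-sym (×-assocˡ (binomial x y (suc q) (suc (inject₁ i))) (suc q) c))
    t-last : t (suc (fromℕ q)) ≈ x ^ suc q
    t-last = begin
      (suc q choose suc (toℕ (fromℕ q))) ·ₙ (x ^ suc (toℕ (fromℕ q)) ⊗ y ^ (q ℕ.∸ toℕ (fromℕ q)))
        ≡⟨ cong (λ k → (suc q choose suc k) ·ₙ (x ^ suc k ⊗ y ^ (q ℕ.∸ k))) (Fin.toℕ-fromℕ q) ⟩
      (suc q choose suc q) ·ₙ (x ^ suc q ⊗ y ^ (q ℕ.∸ q))
        ≡⟨ cong₂ (λ c k → c ·ₙ (x ^ suc q ⊗ y ^ k)) (nCn≡1 (suc q)) (ℕ.n∸n≡0 q) ⟩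
      1 ·ₙ (x ^ suc q ⊗ 1#)
        ≈⟨ ≈-trans (×-homo-1 _) (*-identityʳ _) ⟩
      x ^ suc q ∎

module Fℤ = Frobenius ℤ.+-*-commutativeRing
module Fₚ = Frobenius polyRing

·ₙ-ℤ : ∀ q h → q Fℤ.·ₙ h ≡ ℤ.+ q * h
·ₙ-ℤ zero    h = refl
·ₙ-ℤ (suc q) h = trans (cong (h +_) (·ₙ-ℤ q h)) (sym (ℤ.suc-* (ℤ.+ q) h))

·ₙ-act : ∀ q h φ i → ((q Fₚ.·ₙ h) • φ) i ≡ ℤ.+ q * (h • φ) i
·ₙ-act zero    h φ i = refl
·ₙ-act (suc q) h φ i = trans (act-+ 1 h (q Fₚ.·ₙ h) φ i)
  (trans (cong ((h • φ) i +_) (·ₙ-act q h φ i)) (sym (ℤ.suc-* (ℤ.+ q) ((h • φ) i))))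

0^prime : ∀ q → Prime q → 0ℤ Fℤ.^ q ≡ 0ℤ
0^prime zero    0-prime = ⊥-elim (¬prime[0] 0-prime)
0^prime (suc _) _       = refl

module _ {q} (q-prime : Prime q) where

  private
    Fermat : ℤ → Set
    Fermat a = ∃[ z ] a Fℤ.^ q ≡ a + ℤ.+ q * z

    frobeniusℤ : ∀ a b → ∃[ h ] (a + b) Fℤ.^ q ≡ (a Fℤ.^ q + b Fℤ.^ q) + ℤ.+ q * h
    frobeniusℤ a b with Fℤ.frobenius q-prime a b
    ... | h , eq = h , trans eq (cong ((a Fℤ.^ q + b Fℤ.^ q) +_) (·ₙ-ℤ q h))

    0^q : 0ℤ Fℤ.^ q ≡ 0ℤ
    0^q = 0^prime q q-prime

    1^ : ∀ q → 1ℤ Fℤ.^ q ≡ 1ℤ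
    1^ zero    = refl
    1^ (suc q) = trans (ℤ.*-identityˡ _) (1^ q)

    fermat-pos : ∀ n → Fermat (ℤ.+ n)
    fermat-pos zero = 0ℤ , trans 0^q (sym (trans (ℤ.+-identityˡ _) (ℤ.*-zeroʳ (ℤ.+ q))))
    fermat-pos (suc n) with frobeniusℤ 1ℤ (ℤ.+ n) | fermat-pos n
    ... | h , eq | z , ih = z + h , trans eq (trans (cong₂ (λ a b → (a + b) + ℤ.+ q * h) (1^ q) ih)
      (regroup (ℤ.+ n) (ℤ.+ q) z h))
      where
      regroup : ∀ a q z h → (1ℤ + (a + q * z)) + q * h ≡ (1ℤ + a) + q * (z + h)
      regroup = solve-∀

    -- Expanding 0 = (a + (- a))^q modulo q treats q = 2 and odd q alike.
    fermat-neg : ∀ a → Fermat a → Fermat (- a)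
    fermat-neg a (z , a^q) with frobeniusℤ a (- a)
    ... | h , eq = - z + - h , (begin
      (- a) Fℤ.^ q
        ≡⟨ shuffle (a Fℤ.^ q) ((- a) Fℤ.^ q) (ℤ.+ q * h) ⟩
      ((a Fℤ.^ q + (- a) Fℤ.^ q) + ℤ.+ q * h) - (a Fℤ.^ q + ℤ.+ q * h)
        ≡⟨ cong₂ (λ x y → x - (y + ℤ.+ q * h)) (trans (sym eq) (trans (cong (Fℤ._^ q) (ℤ.+-inverseʳ a)) 0^q)) a^q ⟩
      0ℤ - ((a + ℤ.+ q * z) + ℤ.+ q * h)
        ≡⟨ regroup a (ℤ.+ q) z h ⟩
      - a + ℤ.+ q * (- z + - h) ∎)
      where
      open ≡-Reasoning
      shuffle : ∀ x y w → y ≡ ((x + y) + w) - (x + w)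
      shuffle = solve-∀
      regroup : ∀ a q z h → 0ℤ - ((a + q * z) + q * h) ≡ - a + q * (- z + - h)
      regroup = solve-∀

  fermat : ∀ a → ∃[ z ] a Fℤ.^ q ≡ a + ℤ.+ q * z
  fermat (ℤ.+ n)      = fermat-pos n
  fermat ℤ.-[1+ n ]   = fermat-neg (ℤ.+ suc n) (fermat-pos (suc n))

  const-^-act : ∀ m a φ i → (((a ∷ []) Fₚ.^ m) • φ) i ≡ a Fℤ.^ m * φ i
  const-^-act zero    a φ i = ℤ.+-identityʳ _
  const-^-act (suc m) a φ i = trans (act-* 1 (a ∷ []) ((a ∷ []) Fₚ.^ m) φ i)
    (trans (ℤ.+-identityʳ _) (trans (cong (a *_) (const-^-act m a φ i)) (sym (ℤ.*-assoc a (a Fℤ.^ m) (φ i)))))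

  shift-^-act : ∀ m g φ i → (((0ℤ ∷ g) Fₚ.^ m) • φ) i ≡ ((g Fₚ.^ m) • φ) (m ℕ.+ i)
  shift-^-act zero    g φ i = refl
  shift-^-act (suc m) g φ i = begin
    (((0ℤ ∷ g) *ₚ ((0ℤ ∷ g) Fₚ.^ m)) • φ) i
      ≡⟨ act-* 1 (0ℤ ∷ g) ((0ℤ ∷ g) Fₚ.^ m) φ i ⟩
    0ℤ + (g • (((0ℤ ∷ g) Fₚ.^ m) • φ)) (suc i)
      ≡⟨ ℤ.+-identityˡ _ ⟩
    (g • (((0ℤ ∷ g) Fₚ.^ m) • φ)) (suc i)
      ≡⟨ act-cong 1 g (shift-^-act m g φ) (suc i) ⟩
    (g • (λ j → ((g Fₚ.^ m) • φ) (m ℕ.+ j))) (suc i)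
      ≡⟨ act-shift 1 g ((g Fₚ.^ m) • φ) m (suc i) ⟩
    (g • ((g Fₚ.^ m) • φ)) (m ℕ.+ suc i)
      ≡⟨ cong (g • ((g Fₚ.^ m) • φ)) (ℕ.+-suc m i) ⟩
    (g • ((g Fₚ.^ m) • φ)) (suc m ℕ.+ i)
      ≡⟨ sym (act-* 1 g (g Fₚ.^ m) φ (suc m ℕ.+ i)) ⟩
    ((g *ₚ (g Fₚ.^ m)) • φ) (suc m ℕ.+ i) ∎
    where open ≡-Reasoning

  -- Modulo q one has (a + x g)^q ≡ a^q + x^q g^q ≡ a + x^q g(x^q), by Frobenius, Fermat and
  -- induction on the coefficient list.
  frobenius-act : ∀ f φ i → ∃[ z ] ((f Fₚ.^ q) • φ) i ≡ act q f φ i + ℤ.+ q * z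
  frobenius-act [] φ i = 0ℤ , trans ([]^ q q-prime) (sym (trans (ℤ.+-identityˡ _) (ℤ.*-zeroʳ (ℤ.+ q))))
    where
    []^ : ∀ q → Prime q → (([] Fₚ.^ q) • φ) i ≡ 0ℤ
    []^ zero    0-prime = ⊥-elim (¬prime[0] 0-prime)
    []^ (suc _) _       = refl
  frobenius-act (a ∷ g) φ i with Fₚ.frobenius q-prime (a ∷ []) (0ℤ ∷ g)
    | fermat a | frobenius-act g φ (q ℕ.+ i)
  ... | h , eq | z , a^q | w , ih = z * φ i + w + (h • φ) i , (begin
    (((a ∷ g) Fₚ.^ q) • φ) i
      -- The sum of the constant a and x g has head a + 0, not a.
      ≡⟨ cong (λ b → (((b ∷ g) Fₚ.^ q) • φ) i) (sym (ℤ.+-identityʳ a)) ⟩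
    (((a + 0ℤ ∷ g) Fₚ.^ q) • φ) i
      ≡⟨ action eq φ i ⟩
    ((((a ∷ []) Fₚ.^ q +ₚ (0ℤ ∷ g) Fₚ.^ q) +ₚ q Fₚ.·ₙ h) • φ) i
      ≡⟨ trans (act-+ 1 ((a ∷ []) Fₚ.^ q +ₚ (0ℤ ∷ g) Fₚ.^ q) (q Fₚ.·ₙ h) φ i)
           (cong (_+ ((q Fₚ.·ₙ h) • φ) i) (act-+ 1 ((a ∷ []) Fₚ.^ q) ((0ℤ ∷ g) Fₚ.^ q) φ i)) ⟩
    ((((a ∷ []) Fₚ.^ q) • φ) i + (((0ℤ ∷ g) Fₚ.^ q) • φ) i) + ((q Fₚ.·ₙ h) • φ) i
      ≡⟨ cong₂ _+_ (cong₂ _+_ (trans (const-^-act q a φ i) (cong (_* φ i) a^q))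
           (trans (shift-^-act q g φ i) ih)) (·ₙ-act q h φ i) ⟩
    ((a + ℤ.+ q * z) * φ i + (act q g φ (q ℕ.+ i) + ℤ.+ q * w)) + ℤ.+ q * (h • φ) i
      ≡⟨ regroup a (ℤ.+ q) z (φ i) (act q g φ (q ℕ.+ i)) w ((h • φ) i) ⟩
    (a * φ i + act q g φ (q ℕ.+ i)) + ℤ.+ q * (z * φ i + w + (h • φ) i) ∎)
    where
    open ≡-Reasoning
    regroup : ∀ a q z x s w h → ((a + q * z) * x + (s + q * w)) + q * h ≡ (a * x + s) + q * (z * x + w + h)
    regroup = solve-∀

-- Conjugation x ↦ x^k by Landau's argument

norm : Poly → ℕ
norm []      = 0
norm (a ∷ p) = ∣ a ∣ ℕ.+ norm p

Bounded : ℕ → Seq → Set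
Bounded B φ = ∀ i → ∣ φ i ∣ ℕ.≤ B

-- The bound does not involve the step k; this lets a large prime q exceed it although q is itself
-- the step.
act-bounded : ∀ k p {B φ} → Bounded B φ → Bounded (norm p ℕ.* B) (act k p φ)
act-bounded k []      φ≤B i = z≤n
act-bounded k (a ∷ p) {B} {φ} φ≤B i = begin
  ∣ a * φ i + act k p φ (k ℕ.+ i) ∣
    ≤⟨ ℤ.∣i+j∣≤∣i∣+∣j∣ (a * φ i) (act k p φ (k ℕ.+ i)) ⟩
  ∣ a * φ i ∣ ℕ.+ ∣ act k p φ (k ℕ.+ i) ∣
    ≤⟨ ℕ.+-mono-≤ (ℕ.≤-trans (ℕ.≤-reflexive (ℤ.abs-* a (φ i))) (ℕ.*-monoʳ-≤ ∣ a ∣ (φ≤B i)))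
         (act-bounded k p φ≤B (k ℕ.+ i)) ⟩
  ∣ a ∣ ℕ.* B ℕ.+ norm p ℕ.* B
    ≡⟨ sym (ℕ.*-distribʳ-+ B ∣ a ∣ (norm p)) ⟩
  (∣ a ∣ ℕ.+ norm p) ℕ.* B ∎
  where open ℕ.≤-Reasoning

small-multiple : ∀ q x z → ∣ x ∣ ℕ.< q → x + ℤ.+ q * z ≡ 0ℤ → x ≡ 0ℤ
small-multiple q x z x<q eq = ℤ.∣i∣≡0⇒i≡0 (abs≡0 ∣ z ∣ ∣x∣≡)
  where
  ∣x∣≡ : ∣ x ∣ ≡ q ℕ.* ∣ z ∣
  ∣x∣≡ = trans (cong ∣_∣ (trans (isolate x (ℤ.+ q * z)) (trans (cong (_- ℤ.+ q * z) eq) (ℤ.+-identityˡ (- (ℤ.+ q * z))))))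
    (trans (ℤ.∣-i∣≡∣i∣ (ℤ.+ q * z)) (ℤ.abs-* (ℤ.+ q) z))
    where
    isolate : ∀ x y → x ≡ (x + y) - y
    isolate = solve-∀
  abs≡0 : ∀ m → ∣ x ∣ ≡ q ℕ.* m → ∣ x ∣ ≡ 0
  abs≡0 zero    ∣x∣≡ = trans ∣x∣≡ (ℕ.*-zeroʳ q)
  abs≡0 (suc m) ∣x∣≡ = ⊥-elim (ℕ.<⇒≱ x<q (ℕ.≤-trans (ℕ.m≤m*n q (suc m)) (ℕ.≤-reflexive (sym ∣x∣≡))))

-- Landau's argument: f(x^q) φ is a multiple of q which is smaller than q.
large-prime-kills : ∀ f {B φ q} → Bounded B φ → f kills φ → Prime q → norm f ℕ.* B ℕ.< q →
  ∀ i → act q f φ i ≡ 0ℤ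
large-prime-kills f {B} {φ} {q} φ≤B fφ≗0 q-prime N<q i with frobenius-act q-prime f φ i
... | z , eq = small-multiple q (act q f φ i) z (ℕ.≤-<-trans (act-bounded q f φ≤B i) N<q)
  (trans (sym eq) (f^q-kills q q-prime))
  where
  f^q-kills : ∀ q → Prime q → ((f Fₚ.^ q) • φ) i ≡ 0ℤ
  f^q-kills zero    0-prime = ⊥-elim (¬prime[0] 0-prime)
  f^q-kills (suc q) _ = trans (act-* 1 f (f Fₚ.^ q) φ i) (kills-• {f} {φ} (f Fₚ.^ q) fφ≗0 i)

-- Sampling φ along the progression i, i + m, i + 2 m, ... turns S into S^m. This reduces the
-- passage from f(x^m) to f(x^(p m)) to a single prime p.
act-dilate : ∀ k p (φ : Seq) m i s → act k p (λ t → φ (t ℕ.* m ℕ.+ i)) s ≡ act (k ℕ.* m) p φ (s ℕ.* m ℕ.+ i)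
act-dilate k []      φ m i s = refl
act-dilate k (a ∷ p) φ m i s = cong (a * φ (s ℕ.* m ℕ.+ i) +_) (trans (act-dilate k p φ m i (k ℕ.+ s))
  (cong (act (k ℕ.* m) p φ) (trans (cong (ℕ._+ i) (ℕ.*-distribʳ-+ m k s)) (ℕ.+-assoc (k ℕ.* m) (s ℕ.* m) i))))

-- Induction over the prime factors. The samples of φ satisfy the same bound B, so one threshold
-- serves for every factor.
smooth-free-kills : ∀ f {B φ} → Bounded B φ → f kills φ → ∀ ps → All Prime ps →
  (∀ {q} → Prime q → q ∣ product ps → norm f ℕ.* B ℕ.< q) → ∀ i → act (product ps) f φ i ≡ 0ℤ
smooth-free-kills f φ≤B fφ≗0 [] [] large i = fφ≗0 i
smooth-free-kills f {B} {φ} φ≤B fφ≗0 (p ∷ ps) (p-prime ∷ ps-prime) large i =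
  trans (sym (act-dilate p f φ m i 0)) (large-prime-kills f {B} {λ t → φ (t ℕ.* m ℕ.+ i)} (λ t → φ≤B _)
    (λ t → trans (act-dilate 1 f φ m i t) (trans (cong (λ k → act k f φ (t ℕ.* m ℕ.+ i)) (ℕ.+-identityʳ m))
      (smooth-free-kills f φ≤B fφ≗0 ps ps-prime (λ q-prime q∣m → large q-prime (ℕ.∣n⇒∣m*n p q∣m)) _)))
    p-prime (large p-prime (ℕ.m∣m*n m)) 0)
  where m = product ps

-- The multiplier T of the residue class below. A prime q ≤ N divides it exactly when q does not
-- divide k.
coprimeProduct : ℕ → ℕ → ℕ
coprimeProduct k zero    = 1
coprimeProduct k (suc N) with gcd (suc N) k ℕ.≟ 1
... | yes _ = suc N ℕ.* coprimeProduct k N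
... | no  _ = coprimeProduct k N

prime∣coprimeProduct⇒∤ : ∀ {q} k N → Prime q → q ∣ coprimeProduct k N → q ∤ k
prime∣coprimeProduct⇒∤ k zero q-prime q∣1 _ = ¬prime[1] (subst Prime (ℕ.∣1⇒≡1 q∣1) q-prime)
prime∣coprimeProduct⇒∤ k (suc N) q-prime q∣ q∣k with gcd (suc N) k ℕ.≟ 1
... | no  _ = prime∣coprimeProduct⇒∤ k N q-prime q∣ q∣k
... | yes gcd≡1 with euclidsLemma (suc N) (coprimeProduct k N) q-prime q∣
...   | inj₁ q∣N = ¬prime[1] (subst Prime (ℕ.∣1⇒≡1 (subst (_ ∣_) gcd≡1 (gcd-greatest q∣N q∣k))) q-prime)
...   | inj₂ q∣T = prime∣coprimeProduct⇒∤ k N q-prime q∣T q∣k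

prime∤⇒∣coprimeProduct : ∀ {q} k N → Prime q → q ℕ.≤ N → q ∤ k → q ∣ coprimeProduct k N
prime∤⇒∣coprimeProduct {zero} k zero q-prime z≤n q∤k = ⊥-elim (¬prime[0] q-prime)
prime∤⇒∣coprimeProduct {q} k (suc N) q-prime q≤N q∤k with gcd (suc N) k ℕ.≟ 1 | ℕ.m≤n⇒m<n∨m≡n q≤N
... | yes _ | inj₁ (s≤s q≤N) = ℕ.∣n⇒∣m*n (suc N) (prime∤⇒∣coprimeProduct k N q-prime q≤N q∤k)
... | no  _ | inj₁ (s≤s q≤N) = prime∤⇒∣coprimeProduct k N q-prime q≤N q∤k
... | yes _ | inj₂ refl = ℕ.m∣m*n (coprimeProduct k N)
... | no gcd≢1 | inj₂ refl with prime⇒irreducible q-prime (gcd[m,n]∣m (suc N) k)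
...   | inj₁ gcd≡1 = ⊥-elim (gcd≢1 gcd≡1)
...   | inj₂ gcd≡q = ⊥-elim (q∤k (subst (_∣ k) gcd≡q (gcd[m,n]∣n (suc N) k)))

-- A prime q ≤ N divides exactly one of k and T d: if q divides k, it divides neither T nor d;
-- otherwise it divides T. So it does not divide the sum.
smooth-free-residue : ∀ k d N → gcd k d ≡ 1 → ∀ {q} → Prime q →
  q ∣ k ℕ.+ coprimeProduct k N ℕ.* d → N ℕ.< q
smooth-free-residue k d N gcd≡1 {q} q-prime q∣m with q ℕ.≤? N | q ∣? k
... | no q≰N  | _ = ℕ.≰⇒> q≰N
... | yes q≤N | no q∤k = ⊥-elim (q∤k (ℕ.∣m+n∣m⇒∣n
    (subst (q ∣_) (ℕ.+-comm k _) q∣m) (ℕ.∣m⇒∣m*n d (prime∤⇒∣coprimeProduct k N q-prime q≤N q∤k))))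
... | yes q≤N | yes q∣k with euclidsLemma (coprimeProduct k N) d q-prime (ℕ.∣m+n∣m⇒∣n q∣m q∣k)
...   | inj₁ q∣T = ⊥-elim (prime∣coprimeProduct⇒∤ k N q-prime q∣T q∣k)
...   | inj₂ q∣d = ⊥-elim (¬prime[1] (subst Prime (ℕ.∣1⇒≡1 (subst (q ∣_) gcd≡1 (gcd-greatest q∣k q∣d))) q-prime))

act-periodic : ∀ {d φ} k p → Periodic d φ → Periodic d (act k p φ)
act-periodic {d} {φ} k p φd i = trans (sym (act-shift k p φ d i)) (act-cong k p φd i)

act-step-periodic : ∀ {d φ} k s p → Periodic d φ → ∀ i → act (k ℕ.+ s ℕ.* d) p φ i ≡ act k p φ i
act-step-periodic k s [] φd i = refl
act-step-periodic {d} {φ} k s (a ∷ p) φd i = cong (a * φ i +_) (begin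
  act (k ℕ.+ s ℕ.* d) p φ (k ℕ.+ s ℕ.* d ℕ.+ i)
    ≡⟨ act-step-periodic k s p φd _ ⟩
  act k p φ (k ℕ.+ s ℕ.* d ℕ.+ i)
    ≡⟨ cong (act k p φ) (trans (cong (ℕ._+ i) (ℕ.+-comm k (s ℕ.* d))) (ℕ.+-assoc (s ℕ.* d) k i)) ⟩
  act k p φ (s ℕ.* d ℕ.+ (k ℕ.+ i))
    ≡⟨ periodic-∣ {φ = act k p φ} (ℕ.n∣m*n s) (act-periodic {d} {φ} k p φd) (k ℕ.+ i) ⟩
  act k p φ (k ℕ.+ i) ∎)
  where open ≡-Reasoning

periodic-% : ∀ {d φ} .{{_ : NonZero d}} → Periodic d φ → ∀ i → φ i ≡ φ (i % d)
periodic-% {d} {φ} φd i = trans (cong φ (trans (ℕ.m≡m%n+[m/n]*n i d) (ℕ.+-comm (i % d) _)))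
  (periodic-∣ {φ = φ} (ℕ.n∣m*n (i / d)) φd (i % d))

periodic-bounded : ∀ {d φ} .{{_ : NonZero d}} → Periodic d φ → ∃[ B ] Bounded B φ
periodic-bounded {d} {φ} φd with initial d
  where
  initial : ∀ m → ∃[ B ] (∀ i → i ℕ.< m → ∣ φ i ∣ ℕ.≤ B)
  initial zero = 0 , λ _ ()
  initial (suc m) with initial m
  ... | B , φ≤B = B ℕ.+ ∣ φ m ∣ , bound
    where
    bound : ∀ i → i ℕ.< suc m → ∣ φ i ∣ ℕ.≤ B ℕ.+ ∣ φ m ∣
    bound i (s≤s i≤m) with ℕ.m≤n⇒m<n∨m≡n i≤m
    ... | inj₁ i<m  = ℕ.m≤n⇒m≤n+o _ (φ≤B i i<m)
    ... | inj₂ refl = ℕ.m≤n+m _ B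
... | B , φ≤B = B , λ i → ℕ.≤-trans (ℕ.≤-reflexive (cong ∣_∣ (periodic-% {d} {φ} φd i))) (φ≤B (i % d) (ℕ.m%n<n i d))

-- The counterpart of the automorphism ζ ↦ ζ^k. On a d-periodic sequence S^k and S^(k + T d) agree,
-- and the prime factors of the second exponent all exceed Landau's threshold N.
conjugate-kills : ∀ f {d φ} .{{_ : NonZero d}} → Periodic d φ → f kills φ →
  ∀ k → gcd (suc k) d ≡ 1 → ∀ i → act (suc k) f φ i ≡ 0ℤ
conjugate-kills f {d} {φ} φd fφ≗0 k gcd≡1 i with periodic-bounded {d} {φ} φd
... | B , φ≤B = begin
  act (suc k) f φ i
    ≡⟨ sym (act-step-periodic {d} {φ} (suc k) T f φd i) ⟩
  act m f φ i
    ≡⟨ cong (λ t → act t f φ i) m≡product ⟩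
  act (product (PrimeFactorisation.factors pf)) f φ i
    ≡⟨ smooth-free-kills f {B} {φ} φ≤B fφ≗0 _ (PrimeFactorisation.factorsPrime pf)
         (λ {q} q-prime q∣ → smooth-free-residue (suc k) d N gcd≡1 q-prime (subst (q ∣_) (sym m≡product) q∣)) i ⟩
  0ℤ ∎
  where
  open ≡-Reasoning
  N = norm f ℕ.* B
  T = coprimeProduct (suc k) N
  m = suc k ℕ.+ T ℕ.* d
  pf = factorise m
  m≡product = PrimeFactorisation.isFactorisation pf

-- Ramanujan sums and divisibility by a cyclotomic polynomial

act-sum : ∀ k p m (g : Fin m → Seq) i →
  act k p (λ j → sumFin m (λ t → g t j)) i ≡ sumFin m (λ t → act k p (g t) i)
act-sum k p zero    g i = act-zero k p (λ _ → refl) i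
act-sum k p (suc m) g i = trans (act-+ˢ k p (g zero) (λ j → sumFin m (λ t → g (suc t) j)) i)
  (cong (act k p (g zero) i +_) (act-sum k p m (g ∘ suc) i))

sum-last : ∀ n (g : ℕ → ℤ) → sumFin n (g ∘ toℕ) + g n ≡ g 0 + sumFin n (λ t → g (suc (toℕ t)))
sum-last zero    g = trans (ℤ.+-identityˡ (g 0)) (sym (ℤ.+-identityʳ (g 0)))
sum-last (suc n) g = trans (ℤ.+-assoc (g 0) (sumFin n (λ t → g (suc (toℕ t)))) (g (suc n)))
  (cong (g 0 +_) (sum-last n (g ∘ suc)))

sum-rotate : ∀ n (g : ℕ → ℤ) → g n ≡ g 0 → sumFin n (λ t → g (suc (toℕ t))) ≡ sumFin n (g ∘ toℕ)
sum-rotate n g gn≡g0 = ∙-cancelˡ (g 0) (sumFin n (λ t → g (suc (toℕ t)))) (sumFin n (g ∘ toℕ))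
  (trans (sym (sum-last n g)) (trans (cong (sumFin n (g ∘ toℕ) +_) gn≡g0) (ℤ.+-comm _ (g 0))))

sum-shift : ∀ n {g : ℕ → ℤ} → Periodic n g → ∀ s → sumFin n (λ t → g (s ℕ.+ toℕ t)) ≡ sumFin n (g ∘ toℕ)
sum-shift n gn zero = refl
sum-shift n {g} gn (suc s) = trans (sumFin-cong n λ t → cong g (sym (ℕ.+-suc s (toℕ t))))
  (trans (sum-rotate n (λ x → g (s ℕ.+ x)) (trans (cong g (ℕ.+-comm s n))
    (trans (gn s) (cong g (sym (ℕ.+-identityʳ s)))))) (sum-shift n gn s))

comb-lcm : ∀ e p k → comb e k * comb p k ≡ comb (lcm e p) k
comb-lcm e p k with e ∣? k | p ∣? k
... | yes e∣k | yes p∣k = sym (comb-∣ (lcm-least e∣k p∣k))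
... | yes e∣k | no p∤k  = sym (comb-∤ (p∤k ∘ ℕ.∣-trans (n∣lcm[m,n] e p)))
... | no e∤k  | yes _   = sym (comb-∤ (e∤k ∘ ℕ.∣-trans (m∣lcm[m,n] e p)))
... | no e∤k  | no _    = sym (comb-∤ (e∤k ∘ ℕ.∣-trans (m∣lcm[m,n] e p)))

module _ (δ : ℕ) where

  private
    d = suc δ

    periodic : ∀ {φ} → cyclotomic d kills φ → Periodic d φ
    periodic {φ} = Factorised.killed⇒periodic (factorised δ) {φ}

  -- For φ i = ζ^i this is the character sum Σ w(k) ζ^(j k) times φ. The index k runs from 1 to d,
  -- hence is positive, as `conjugate-kills` requires.
  twistedSum : (ℕ → ℤ) → ℕ → Seq → Seq
  twistedSum w j φ i = sumFin d (λ t → w (suc (toℕ t)) * φ (j ℕ.* suc (toℕ t) ℕ.+ i))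

  act-twistedSum : ∀ w j φ p → ∀ i →
    (p • twistedSum w j φ) i ≡ twistedSum w j (p • φ) i
  act-twistedSum w j φ p i = trans
    (act-sum 1 p d (λ t i → w (suc (toℕ t)) * φ (j ℕ.* suc (toℕ t) ℕ.+ i)) i)
    (sumFin-cong d λ t → trans (act-*ˢ 1 p (w (suc (toℕ t))) (λ i → φ (j ℕ.* suc (toℕ t) ℕ.+ i)) i)
      (cong (w (suc (toℕ t)) *_) (act-shift 1 p φ (j ℕ.* suc (toℕ t)) i)))

  twistedSum-∣ : ∀ {e j φ} → Periodic d φ → d ∣ j ℕ.* e → ∀ i →
    twistedSum (comb e) j φ i ≡ sumFin d (λ t → comb e (suc (toℕ t))) * φ i
  twistedSum-∣ {e} {j} {φ} φd d∣je i =
    trans (sumFin-cong d term) (sumFin-*ʳ d (φ i) (λ t → comb e (suc (toℕ t))))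
    where
    term : ∀ t → comb e (suc (toℕ t)) * φ (j ℕ.* suc (toℕ t) ℕ.+ i) ≡ comb e (suc (toℕ t)) * φ i
    term t with e ∣? suc (toℕ t)
    ... | no _ = refl
    ... | yes e∣k = cong (1ℤ *_) (periodic-∣ {φ = φ} (ℕ.∣-trans d∣je (ℕ.*-monoʳ-∣ j e∣k)) φd i)

  -- Replacing k by k + e preserves the weight and a full period of summation, and moves the
  -- argument of φ by j e.
  twistedSum-periodic : ∀ {e j φ} → e ∣ d → Periodic d φ → Periodic (j ℕ.* e) (twistedSum (comb e) j φ)
  twistedSum-periodic {e} {j} {φ} e∣d φd i = begin
    sumFin d (λ t → comb e (suc (toℕ t)) * φ (j ℕ.* suc (toℕ t) ℕ.+ (j ℕ.* e ℕ.+ i)))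
      ≡⟨ sumFin-cong d (λ t → cong₂ _*_ (sym (comb-periodic e ℕ.∣-refl (suc (toℕ t))))
           (cong φ (regroup j (suc (toℕ t)) e i))) ⟩
    sumFin d (λ t → G (e ℕ.+ suc (toℕ t)))
      ≡⟨ sumFin-cong d (λ t → cong G (ℕ.+-suc e (toℕ t))) ⟩
    sumFin d (λ t → G (suc e ℕ.+ toℕ t))
      ≡⟨ sum-shift d {G} Gd (suc e) ⟩
    sumFin d (G ∘ toℕ)
      ≡⟨ sym (sum-shift d {G} Gd 1) ⟩
    sumFin d (λ t → G (suc (toℕ t))) ∎
    where
    open ≡-Reasoning
    G : ℕ → ℤ
    G k = comb e k * φ (j ℕ.* k ℕ.+ i)
    regroup : ∀ j k e i → j ℕ.* k ℕ.+ (j ℕ.* e ℕ.+ i) ≡ j ℕ.* (e ℕ.+ k) ℕ.+ i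
    regroup = ℕ-Solver.solve-∀
    Gd : Periodic d G
    Gd k = cong₂ _*_ (comb-periodic e e∣d k) (trans (cong φ (regroup′ j d k i))
      (periodic-∣ {φ = φ} (ℕ.n∣m*n j) φd (j ℕ.* k ℕ.+ i)))
      where
      regroup′ : ∀ j d k i → j ℕ.* (d ℕ.+ k) ℕ.+ i ≡ j ℕ.* d ℕ.+ (j ℕ.* k ℕ.+ i)
      regroup′ = ℕ-Solver.solve-∀

  -- The vanishing of a geometric sum with ratio ζ^(j e) ≠ 1: the sum is killed by `Φ d` like φ and
  -- has the period j e, no multiple of d.
  twistedSum-∤ : ∀ {e j φ} → e ∣ d → cyclotomic d kills φ → d ∤ j ℕ.* e → ∀ i →
    twistedSum (comb e) j φ i ≡ 0ℤ
  twistedSum-∤ {e} {j} {φ} e∣d Φφ≗0 d∤je =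
    killed∧periodic⇒zero δ {twistedSum (comb e) j φ} (j ℕ.* e) (λ i _ → factorised i)
      (λ i → trans (act-twistedSum (comb e) j φ (cyclotomic d) i)
        (sumFin-zero d λ t → trans (cong (comb e (suc (toℕ t)) *_) (Φφ≗0 (j ℕ.* suc (toℕ t) ℕ.+ i))) (ℤ.*-zeroʳ (comb e (suc (toℕ t))))))
      (twistedSum-periodic {e} {j} {φ} e∣d (periodic {φ} Φφ≗0)) d∤je

  -- Over ℂ: the sums Σ w(k) ζ^(j k), for ζ a primitive d-th root of unity, are integers.
  IntegralWeight : (ℕ → ℤ) → Set
  IntegralWeight w = ∀ j → Σ[ c ∈ ℤ ] (∀ φ → cyclotomic d kills φ → ∀ i → twistedSum w j φ i ≡ c * φ i)

  integralWeight-cong : ∀ w w′ → (∀ k → w k ≡ w′ k) → IntegralWeight w → IntegralWeight w′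
  integralWeight-cong w w′ w≗w′ w-int j with w-int j
  ... | c , eq = c , λ φ Φφ≗0 i →
    trans (sumFin-cong d λ t → cong (_* φ (j ℕ.* suc (toℕ t) ℕ.+ i)) (sym (w≗w′ (suc (toℕ t))))) (eq φ Φφ≗0 i)

  integralWeight-- : ∀ w w′ → IntegralWeight w → IntegralWeight w′ → IntegralWeight (λ k → w k - w′ k)
  integralWeight-- w w′ w-int w′-int j with w-int j | w′-int j
  ... | c , eq | c′ , eq′ = c - c′ , λ φ Φφ≗0 i → begin
    sumFin d (λ t → (w (suc (toℕ t)) - w′ (suc (toℕ t))) * φ (j ℕ.* suc (toℕ t) ℕ.+ i))
      ≡⟨ sumFin-cong d (λ t → distrib (w (suc (toℕ t))) (w′ (suc (toℕ t))) (φ (j ℕ.* suc (toℕ t) ℕ.+ i))) ⟩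
    sumFin d (λ t → w (suc (toℕ t)) * φ (j ℕ.* suc (toℕ t) ℕ.+ i) +
      - (w′ (suc (toℕ t)) * φ (j ℕ.* suc (toℕ t) ℕ.+ i)))
      ≡⟨ sumFin-+ d (λ t → w (suc (toℕ t)) * φ (j ℕ.* suc (toℕ t) ℕ.+ i)) (λ t → - (w′ (suc (toℕ t)) * φ (j ℕ.* suc (toℕ t) ℕ.+ i))) ⟩
    twistedSum w j φ i + sumFin d (λ t → - (w′ (suc (toℕ t)) * φ (j ℕ.* suc (toℕ t) ℕ.+ i)))
      ≡⟨ cong₂ _+_ (eq φ Φφ≗0 i) (trans
           (sumFin-neg d (λ t → w′ (suc (toℕ t)) * φ (j ℕ.* suc (toℕ t) ℕ.+ i)))
           (cong -_ (eq′ φ Φφ≗0 i))) ⟩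
    c * φ i + - (c′ * φ i)
      ≡⟨ sym (distrib c c′ (φ i)) ⟩
    (c - c′) * φ i ∎
    where
    open ≡-Reasoning
    distrib : ∀ a b x → (a - b) * x ≡ a * x + - (b * x)
    distrib = solve-∀

  integralWeight-comb : ∀ {e} → e ∣ d → IntegralWeight (comb e)
  integralWeight-comb {e} e∣d j with d ∣? j ℕ.* e
  ... | yes d∣je = sumFin d (λ t → comb e (suc (toℕ t))) , λ φ Φφ≗0 →
    twistedSum-∣ {e} {j} {φ} (periodic {φ} Φφ≗0) d∣je
  ... | no d∤je = 0ℤ , λ φ Φφ≗0 → twistedSum-∤ {e} {j} {φ} e∣d Φφ≗0 d∤je

  -- For t ≥ d - 1 this is the indicator function of the integers prime to d.
  weight : ℕ → ℕ → ℤ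
  weight zero    k = 1ℤ
  weight (suc t) k = if does (suc (suc t) ∣? d) then (1ℤ - comb (suc (suc t)) k) * weight t k else weight t k

  -- Inclusion and exclusion over the divisors of d. The extra factor `comb e` makes the induction
  -- go through, since a product of combs is the comb of the least common multiple, again a divisor
  -- of d.
  integralWeight-comb*weight : ∀ t {e} → e ∣ d → IntegralWeight (λ k → comb e k * weight t k)
  integralWeight-comb*weight zero {e} e∣d =
    integralWeight-cong (comb e) (λ k → comb e k * 1ℤ) (λ k → sym (ℤ.*-identityʳ (comb e k))) (integralWeight-comb e∣d)
  integralWeight-comb*weight (suc t) {e} e∣d with suc (suc t) ∣? d
  ... | no t∤d rewrite dec-false (suc (suc t) ∣? d) t∤d = integralWeight-comb*weight t e∣d
  ... | yes t∣d rewrite dec-true (suc (suc t) ∣? d) t∣d = integralWeight-cong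
    (λ k → comb e k * weight t k - comb (lcm e (suc (suc t))) k * weight t k)
    (λ k → comb e k * ((1ℤ - comb (suc (suc t)) k) * weight t k))
    (λ k → trans (cong (λ c → comb e k * weight t k - c * weight t k) (sym (comb-lcm e (suc (suc t)) k)))
      (regroup (comb e k) (comb (suc (suc t)) k) (weight t k)))
    (integralWeight-- (λ k → comb e k * weight t k) (λ k → comb (lcm e (suc (suc t))) k * weight t k)
      (integralWeight-comb*weight t e∣d) (integralWeight-comb*weight t (lcm-least e∣d t∣d)))
    where
    regroup : ∀ a b w → a * w - a * b * w ≡ a * ((1ℤ - b) * w)
    regroup = solve-∀

  integralWeight-weight : ∀ t → IntegralWeight (weight t)
  integralWeight-weight t = integralWeight-cong (λ k → comb 1 k * weight t k) (weight t)
    (λ k → trans (cong (_* weight t k) (comb-∣ (ℕ.1∣ k))) (ℤ.*-identityˡ (weight t k)))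
    (integralWeight-comb*weight t (ℕ.1∣ d))

  weight-1 : ∀ t → weight t 1 ≡ 1ℤ
  weight-1 zero = refl
  weight-1 (suc t) with does (suc (suc t) ∣? d)
  ... | false = weight-1 t
  ... | true  = cong₂ (λ c w → (1ℤ - c) * w)
    (comb-∤ {suc (suc t)} λ t∣1 → ℕ.1+n≢0 (ℕ.suc-injective (ℕ.∣1⇒≡1 t∣1))) (weight-1 t)

  weight-noncoprime : ∀ t s k → s ℕ.< t → suc (suc s) ∣ d → suc (suc s) ∣ k → weight t k ≡ 0ℤ
  weight-noncoprime (suc t) s k (s≤s s≤t) s∣d s∣k with ℕ.m≤n⇒m<n∨m≡n s≤t
  ... | inj₂ refl rewrite dec-true (suc (suc s) ∣? d) s∣d | comb-∣ s∣k = refl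
  ... | inj₁ s<t with does (suc (suc t) ∣? d)
  ...   | false = weight-noncoprime t s k s<t s∣d s∣k
  ...   | true  = trans (cong ((1ℤ - comb (suc (suc t)) k) *_) (weight-noncoprime t s k s<t s∣d s∣k))
    (ℤ.*-zeroʳ (1ℤ - comb (suc (suc t)) k))

  weight-zero⊎coprime : ∀ k → weight d k ≡ 0ℤ ⊎ gcd k d ≡ 1
  weight-zero⊎coprime k with gcd k d | gcd[m,n]∣m k d | gcd[m,n]∣n k d
  ... | zero        | _   | 0∣d = ⊥-elim (ℕ.1+n≢0 (ℕ.0∣⇒≡0 0∣d))
  ... | suc zero    | _   | _   = inj₂ refl
  ... | suc (suc s) | s∣k | s∣d = inj₁ (weight-noncoprime d s k (ℕ.≤-trans (ℕ.n≤1+n _) (ℕ.∣⇒≤ s∣d)) s∣d s∣k)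

  -- The trace of ζ^j from ℚ(ζ) to ℚ, available as an integer because its weight is integral.
  ramanujan : Seq
  ramanujan j = proj₁ (integralWeight-weight d j)

  ramanujan-sum : ∀ φ → cyclotomic d kills φ → ∀ j i → ramanujan j * φ i ≡ twistedSum (weight d) j φ i
  ramanujan-sum φ Φφ≗0 j i = sym (proj₂ (integralWeight-weight d j) φ Φφ≗0 i)

  -- For i with φ i ≠ 0, φ i times `ramanujan` is a weighted sum of the sequences j ↦ φ (j k + i)
  -- with k prime to d. On such a sample f(S) acts as f(S^k) does on φ, which gives zero.
  common-kills-ramanujan : ∀ f φ {i} → cyclotomic d kills φ → f kills φ → φ i ≢ 0ℤ → f kills ramanujan
  common-kills-ramanujan f φ {i} Φφ≗0 fφ≗0 φi≢0 l = cancel-nonzero φi≢0 (begin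
    φ i * (f • ramanujan) l
      ≡⟨ sym (act-*ˢ 1 f (φ i) ramanujan l) ⟩
    (f • (λ j → φ i * ramanujan j)) l
      ≡⟨ act-cong 1 f (λ j → trans (ℤ.*-comm (φ i) (ramanujan j)) (ramanujan-sum φ Φφ≗0 j i)) l ⟩
    (f • (λ j → sumFin d (λ t → weight d (suc (toℕ t)) * φ (j ℕ.* suc (toℕ t) ℕ.+ i)))) l
      ≡⟨ act-sum 1 f d (λ t j → weight d (suc (toℕ t)) * φ (j ℕ.* suc (toℕ t) ℕ.+ i)) l ⟩
    sumFin d (λ t → (f • (λ j → weight d (suc (toℕ t)) * φ (j ℕ.* suc (toℕ t) ℕ.+ i))) l)
      ≡⟨ sumFin-zero d term ⟩
    0ℤ ∎)
    where
    open ≡-Reasoning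
    term : ∀ t → (f • (λ j → weight d (suc (toℕ t)) * φ (j ℕ.* suc (toℕ t) ℕ.+ i))) l ≡ 0ℤ
    term t with weight-zero⊎coprime (suc (toℕ t))
    ... | inj₁ w≡0 = act-zero 1 f (λ j → cong (_* φ (j ℕ.* suc (toℕ t) ℕ.+ i)) w≡0) l
    ... | inj₂ gcd≡1 = trans (act-*ˢ 1 f (weight d k) (λ j → φ (j ℕ.* k ℕ.+ i)) l)
      (trans (cong (weight d k *_) (trans (act-dilate 1 f φ k i l)
        (trans (cong (λ m → act m f φ (l ℕ.* k ℕ.+ i)) (ℕ.+-identityʳ k))
          (conjugate-kills f {d} {φ} (periodic {φ} Φφ≗0) fφ≗0 (toℕ t) gcd≡1 (l ℕ.* k ℕ.+ i)))))
        (ℤ.*-zeroʳ (weight d k)))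
      where k = suc (toℕ t)

  -- Fourier inversion: every sequence killed by Φ d is, up to the factor d, a combination of shifts of ramanujan.
  ramanujan-spans : ∀ χ → cyclotomic d kills χ → ∀ i →
    sumFin d (λ s → ramanujan (suc (toℕ s) ℕ.+ i) * χ (δ ℕ.* suc (toℕ s))) ≡ ℤ.+ d * χ i
  ramanujan-spans χ Φχ≗0 i = begin
    sumFin d (λ s → ramanujan (suc (toℕ s) ℕ.+ i) * χ (δ ℕ.* suc (toℕ s)))
      -- As δ ≡ -1 modulo d, the coefficient χ (δ s) is χ (- s).
      ≡⟨ sumFin-cong d (λ s → trans (ramanujan-sum χ Φχ≗0 (suc (toℕ s) ℕ.+ i) (δ ℕ.* suc (toℕ s)))
           (sumFin-cong d λ t → cong (λ m → weight d (suc (toℕ t)) * χ m) (regroup (suc (toℕ s)) i (suc (toℕ t)) δ))) ⟩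
    sumFin d (λ s → sumFin d (λ t → weight d (suc (toℕ t)) * X t s))
      ≡⟨ sumFin-exchange d d (λ s t → weight d (suc (toℕ t)) * X t s) ⟩
    sumFin d (λ t → sumFin d (λ s → weight d (suc (toℕ t)) * X t s))
      ≡⟨ sumFin-cong d (λ t → trans (sumFin-*ˡ d (weight d (suc (toℕ t))) (X t))
           (cong (weight d (suc (toℕ t)) *_) (sumFin-cong d λ s →
             sym (trans (cong (_* X t s) (comb-∣ (ℕ.1∣ suc (toℕ s)))) (ℤ.*-identityˡ (X t s)))))) ⟩
    sumFin d (λ t → weight d (suc (toℕ t)) * twistedSum (comb 1) (δ ℕ.+ suc (toℕ t)) χ (i ℕ.* suc (toℕ t)))
      -- Orthogonality: the inner sum vanishes unless d divides δ + k, which for 1 ≤ k ≤ d leaves k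
      -- = 1 alone.
      ≡⟨ cong₂ _+_ first (sumFin-zero δ rest) ⟩
    ℤ.+ d * χ i + 0ℤ
      ≡⟨ ℤ.+-identityʳ _ ⟩
    ℤ.+ d * χ i ∎
    where
    open ≡-Reasoning
    X : Fin d → Fin d → ℤ
    X t s = χ ((δ ℕ.+ suc (toℕ t)) ℕ.* suc (toℕ s) ℕ.+ i ℕ.* suc (toℕ t))
    regroup : ∀ s i t δ → (s ℕ.+ i) ℕ.* t ℕ.+ δ ℕ.* s ≡ (δ ℕ.+ t) ℕ.* s ℕ.+ i ℕ.* t
    regroup = ℕ-Solver.solve-∀
    count : ∀ m → sumFin m (λ t → comb 1 (suc (toℕ t))) ≡ ℤ.+ m
    count m = trans (sumFin-cong m λ t → comb-∣ (ℕ.1∣ suc (toℕ t))) (ones m)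
      where
      ones : ∀ m → sumFin m (λ _ → 1ℤ) ≡ ℤ.+ m
      ones zero    = refl
      ones (suc m) = cong (1ℤ +_) (ones m)
    first : weight d 1 * twistedSum (comb 1) (δ ℕ.+ 1) χ (i ℕ.* 1) ≡ ℤ.+ d * χ i
    first = trans (cong (_* twistedSum (comb 1) (δ ℕ.+ 1) χ (i ℕ.* 1)) (weight-1 d))
      (trans (ℤ.*-identityˡ (twistedSum (comb 1) (δ ℕ.+ 1) χ (i ℕ.* 1)))
      (trans (twistedSum-∣ {1} {δ ℕ.+ 1} {χ} (periodic {χ} Φχ≗0)
          (ℕ.∣-reflexive (trans (ℕ.+-comm 1 δ) (sym (ℕ.*-identityʳ (δ ℕ.+ 1))))) (i ℕ.* 1))
        (cong₂ (λ a b → a * χ b) (count d) (ℕ.*-identityʳ i))))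
    rest : ∀ t → weight d (suc (suc (toℕ t))) *
      twistedSum (comb 1) (δ ℕ.+ suc (suc (toℕ t))) χ (i ℕ.* suc (suc (toℕ t))) ≡ 0ℤ
    rest t = trans (cong (weight d (suc (suc (toℕ t))) *_)
      (twistedSum-∤ {1} {δ ℕ.+ suc (suc (toℕ t))} {χ} (ℕ.1∣ d) Φχ≗0 d∤ (i ℕ.* suc (suc (toℕ t)))))
      (ℤ.*-zeroʳ (weight d (suc (suc (toℕ t)))))
      where
      d∤ : d ∤ (δ ℕ.+ suc (suc (toℕ t))) ℕ.* 1
      d∤ d∣ = ℕ.<⇒≱ (s≤s (Fin.toℕ<n t)) (ℕ.∣⇒≤ (ℕ.∣m+n∣m⇒∣n
        (subst (d ∣_) (trans (ℕ.*-identityʳ _) (ℕ.+-suc δ (suc (toℕ t)))) d∣) ℕ.∣-refl))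

  -- The irreducibility of `Φ d` in the form needed: one nonzero common solution suffices. Fourier
  -- inversion carries the annihilation from `ramanujan` to d times the generator, and whatever
  -- kills the generator is a multiple of `Φ d`.
  common-kills⇒∣ : ∀ f φ {i} → cyclotomic d kills φ → f kills φ → φ i ≢ 0ℤ → cyclotomic d ∣ᵖ f
  common-kills⇒∣ f φ Φφ≗0 fφ≗0 φi≢0 = kills-generator⇒∣ δ (λ e _ → factorised e) f λ i →
    cancel-nonzero {ℤ.+ d} (λ ()) (begin
      ℤ.+ d * (f • χ) i
        ≡⟨ sym (act-*ˢ 1 f (ℤ.+ d) χ i) ⟩
      (f • (λ i → ℤ.+ d * χ i)) i
        ≡⟨ act-cong 1 f (λ i → sym (ramanujan-spans χ (generator-killed δ (factorised δ)) i)) i ⟩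
      (f • (λ i → sumFin d (λ s → ramanujan (suc (toℕ s) ℕ.+ i) * χ (δ ℕ.* suc (toℕ s))))) i
        ≡⟨ act-sum 1 f d (λ s i → ramanujan (suc (toℕ s) ℕ.+ i) * χ (δ ℕ.* suc (toℕ s))) i ⟩
      sumFin d (λ s → (f • (λ i → ramanujan (suc (toℕ s) ℕ.+ i) * χ (δ ℕ.* suc (toℕ s)))) i)
        ≡⟨ sumFin-zero d (λ s → trans
             (act-cong 1 f (λ i → ℤ.*-comm (ramanujan (suc (toℕ s) ℕ.+ i)) (χ (δ ℕ.* suc (toℕ s)))) i)
             (trans (act-*ˢ 1 f (χ (δ ℕ.* suc (toℕ s))) (λ i → ramanujan (suc (toℕ s) ℕ.+ i)) i)
               (trans (cong (χ (δ ℕ.* suc (toℕ s)) *_) (trans (act-shift 1 f ramanujan (suc (toℕ s)) i)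
                 (common-kills-ramanujan f φ Φφ≗0 fφ≗0 φi≢0 (suc (toℕ s) ℕ.+ i))))
                 (ℤ.*-zeroʳ (χ (δ ℕ.* suc (toℕ s))))))) ⟩
      0ℤ ∎)
    where
    open ≡-Reasoning
    χ = generator δ

-- Nonzero sequences killed by a cyclotomic polynomial

periodic-zero⊎nonzero : ∀ {n φ} .{{_ : NonZero n}} → Periodic n φ → (∀ i → φ i ≡ 0ℤ) ⊎ (∃[ i ] φ i ≢ 0ℤ)
periodic-zero⊎nonzero {n} {φ} φn with allZero⊎nonzero n (φ ∘ toℕ)
... | inj₂ (i , φi≢0) = inj₂ (toℕ i , φi≢0)
... | inj₁ φ≗0 = inj₁ λ i → trans (periodic-% {n} {φ} φn i)
  (trans (cong φ (sym (Fin.toℕ-fromℕ< (ℕ.m%n<n i n)))) (φ≗0 (fromℕ< (ℕ.m%n<n i n))))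

prime-divisor : ∀ n → 1 ℕ.< n → ∃[ p ] (Prime p × p ∣ n)
prime-divisor 1 (s≤s ())
prime-divisor n@(suc (suc _)) _ with factorise n
... | record { factors = [] ; isFactorisation = () }
... | record { factors = p ∷ ps ; isFactorisation = n≡ ; factorsPrime = p-prime ∷ _ } =
  p , p-prime , subst (p ∣_) (sym n≡) (ℕ.m∣m*n (product ps))

module _ (δ : ℕ) where

  private
    d = suc δ

  -- In terms of roots of unity, the image of 1 - S^(d / p) has no component at roots of order
  -- dividing d / p. Every proper divisor of d divides some d / p, so for t = d the primitive roots
  -- alone remain.
  Primitive : ℕ → Seq → Set
  Primitive t χ = ∀ p → Prime p → p ℕ.≤ t → ∀ h → h ℕ.* p ≡ d →
    Σ[ η ∈ Seq ] (Periodic d η × (∀ i → χ i ≡ η i + -1ℤ * η (h ℕ.+ i)))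

  primitive-• : ∀ t {χ} p → Primitive t χ → Primitive t (p • χ)
  primitive-• t {χ} f χ-primitive p p-prime p≤t h hp≡d with χ-primitive p p-prime p≤t h hp≡d
  ... | η , ηd , χ≗ = f • η , periodic-• {d} {η} f ηd , λ i → begin
    (f • χ) i
      ≡⟨ act-cong 1 f χ≗ i ⟩
    (f • (λ i → η i + -1ℤ * η (h ℕ.+ i))) i
      ≡⟨ act-+ˢ 1 f η (λ i → -1ℤ * η (h ℕ.+ i)) i ⟩
    (f • η) i + (f • (λ i → -1ℤ * η (h ℕ.+ i))) i
      ≡⟨ cong ((f • η) i +_) (trans (act-*ˢ 1 f -1ℤ (λ i → η (h ℕ.+ i)) i)
           (cong (-1ℤ *_) (act-shift 1 f η h i))) ⟩
    (f • η) i + -1ℤ * (f • η) (h ℕ.+ i) ∎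
    where open ≡-Reasoning

  -- For a prime p dividing d / (e + 1), the number h = d / p is a period of χ, and χ = η - S^h η.
  -- Hence η drops by χ i with each step h from i; after p steps it has returned to its start, so p
  -- χ i = 0.
  primitive∧periodic⇒zero : ∀ e {χ} → e ℕ.< δ → suc e ∣ d → Primitive d χ → Periodic (suc e) χ → ∀ i → χ i ≡ 0ℤ
  primitive∧periodic⇒zero e {χ} e<δ (ℕ.divides q d≡qe) χ-primitive χe i
    with prime-divisor q (>1 q d≡qe)
    where
    >1 : ∀ q → d ≡ q ℕ.* suc e → 1 ℕ.< q
    >1 zero d≡0 = ⊥-elim (ℕ.1+n≢0 d≡0)
    >1 (suc zero) d≡e = ⊥-elim (ℕ.<-irrefl (sym (trans d≡e (ℕ.*-identityˡ (suc e)))) (s≤s e<δ))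
    >1 (suc (suc _)) _ = s≤s (s≤s z≤n)
  ... | p , p-prime , ℕ.divides c q≡cp = cancel-nonzero p≢0 (begin
    ℤ.+ p * χ i
      ≡⟨ isolate (η i) (ℤ.+ p * χ i) ⟩
    η i - (η i - ℤ.+ p * χ i)
      ≡⟨ cong (λ z → η i - z) (sym (descend p)) ⟩
    η i - η (p ℕ.* h ℕ.+ i)
      ≡⟨ cong (λ z → η i - z) (trans (cong (λ m → η (m ℕ.+ i)) (trans (ℕ.*-comm p h) hp≡d)) (ηd i)) ⟩
    η i - η i
      ≡⟨ ℤ.+-inverseʳ (η i) ⟩
    0ℤ ∎)
    where
    open ≡-Reasoning
    h = c ℕ.* suc e
    hp≡d : h ℕ.* p ≡ d
    hp≡d = trans (regroup c (suc e) p) (sym (trans d≡qe (cong (ℕ._* suc e) q≡cp)))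
      where
      regroup : ∀ c e p → c ℕ.* e ℕ.* p ≡ c ℕ.* p ℕ.* e
      regroup = ℕ-Solver.solve-∀
    p≢0 : ℤ.+ p ≢ 0ℤ
    p≢0 p≡0 = ¬prime[0] (subst Prime (ℤ.+-injective p≡0) p-prime)
    χ-image = χ-primitive p p-prime (ℕ.∣⇒≤ (ℕ.divides h (sym hp≡d))) h hp≡d
    η = proj₁ χ-image
    ηd : Periodic d η
    ηd = proj₁ (proj₂ χ-image)
    isolate : ∀ a b → b ≡ a - (a - b)
    isolate = solve-∀
    descend : ∀ k → η (k ℕ.* h ℕ.+ i) ≡ η i - ℤ.+ k * χ i
    descend zero = sym (trans (cong (λ z → η i - z) (ℤ.*-zeroˡ (χ i))) (ℤ.+-identityʳ (η i)))
    descend (suc k) = begin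
      η (h ℕ.+ k ℕ.* h ℕ.+ i)
        ≡⟨ cong η (ℕ.+-assoc h (k ℕ.* h) i) ⟩
      η (h ℕ.+ (k ℕ.* h ℕ.+ i))
        ≡⟨ solve-for (η (k ℕ.* h ℕ.+ i)) (η (h ℕ.+ (k ℕ.* h ℕ.+ i))) ⟩
      η (k ℕ.* h ℕ.+ i) - (η (k ℕ.* h ℕ.+ i) + -1ℤ * η (h ℕ.+ (k ℕ.* h ℕ.+ i)))
        ≡⟨ cong₂ _-_ (descend k) (trans (sym (proj₂ (proj₂ χ-image) (k ℕ.* h ℕ.+ i)))
             (periodic-∣ {φ = χ} (ℕ.∣n⇒∣m*n k (ℕ.n∣m*n c)) χe i)) ⟩
      (η i - ℤ.+ k * χ i) - χ i
        ≡⟨ collect (η i) (ℤ.+ k) (χ i) ⟩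
      η i - (1ℤ + ℤ.+ k) * χ i ∎
      where
      solve-for : ∀ a b → b ≡ a - (a + -1ℤ * b)
      solve-for = solve-∀
      collect : ∀ a k x → (a - k * x) - x ≡ a - (1ℤ + k) * x
      collect = solve-∀

  -- `N` bounds the denominators of i / d on the support of θ. If h = d / p lay in the support for
  -- the next prime p, then p would divide `N`, whose primes are at most t. So θ h = 0, and the
  -- value 1 at 0 survives the next factor 1 - S^h.
  record PrimitiveUpTo (t : ℕ) : Set where
    field
      θ         : Seq
      N         : ℕ
      N-primes  : ∀ {q} → Prime q → q ∣ N → q ℕ.≤ t
      support   : ∀ i → θ i ≢ 0ℤ → d ∣ N ℕ.* i
      at-0      : θ 0 ≡ 1ℤ
      periodic  : Periodic d θ
      isPrimitive : Primitive t θ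

  -- θ = ∏ (1 - S^(d / p)) comb d over the primes p ≤ t dividing d. It does not vanish at 0, because
  -- a nonempty sum of fractions 1 / p over distinct primes p is not an integer.
  primitiveUpTo : ∀ t → PrimitiveUpTo t
  primitiveUpTo zero = record
    { θ = comb d ; N = 1
    ; N-primes  = λ q-prime q∣1 → ⊥-elim (¬prime[1] (subst Prime (ℕ.∣1⇒≡1 q∣1) q-prime))
    ; support   = λ i θi≢0 → subst (d ∣_) (sym (ℕ.*-identityˡ i)) (comb-support i θi≢0)
    ; at-0      = comb-∣ (d ℕ.∣0)
    ; periodic  = comb-periodic d ℕ.∣-refl
    ; isPrimitive = λ { zero p-prime z≤n → ⊥-elim (¬prime[0] p-prime) } }
    where
    comb-support : ∀ i → comb d i ≢ 0ℤ → d ∣ i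
    comb-support i ci≢0 with d ∣? i
    ... | yes d∣i = d∣i
    ... | no d∤i  = ⊥-elim (ci≢0 (comb-∤ d∤i))
  primitiveUpTo (suc t) with primitiveUpTo t | prime? (suc t) | suc t ∣? d
  ... | P | no ¬p-prime | _ = record
    { θ = θ ; N = N ; support = support ; at-0 = at-0 ; periodic = periodic
    ; N-primes = λ q-prime q∣N → ℕ.m≤n⇒m≤1+n (N-primes q-prime q∣N)
    ; isPrimitive = λ p p-prime p≤ h hp≡d → isPrimitive p p-prime
        (ℕ.≤-pred (ℕ.≤∧≢⇒< p≤ λ { refl → ¬p-prime p-prime })) h hp≡d }
    where open PrimitiveUpTo P
  ... | P | yes _ | no p∤d = record
    { θ = θ ; N = N ; support = support ; at-0 = at-0 ; periodic = periodic
    ; N-primes = λ q-prime q∣N → ℕ.m≤n⇒m≤1+n (N-primes q-prime q∣N)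
    ; isPrimitive = λ p p-prime p≤ h hp≡d → isPrimitive p p-prime
        (ℕ.≤-pred (ℕ.≤∧≢⇒< p≤ λ { refl → p∤d (ℕ.divides h (sym hp≡d)) })) h hp≡d }
    where open PrimitiveUpTo P
  ... | P | yes p-prime | yes (ℕ.divides h d≡hp) = record
    { θ         = θ′
    ; N         = N ℕ.* p
    ; N-primes  = N′-primes
    ; support   = support′
    ; at-0      = trans (cong₂ (λ a b → a + -1ℤ * b) at-0 (trans (cong θ (ℕ.+-identityʳ h)) θh≡0)) refl
    ; periodic  = λ i → cong₂ (λ a b → a + -1ℤ * b) (periodic i)
        (trans (cong θ (swapˡ h d i)) (periodic (h ℕ.+ i)))
    ; isPrimitive = primitive′ }
    where
    open PrimitiveUpTo P
    p = suc t
    θ′ : Seq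
    θ′ i = θ i + -1ℤ * θ (h ℕ.+ i)
    swapˡ : ∀ a b c → a ℕ.+ (b ℕ.+ c) ≡ b ℕ.+ (a ℕ.+ c)
    swapˡ = ℕ-Solver.solve-∀
    h≢0 : NonZero h
    h≢0 = ℕ.≢-nonZero λ { refl → ℕ.1+n≢0 d≡hp }
    θh≡0 : θ h ≡ 0ℤ
    θh≡0 with θ h ℤ.≟ 0ℤ
    ... | yes θh≡0 = θh≡0
    ... | no θh≢0 = ⊥-elim (ℕ.1+n≰n (N-primes p-prime (ℕ.*-cancelˡ-∣ h {{h≢0}}
      (subst₂ _∣_ d≡hp (ℕ.*-comm N h) (support h θh≢0)))))
    N′-primes : ∀ {q} → Prime q → q ∣ N ℕ.* p → q ℕ.≤ suc t
    N′-primes q-prime q∣Np with euclidsLemma N p q-prime q∣Np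
    ... | inj₁ q∣N = ℕ.m≤n⇒m≤1+n (N-primes q-prime q∣N)
    ... | inj₂ q∣p = ℕ.∣⇒≤ q∣p
    support′ : ∀ i → θ′ i ≢ 0ℤ → d ∣ N ℕ.* p ℕ.* i
    support′ i θ′i≢0 with θ i ℤ.≟ 0ℤ | θ (h ℕ.+ i) ℤ.≟ 0ℤ
    ... | no θi≢0 | _ = subst (d ∣_) (regroup p N i) (ℕ.∣n⇒∣m*n p (support i θi≢0))
      where
      regroup : ∀ p N i → p ℕ.* (N ℕ.* i) ≡ N ℕ.* p ℕ.* i
      regroup = ℕ-Solver.solve-∀
    ... | yes θi≡0 | yes θhi≡0 = ⊥-elim (θ′i≢0 (cong₂ (λ a b → a + -1ℤ * b) θi≡0 θhi≡0))
    ... | yes _ | no θhi≢0 = ℕ.∣m+n∣m⇒∣n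
      (subst (d ∣_) (trans (regroup p N h i) (cong (λ m → N ℕ.* m ℕ.+ N ℕ.* p ℕ.* i) (sym d≡hp)))
        (ℕ.∣n⇒∣m*n p (support (h ℕ.+ i) θhi≢0)))
      (ℕ.n∣m*n N)
      where
      regroup : ∀ p N h i → p ℕ.* (N ℕ.* (h ℕ.+ i)) ≡ N ℕ.* (h ℕ.* p) ℕ.+ N ℕ.* p ℕ.* i
      regroup = ℕ-Solver.solve-∀
    primitive′ : Primitive (suc t) θ′
    primitive′ r r-prime r≤ g gr≡d with ℕ.m≤n⇒m<n∨m≡n r≤
    ... | inj₂ refl rewrite ℕ.*-cancelʳ-≡ g h p (trans gr≡d d≡hp) = θ , periodic , λ i → refl
    ... | inj₁ (s≤s r≤t) with isPrimitive r r-prime r≤t g gr≡d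
    ...   | η , ηd , θ≗ = (λ i → η i + -1ℤ * η (h ℕ.+ i))
      , (λ i → cong₂ (λ a b → a + -1ℤ * b) (ηd i) (trans (cong η (swapˡ h d i)) (ηd (h ℕ.+ i))))
      , λ i → trans (cong₂ (λ a b → a + -1ℤ * b) (θ≗ i) (θ≗ (h ℕ.+ i)))
          (trans (cong (λ m → (η i + -1ℤ * η (g ℕ.+ i)) + -1ℤ * (η (h ℕ.+ i) + -1ℤ * η m)) (swapˡ g h i))
            (regroup (η i) (η (g ℕ.+ i)) (η (h ℕ.+ i)) (η (h ℕ.+ (g ℕ.+ i)))))
      where
      regroup : ∀ a b c e → (a + -1ℤ * b) + -1ℤ * (c + -1ℤ * e) ≡ (a + -1ℤ * c) + -1ℤ * (b + -1ℤ * e)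
      regroup = solve-∀

  -- Excludes `Φ d` = 1. The d-periodic θ is sent by the complementary product to a sequence killed
  -- by `Φ d`, and this product is injective on primitive sequences.
  killed-nonzero : Σ[ χ ∈ Seq ] (cyclotomic d kills χ × (∃[ i ] χ i ≢ 0ℤ))
  killed-nonzero = χ , Φχ≗0 , χ≢0
    where
    open PrimitiveUpTo (primitiveUpTo d)
    χ = Φ∏ d δ • θ
    Φχ≗0 : cyclotomic d kills χ
    Φχ≗0 = *-kills⁻¹ (cyclotomic d) (Φ∏ d δ) {θ}
      (kills-≋ (ℤ[x].sym (Factorised.Φ*Φ∏ (factorised δ))) (periodic⇒xⁿ-1-kills d {θ} periodic))
    1≢0 : 1ℤ ≢ 0ℤ
    1≢0 ()
    decide : (∀ i → χ i ≡ 0ℤ) ⊎ (∃[ i ] χ i ≢ 0ℤ) → ∃[ i ] χ i ≢ 0ℤ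
    decide (inj₂ nonzero) = nonzero
    decide (inj₁ χ≗0) = ⊥-elim (1≢0 (trans (sym at-0) (Φ∏-injective (Primitive d) d δ
      (λ {χ} f → primitive-• d {χ} f) (λ e _ _ → factorised e)
      (λ e {χ} e<δ e∣d → primitive∧periodic⇒zero e {χ} e<δ e∣d) {θ} isPrimitive χ≗0 0)))
    χ≢0 : ∃[ i ] χ i ≢ 0ℤ
    χ≢0 = decide (periodic-zero⊎nonzero {d} {χ} (Factorised.killed⇒periodic (factorised δ) {χ} Φχ≗0))

-- If the last factor kills φ, it divides f. Otherwise its image of φ is a nonzero sequence, still
-- killed by f and by the remaining product.
cyclotomic-divisor : ∀ n k f φ → .{{_ : NonZero n}} → Periodic n φ → (∃[ i ] φ i ≢ 0ℤ) →
  Φ∏ n k kills φ → f kills φ → ∃[ δ ] (suc δ ∣ n × cyclotomic (suc δ) ∣ᵖ f)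
cyclotomic-divisor n zero f φ φn (i , φi≢0) 1φ≗0 fφ≗0 = ⊥-elim (φi≢0 (trans (sym (xpow-act 0 φ i)) (1φ≗0 i)))
cyclotomic-divisor n (suc k) f φ φn (i , φi≢0) Pφ≗0 fφ≗0 with suc k ∣? n
... | no k∤n rewrite Φ∏-∤ n k k∤n = cyclotomic-divisor n k f φ φn (i , φi≢0) Pφ≗0 fφ≗0
... | yes k∣n rewrite Φ∏-∣ n k k∣n = decide (periodic-zero⊎nonzero {n} {ψ} ψn)
  where
  ψ = cyclotomic (suc k) • φ
  ψn : Periodic n ψ
  ψn = periodic-• {n} {φ} (cyclotomic (suc k)) φn
  decide : (∀ i → ψ i ≡ 0ℤ) ⊎ (∃[ i ] ψ i ≢ 0ℤ) → ∃[ δ ] (suc δ ∣ n × cyclotomic (suc δ) ∣ᵖ f)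
  decide (inj₁ Φφ≗0) = k , k∣n , common-kills⇒∣ k f φ {i} Φφ≗0 fφ≗0 φi≢0
  decide (inj₂ ψ≢0)  = cyclotomic-divisor n k f ψ ψn ψ≢0
    (*-kills⁻¹ (Φ∏ n k) (cyclotomic (suc k)) {φ} Pφ≗0) (kills-• {f} {φ} (cyclotomic (suc k)) fφ≗0)

PeriodicSolution : ℕ → Poly → Set
PeriodicSolution n f = Σ[ φ ∈ Seq ] (Periodic n φ × (∃[ i ] φ i ≢ 0ℤ) × f kills φ)

periodicSolution⇒cyclotomic : ∀ n f .{{_ : NonZero n}} → PeriodicSolution n f →
  ∃[ δ ] (suc δ ∣ n × cyclotomic (suc δ) ∣ᵖ f)
periodicSolution⇒cyclotomic (suc ν) f (φ , φn , φ≢0 , fφ≗0) =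
  cyclotomic-divisor (suc ν) (suc ν) f φ φn φ≢0
    (kills-≋ {xⁿ-1 (suc ν)} {Φ∏ (suc ν) (suc ν)} {φ} (ℤ[x].sym (Factorised.Φ∏≋xⁿ-1 (factorised ν)))
      (periodic⇒xⁿ-1-kills (suc ν) {φ} φn)) fφ≗0

cyclotomic⇒periodicSolution : ∀ n f δ → suc δ ∣ n → cyclotomic (suc δ) ∣ᵖ f → PeriodicSolution n f
cyclotomic⇒periodicSolution n f δ δ∣n Φ∣f = solve (killed-nonzero δ)
  where
  solve : Σ[ χ ∈ Seq ] (cyclotomic (suc δ) kills χ × (∃[ i ] χ i ≢ 0ℤ)) → PeriodicSolution n f
  solve (χ , Φχ≗0 , χ≢0) =
    χ , periodic-∣ {φ = χ} δ∣n (Factorised.killed⇒periodic (factorised δ) {χ} Φχ≗0) , χ≢0 ,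
    ∣-kills {cyclotomic (suc δ)} {f} {χ} Φ∣f Φχ≗0

-- The Cayley graph

tabulate-act : ∀ n (g : Fin n → ℤ) φ i →
  (List.tabulate g • φ) i ≡ sumFin n (λ j → g j * φ (toℕ j ℕ.+ i))
tabulate-act zero    g φ i = refl
tabulate-act (suc n) g φ i = cong (g zero * φ i +_)
  (trans (tabulate-act n (g ∘ suc) φ (suc i))
    (sumFin-cong n λ j → cong (λ m → g (suc j) * φ m) (ℕ.+-suc (toℕ j) i)))

sumFin-split : ∀ m k (f : Fin (m ℕ.+ k) → ℤ) →
  sumFin (m ℕ.+ k) f ≡ sumFin m (λ i → f (i ↑ˡ k)) + sumFin k (λ j → f (m ↑ʳ j))
sumFin-split zero    k f = sym (ℤ.+-identityˡ _)
sumFin-split (suc m) k f = trans (cong (f zero +_) (sumFin-split m k (f ∘ suc)))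
  (sym (ℤ.+-assoc (f zero) (sumFin m (λ i → f (suc i ↑ˡ k))) (sumFin k (λ j → f (suc m ↑ʳ j)))))

toℕ-mod : ∀ a n .{{_ : NonZero n}} → toℕ (a mod n) ≡ a % n
toℕ-mod a n = Fin.toℕ-fromℕ< (ℕ.m%n<n a n)

mod-cong : ∀ a b n .{{_ : NonZero n}} → a % n ≡ b % n → a mod n ≡ b mod n
mod-cong a b n eq = Fin.toℕ-injective (trans (toℕ-mod a n) (trans eq (sym (toℕ-mod b n))))

mod-toℕ : ∀ {n} .{{_ : NonZero n}} (i : Fin n) → toℕ i mod n ≡ i
mod-toℕ {n} i = Fin.toℕ-injective (trans (toℕ-mod (toℕ i) n) (ℕ.m<n⇒m%n≡m (Fin.toℕ<n i)))

module _ (n : ℕ) where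

  transform : (ℕ → ℕ → ℤ) → Seq → Seq
  transform κ φ i = sumFin n (λ j → κ i (toℕ j) * φ (toℕ j))

  transform-∘ : ∀ κ ρ φ i → transform κ (transform ρ φ) i ≡
    transform (λ i j → sumFin n (λ k → κ i (toℕ k) * ρ (toℕ k) j)) φ i
  transform-∘ κ ρ φ i = begin
    sumFin n (λ k → κ i (toℕ k) * sumFin n (λ j → ρ (toℕ k) (toℕ j) * φ (toℕ j)))
      ≡⟨ sumFin-cong n (λ k → trans
           (sym (sumFin-*ˡ n (κ i (toℕ k)) (λ j → ρ (toℕ k) (toℕ j) * φ (toℕ j))))
           (sumFin-cong n λ j → sym (ℤ.*-assoc (κ i (toℕ k)) (ρ (toℕ k) (toℕ j)) (φ (toℕ j))))) ⟩
    sumFin n (λ k → sumFin n (λ j → κ i (toℕ k) * ρ (toℕ k) (toℕ j) * φ (toℕ j)))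
      ≡⟨ sumFin-exchange n n (λ k j → κ i (toℕ k) * ρ (toℕ k) (toℕ j) * φ (toℕ j)) ⟩
    sumFin n (λ j → sumFin n (λ k → κ i (toℕ k) * ρ (toℕ k) (toℕ j) * φ (toℕ j)))
      ≡⟨ sumFin-cong n (λ j → sumFin-*ʳ n (φ (toℕ j)) (λ k → κ i (toℕ k) * ρ (toℕ k) (toℕ j))) ⟩
    sumFin n (λ j → sumFin n (λ k → κ i (toℕ k) * ρ (toℕ k) (toℕ j)) * φ (toℕ j)) ∎
    where open ≡-Reasoning

module Dihedral (ν : ℕ) (H : Dih (suc ν) → Bool) (connecting : IsConnectingSet H) where

  open IsConnectingSet connecting

  n : ℕ
  n = suc ν

  indicator : Bool → ℤ
  indicator b = if b then 1ℤ else 0ℤ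

  γ : Bool → Seq
  γ s k = indicator (H ⟨ k mod n , s ⟩)

  α β : Seq
  α = γ false
  β = γ true

  γ-periodic : ∀ s → Periodic n (γ s)
  γ-periodic s k = cong (λ r → indicator (H ⟨ r , s ⟩))
    (mod-cong (n ℕ.+ k) k n (trans (cong (_% n) (ℕ.+-comm n k)) (ℕ.[m+n]%n≡m%n k n)))

  wrap : ∀ {φ} → Periodic n φ → ∀ t {x y} → x ≡ t ℕ.* n ℕ.+ y → φ x ≡ φ y
  wrap {φ} φn t {x} {y} x≡ = trans (cong φ x≡) (periodic-∣ {φ = φ} (ℕ.n∣m*n t) φn y)

  wrap-% : ∀ {φ} → Periodic n φ → ∀ k x → φ (k % n ℕ.+ x) ≡ φ (k ℕ.+ x)
  wrap-% {φ} φn k x = sym (wrap {φ} φn (k / n) (trans (cong (ℕ._+ x) (ℕ.m≡m%n+[m/n]*n k n))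
    (regroup (k % n) (k / n ℕ.* n) x)))
    where
    regroup : ∀ a b x → a ℕ.+ b ℕ.+ x ≡ b ℕ.+ (a ℕ.+ x)
    regroup = ℕ-Solver.solve-∀

  -- Multiplication by ν = n - 1 serves as negation modulo n.
  ∸-wrap : ∀ {φ} → Periodic n φ → ∀ x i → i ℕ.≤ n → φ (x ℕ.+ (n ℕ.∸ i)) ≡ φ (x ℕ.+ i ℕ.* ν)
  ∸-wrap {φ} φn x i i≤n = trans (sym (wrap {φ} φn i refl)) (wrap {φ} φn 1 (begin
    i ℕ.* n ℕ.+ (x ℕ.+ (n ℕ.∸ i))
      ≡⟨ regroup i ν x (n ℕ.∸ i) ⟩
    (n ℕ.∸ i) ℕ.+ i ℕ.+ (x ℕ.+ i ℕ.* ν)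
      ≡⟨ cong (ℕ._+ (x ℕ.+ i ℕ.* ν)) (trans (ℕ.m∸n+n≡m i≤n) (sym (ℕ.*-identityˡ n))) ⟩
    1 ℕ.* n ℕ.+ (x ℕ.+ i ℕ.* ν) ∎))
    where
    open ≡-Reasoning
    regroup : ∀ i ν x y → i ℕ.* suc ν ℕ.+ (x ℕ.+ y) ≡ y ℕ.+ i ℕ.+ (x ℕ.+ i ℕ.* ν)
    regroup = ℕ-Solver.solve-∀

  -- The symmetry of H enters here: inversion negates the exponent of a rotation and fixes
  -- reflections, so it amounts to α being even.
  α-neg : ∀ m → α (m ℕ.* ν) ≡ α m
  α-neg m = begin
    α (m ℕ.* ν)
      ≡⟨ sym (α-neg-% m) ⟩
    α (n ℕ.∸ m % n)
      ≡⟨ cong (λ r → α (n ℕ.∸ r)) (sym (toℕ-mod m n)) ⟩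
    indicator (H (inv ⟨ m mod n , false ⟩))
      ≡⟨ cong indicator (symmetric ⟨ m mod n , false ⟩) ⟩
    α m ∎
    where
    open ≡-Reasoning
    α-neg-% : ∀ m → α (n ℕ.∸ m % n) ≡ α (m ℕ.* ν)
    α-neg-% m = trans (∸-wrap {α} (γ-periodic false) 0 (m % n) (ℕ.m%n≤n m n))
      (sym (wrap {α} (γ-periodic false) (m / n ℕ.* ν)
        (trans (cong (ℕ._* ν) (ℕ.m≡m%n+[m/n]*n m n)) (regroup (m % n) (m / n) ν))))
      where
      regroup : ∀ r q ν → (r ℕ.+ q ℕ.* suc ν) ℕ.* ν ≡ q ℕ.* ν ℕ.* suc ν ℕ.+ r ℕ.* ν
      regroup = ℕ-Solver.solve-∀

  α-symmetric : ∀ i j → α (i ℕ.+ j ℕ.* ν) ≡ α (j ℕ.+ i ℕ.* ν)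
  α-symmetric i j = trans (sym (α-neg (i ℕ.+ j ℕ.* ν))) (trans (sym (wrap {α} (γ-periodic false) j refl))
    (wrap {α} (γ-periodic false) (j ℕ.* ν) (regroup i j ν)))
    where
    regroup : ∀ i j ν → j ℕ.* suc ν ℕ.+ (i ℕ.+ j ℕ.* ν) ℕ.* ν ≡ j ℕ.* ν ℕ.* suc ν ℕ.+ (j ℕ.+ i ℕ.* ν)
    regroup = ℕ-Solver.solve-∀

  ==D-ref : ∀ (i j : Fin n) s → (⟨ i , s ⟩ ==D ⟨ j , not s ⟩) ≡ false
  ==D-ref i j false = ∧-zeroʳ (does (i Fin.≟ j))
  ==D-ref i j true  = ∧-zeroʳ (does (i Fin.≟ j))

  α-0 : α 0 ≡ 0ℤ
  α-0 = cong indicator noIdentity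

  negF-involutive : ∀ i → negF (negF i) ≡ i
  negF-involutive i with toℕ i ℕ.≟ 0
  ... | yes i≡0 = Fin.toℕ-injective (trans (toℕ-mod (n ℕ.∸ toℕ (negF i)) n)
    (trans (cong (λ r → (n ℕ.∸ r) % n) (trans (toℕ-mod (n ℕ.∸ toℕ i) n)
      (trans (cong (λ r → (n ℕ.∸ r) % n) i≡0) (ℕ.n%n≡0 n)))) (trans (ℕ.n%n≡0 n) (sym i≡0))))
  ... | no i≢0 = Fin.toℕ-injective (trans (toℕ-mod (n ℕ.∸ toℕ (negF i)) n)
    (trans (cong (λ r → (n ℕ.∸ r) % n) (trans (toℕ-mod (n ℕ.∸ toℕ i) n) (ℕ.m<n⇒m%n≡m n∸i<n)))
      (trans (cong (_% n) (ℕ.m∸[m∸n]≡n (ℕ.<⇒≤ (Fin.toℕ<n i)))) (ℕ.m<n⇒m%n≡m (Fin.toℕ<n i)))))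
    where
    n∸i<n : n ℕ.∸ toℕ i ℕ.< n
    n∸i<n = ℕ.∸-monoʳ-< (ℕ.n≢0⇒n>0 i≢0) (ℕ.<⇒≤ (Fin.toℕ<n i))

  γ-negF : ∀ s i j → γ s (j ℕ.+ toℕ (negF i)) ≡ γ s (j ℕ.+ toℕ i ℕ.* ν)
  γ-negF s i j = begin
    γ s (j ℕ.+ toℕ (negF i))
      ≡⟨ cong (γ s) (trans (cong (j ℕ.+_) (toℕ-mod (n ℕ.∸ toℕ i) n)) (ℕ.+-comm j _)) ⟩
    γ s ((n ℕ.∸ toℕ i) % n ℕ.+ j)
      ≡⟨ wrap-% {γ s} (γ-periodic s) (n ℕ.∸ toℕ i) j ⟩
    γ s ((n ℕ.∸ toℕ i) ℕ.+ j)
      ≡⟨ cong (γ s) (ℕ.+-comm _ j) ⟩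
    γ s (j ℕ.+ (n ℕ.∸ toℕ i))
      ≡⟨ ∸-wrap {γ s} (γ-periodic s) j (toℕ i) (ℕ.<⇒≤ (Fin.toℕ<n i)) ⟩
    γ s (j ℕ.+ toℕ i ℕ.* ν) ∎
    where open ≡-Reasoning

  -- For rotations and for reflections alike the quotient is a^(j - i). The diagonal, zero by the
  -- definition of adjacency, agrees with α 0 because H omits the identity.
  cayAdj-same : ∀ s i j → cayAdj H ⟨ i , s ⟩ ⟨ j , s ⟩ ≡ α (toℕ j ℕ.+ toℕ i ℕ.* ν)
  cayAdj-same s i j with i Fin.≟ j
  cayAdj-same false i j | no _ = γ-negF false i (toℕ j)
  cayAdj-same true  i j | no _ = γ-negF false i (toℕ j)
  cayAdj-same s i .i | yes refl = trans (diagonal s) (sym (trans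
    (wrap {α} (γ-periodic false) (toℕ i) (regroup (toℕ i) ν)) α-0))
    where
    regroup : ∀ i ν → i ℕ.+ i ℕ.* ν ≡ i ℕ.* suc ν ℕ.+ 0
    regroup = ℕ-Solver.solve-∀
    diagonal : ∀ s → (if true ∧ does (s Bool.≟ s) then 0ℤ else indicator (H (⟨ i , s ⟩ · inv ⟨ i , s ⟩))) ≡ 0ℤ
    diagonal false = refl
    diagonal true  = refl

  -- A reflection is its own inverse, so in both directions the quotient is a^(i + j) b. Hence the
  -- two off-diagonal blocks coincide.
  cayAdj-cross : ∀ s i j → cayAdj H ⟨ i , s ⟩ ⟨ j , not s ⟩ ≡ β (toℕ j ℕ.+ toℕ i)
  cayAdj-cross false i j rewrite ==D-ref i j false | negF-involutive i = refl
  cayAdj-cross true  i j rewrite ==D-ref i j true = refl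

  -- Autocorrelations of α and β: they are at once the coefficients of `Ψ′` and `Ψ″` and those of C²
  -- and B² as polynomials in S.
  U W : ℕ → ℤ
  U j = sumFin n (λ k → α (j ℕ.+ toℕ k) * α (toℕ k))
  W j = sumFin n (λ k → β (j ℕ.+ toℕ k) * β (toℕ k))

  shift-periodic : ∀ {φ} s → Periodic n φ → Periodic n (λ k → φ (s ℕ.+ k))
  shift-periodic {φ} s φn k = trans (cong φ (swapˡ s n k)) (φn (s ℕ.+ k))
    where
    swapˡ : ∀ a b c → a ℕ.+ (b ℕ.+ c) ≡ b ℕ.+ (a ℕ.+ c)
    swapˡ = ℕ-Solver.solve-∀

  *-periodic : ∀ {φ ψ : Seq} → Periodic n φ → Periodic n ψ → Periodic n (λ k → φ k * ψ k)
  *-periodic φn ψn k = cong₂ _*_ (φn k) (ψn k)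

  swapʳ : ∀ a b c → a ℕ.+ b ℕ.+ c ≡ b ℕ.+ (a ℕ.+ c)
  swapʳ = ℕ-Solver.solve-∀

  unwind : ∀ i k → α (i ℕ.+ k ℕ.+ i ℕ.* ν) ≡ α k
  unwind i k = wrap {α} (γ-periodic false) i (regroup i k ν)
    where
    regroup : ∀ i k ν → i ℕ.+ k ℕ.+ i ℕ.* ν ≡ i ℕ.* suc ν ℕ.+ k
    regroup = ℕ-Solver.solve-∀

  shift : ∀ k x → α (n ℕ.+ k ℕ.+ x) ≡ α (k ℕ.+ x)
  shift k x = trans (cong α (ℕ.+-assoc n k x)) (γ-periodic false (k ℕ.+ x))

  -- The start i is kept general: the walks begin at a, so i = 1, whereas C² needs every row i.
  αα-sum : ∀ i j → sumFin n (λ k → α (toℕ k ℕ.+ i ℕ.* ν) * α (toℕ k ℕ.+ (j ℕ.+ i) ℕ.* ν)) ≡ U j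
  αα-sum i j = trans (sym (sum-shift n {λ k → α (k ℕ.+ i ℕ.* ν) * α (k ℕ.+ (j ℕ.+ i) ℕ.* ν)}
      (λ k → cong₂ _*_ (shift k (i ℕ.* ν))
        (shift k ((j ℕ.+ i) ℕ.* ν))) (j ℕ.+ i)))
    (sumFin-cong n λ k → cong₂ _*_
      (trans (cong (λ m → α (m ℕ.+ i ℕ.* ν)) (swapʳ j i (toℕ k))) (unwind i (j ℕ.+ toℕ k)))
      (unwind (j ℕ.+ i) (toℕ k)))

  ββ-sum : ∀ i j → sumFin n (λ k → β (toℕ k ℕ.+ i) * β ((j ℕ.+ i) ℕ.+ toℕ k)) ≡ W j
  ββ-sum i j = trans (sumFin-cong n λ k → trans (cong₂ (λ a b → β a * β b) (ℕ.+-comm (toℕ k) i) (ℕ.+-assoc j i (toℕ k)))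
      (ℤ.*-comm (β (i ℕ.+ toℕ k)) _))
    (sum-shift n {λ k → β (j ℕ.+ k) * β k}
      (*-periodic {λ k → β (j ℕ.+ k)} {β} (shift-periodic {β} j (γ-periodic true)) (γ-periodic true)) i)

  uWalks≡U : ∀ j → uWalks H (suc j) ≡ U j
  uWalks≡U j = trans (sumFin-cong n λ k → cong₂ _*_
      (trans (cayAdj-same false (1 mod n) k) (move k 1))
      (trans (cayAdj-same false k (suc j mod n)) (trans (α-symmetric (toℕ (suc j mod n)) (toℕ k))
        (trans (move k (suc j)) (cong (λ m → α (toℕ k ℕ.+ m ℕ.* ν)) (ℕ.+-comm 1 j))))))
    (αα-sum 1 j)
    where
    move : ∀ k a → α (toℕ k ℕ.+ toℕ (a mod n) ℕ.* ν) ≡ α (toℕ k ℕ.+ a ℕ.* ν)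
    move k a = trans (α-symmetric (toℕ k) (toℕ (a mod n))) (trans
      (cong (λ r → α (r ℕ.+ toℕ k ℕ.* ν)) (toℕ-mod a n))
      (trans (wrap-% {α} (γ-periodic false) a (toℕ k ℕ.* ν)) (α-symmetric a (toℕ k))))

  wWalks≡W : ∀ j → wWalks H (suc j) ≡ W j
  wWalks≡W j = trans (sumFin-cong n λ k → cong₂ _*_
      (trans (cayAdj-cross false (1 mod n) k) (trans (cong β (ℕ.+-comm (toℕ k) _)) (trans (move 1 (toℕ k)) (cong β (ℕ.+-comm 1 (toℕ k))))))
      (trans (cayAdj-cross true k (suc j mod n)) (trans (move (suc j) (toℕ k)) (cong (λ m → β (m ℕ.+ toℕ k)) (ℕ.+-comm 1 j)))))
    (ββ-sum 1 j)
    where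
    move : ∀ a x → β (toℕ (a mod n) ℕ.+ x) ≡ β (a ℕ.+ x)
    move a x = trans (cong (λ r → β (r ℕ.+ x)) (toℕ-mod a n)) (wrap-% {β} (γ-periodic true) a x)

  rotations reflections : ℕ → ℕ → ℤ
  rotations   i j = α (j ℕ.+ i ℕ.* ν)
  reflections i j = β (j ℕ.+ i)

  -- The adjacency matrix is [[C, B], [B, C]] for the matrices C and B of these two transforms.
  C B : Seq → Seq
  C = transform n rotations
  B = transform n reflections

  transform-cong : ∀ κ {φ ψ : Seq} → (∀ i → φ i ≡ ψ i) → ∀ i → transform n κ φ i ≡ transform n κ ψ i
  transform-cong κ φ≗ψ i = sumFin-cong n λ j → cong (κ i (toℕ j) *_) (φ≗ψ (toℕ j))

  transform-+ : ∀ κ (φ ψ : Seq) i → transform n κ (λ i → φ i + ψ i) i ≡ transform n κ φ i + transform n κ ψ i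
  transform-+ κ φ ψ i = trans (sumFin-cong n λ j → ℤ.*-distribˡ-+ (κ i (toℕ j)) (φ (toℕ j)) (ψ (toℕ j)))
    (sumFin-+ n (λ j → κ i (toℕ j) * φ (toℕ j)) (λ j → κ i (toℕ j) * ψ (toℕ j)))

  transform-neg : ∀ κ (φ : Seq) i → transform n κ (λ i → - φ i) i ≡ - transform n κ φ i
  transform-neg κ φ i = trans (sumFin-cong n λ j → sym (ℤ.neg-distribʳ-* (κ i (toℕ j)) (φ (toℕ j))))
    (sumFin-neg n (λ j → κ i (toℕ j) * φ (toℕ j)))

  -- Where the entries depend on column minus row only, the matrix acts on periodic sequences as a
  -- polynomial in S.
  transform-shift : ∀ κ {φ} i (V : ℕ → ℤ) → (∀ k → κ i (n ℕ.+ k) ≡ κ i k) → Periodic n φ →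
    (∀ j → κ i (j ℕ.+ i) ≡ V j) → transform n κ φ i ≡ sumFin n (λ j → V (toℕ j) * φ (toℕ j ℕ.+ i))
  transform-shift κ {φ} i V κn φn κ≗V = trans
    (sym (sum-shift n {λ j → κ i j * φ j} (λ k → cong₂ _*_ (κn k) (φn k)) i))
    (sumFin-cong n λ j → trans (cong (λ m → κ i m * φ m) (ℕ.+-comm i (toℕ j)))
      (cong (_* φ (toℕ j ℕ.+ i)) (κ≗V (toℕ j))))

  CC-sum : ∀ {φ} → Periodic n φ → ∀ i → C (C φ) i ≡ sumFin n (λ j → U (toℕ j) * φ (toℕ j ℕ.+ i))
  CC-sum {φ} φn i = trans (transform-∘ n rotations rotations φ i)
    (transform-shift (λ i j → sumFin n (λ k → α (toℕ k ℕ.+ i ℕ.* ν) * α (j ℕ.+ toℕ k ℕ.* ν))) {φ} i U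
      (λ j → sumFin-cong n λ k → cong (α (toℕ k ℕ.+ i ℕ.* ν) *_) (shift j (toℕ k ℕ.* ν))) φn
      λ j → trans (sumFin-cong n λ k → cong (α (toℕ k ℕ.+ i ℕ.* ν) *_) (α-symmetric (j ℕ.+ i) (toℕ k)))
        (αα-sum i j))

  -- The entries of B depend on i + j, so B reverses shifts and need not be a polynomial in S. In B²
  -- the two reversals cancel.
  BB-sum : ∀ {φ} → Periodic n φ → ∀ i → B (B φ) i ≡ sumFin n (λ j → W (toℕ j) * φ (toℕ j ℕ.+ i))
  BB-sum {φ} φn i = trans (transform-∘ n reflections reflections φ i)
    (transform-shift (λ i j → sumFin n (λ k → β (toℕ k ℕ.+ i) * β (j ℕ.+ toℕ k))) {φ} i W
      (λ j → sumFin-cong n λ k → cong (β (toℕ k ℕ.+ i) *_)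
        (trans (cong β (ℕ.+-assoc n j (toℕ k))) (γ-periodic true (j ℕ.+ toℕ k)))) φn
      (ββ-sum i))

  -- Both products have the entries Σ α(k) β(j + i + k); for B C this takes the evenness of α.
  CB≗BC : ∀ φ i → C (B φ) i ≡ B (C φ) i
  CB≗BC φ i = trans (transform-∘ n rotations reflections φ i)
    (trans (sumFin-cong n λ j → cong (_* φ (toℕ j)) (trans (CB (toℕ j)) (sym (BC (toℕ j)))))
      (sym (transform-∘ n reflections rotations φ i)))
    where
    CB : ∀ j → sumFin n (λ k → α (toℕ k ℕ.+ i ℕ.* ν) * β (j ℕ.+ toℕ k)) ≡
      sumFin n (λ k → α (toℕ k) * β (j ℕ.+ i ℕ.+ toℕ k))
    CB j = trans (sym (sum-shift n {λ k → α (k ℕ.+ i ℕ.* ν) * β (j ℕ.+ k)}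
        (λ k → cong₂ _*_ (shift k (i ℕ.* ν)) (shift-periodic {β} j (γ-periodic true) k)) i))
      (sumFin-cong n λ k → cong₂ _*_ (unwind i (toℕ k)) (cong β (sym (ℕ.+-assoc j i (toℕ k)))))
    BC : ∀ j → sumFin n (λ k → β (toℕ k ℕ.+ i) * α (j ℕ.+ toℕ k ℕ.* ν)) ≡
      sumFin n (λ k → α (toℕ k) * β (j ℕ.+ i ℕ.+ toℕ k))
    BC j = trans (sumFin-cong n λ k → cong (β (toℕ k ℕ.+ i) *_) (α-symmetric j (toℕ k)))
      (trans (sym (sum-shift n {λ k → β (k ℕ.+ i) * α (k ℕ.+ j ℕ.* ν)}
        (λ k → cong₂ _*_ (trans (cong β (ℕ.+-assoc n k i)) (γ-periodic true (k ℕ.+ i))) (shift k (j ℕ.* ν))) j))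
      (sumFin-cong n λ k → trans (cong₂ (λ m a → β m * a) (regroup j (toℕ k) i) (unwind j (toℕ k)))
        (ℤ.*-comm (β (j ℕ.+ i ℕ.+ toℕ k)) (α (toℕ k)))))
      where
      regroup : ∀ j k i → j ℕ.+ k ℕ.+ i ≡ j ℕ.+ i ℕ.+ k
      regroup = ℕ-Solver.solve-∀

  f : Poly
  f = Ψ′ H -ₚ Ψ″ H

  f-act : ∀ {φ} → Periodic n φ → ∀ i → (f • φ) i ≡ C (C φ) i - B (B φ) i
  f-act {φ} φn i = trans (act-- 1 (Ψ′ H) (Ψ″ H) φ i) (cong₂ _-_
    (trans (tabulate-act n (λ j → uWalks H (suc (toℕ j))) φ i) (trans
      (sumFin-cong n λ j → cong (_* φ (toℕ j ℕ.+ i)) (uWalks≡U (toℕ j))) (sym (CC-sum {φ} φn i))))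
    (trans (tabulate-act n (λ j → wWalks H (suc (toℕ j))) φ i) (trans
      (sumFin-cong n λ j → cong (_* φ (toℕ j ℕ.+ i)) (wWalks≡W (toℕ j))) (sym (BB-sum {φ} φn i)))))

  C-periodic : ∀ φ → Periodic n (C φ)
  C-periodic φ i = sumFin-cong n λ j → cong (_* φ (toℕ j)) (wrap {α} (γ-periodic false) ν (regroup (toℕ j) i ν))
    where
    regroup : ∀ j i ν → j ℕ.+ (suc ν ℕ.+ i) ℕ.* ν ≡ ν ℕ.* suc ν ℕ.+ (j ℕ.+ i ℕ.* ν)
    regroup = ℕ-Solver.solve-∀

  B-periodic : ∀ φ → Periodic n (B φ)
  B-periodic φ i = sumFin-cong n λ j → cong (_* φ (toℕ j)) (shift-periodic {β} (toℕ j) (γ-periodic true) i)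

  neg-unique : ∀ x y → x + y ≡ 0ℤ → x ≡ - y
  neg-unique x y x+y≡0 = trans (isolate x y) (trans (cong (_- y) x+y≡0) (ℤ.+-identityˡ (- y)))
    where
    isolate : ∀ x y → x ≡ x + y - y
    isolate = solve-∀

  -- Applying C to the first equation and B to the second eliminates q, as C and B commute.
  kernel-kills : ∀ {p q} → Periodic n p → (∀ i → C p i + B q i ≡ 0ℤ) → (∀ i → B p i + C q i ≡ 0ℤ) → f kills p
  kernel-kills {p} {q} pn Cp+Bq Bp+Cq i = begin
    (f • p) i
      ≡⟨ f-act {p} pn i ⟩
    C (C p) i - B (B p) i
      ≡⟨ cong₂ _-_
           (trans (transform-cong rotations (λ j → neg-unique (C p j) (B q j) (Cp+Bq j)) i)
             (transform-neg rotations (B q) i))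
           (trans (transform-cong reflections (λ j → neg-unique (B p j) (C q j) (Bp+Cq j)) i)
             (transform-neg reflections (C q) i)) ⟩
    - C (B q) i - - B (C q) i
      ≡⟨ cong (λ x → - x - - B (C q) i) (CB≗BC q i) ⟩
    - B (C q) i - - B (C q) i
      ≡⟨ ℤ.+-inverseʳ (- B (C q) i) ⟩
    0ℤ ∎
    where open ≡-Reasoning

  -- Kernel vectors of the adjacency matrix and periodic solutions

  A : Matrix (n ℕ.+ n) (n ℕ.+ n)
  A = adjMatrix H

  vertex-rotation : ∀ j → vertex (j ↑ˡ n) ≡ ⟨ j , false ⟩
  vertex-rotation j rewrite Fin.splitAt-↑ˡ n j n = refl

  vertex-reflection : ∀ j → vertex (n ↑ʳ j) ≡ ⟨ j , true ⟩
  vertex-reflection j rewrite Fin.splitAt-↑ʳ n n j = refl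

  row : ∀ k u → vertex k ≡ u → (v : Fin (n ℕ.+ n) → ℤ) → sumFin (n ℕ.+ n) (λ l → A k l * v l) ≡
    sumFin n (λ j → cayAdj H u ⟨ j , false ⟩ * v (j ↑ˡ n)) +
    sumFin n (λ j → cayAdj H u ⟨ j , true ⟩ * v (n ↑ʳ j))
  row k u refl v = trans (sumFin-split n n (λ l → A k l * v l)) (cong₂ _+_
    (sumFin-cong n λ j → cong (λ w → cayAdj H u w * v (j ↑ˡ n)) (vertex-rotation j))
    (sumFin-cong n λ j → cong (λ w → cayAdj H u w * v (n ↑ʳ j)) (vertex-reflection j)))

  module _ (v : Fin (n ℕ.+ n) → ℤ) (p q : Seq)
    (v-rotation : ∀ (j : Fin n) → v (j ↑ˡ n) ≡ p (toℕ j))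
    (v-reflection : ∀ (j : Fin n) → v (n ↑ʳ j) ≡ q (toℕ j)) where

    row-rotation : ∀ i → sumFin (n ℕ.+ n) (λ l → A (i ↑ˡ n) l * v l) ≡ C p (toℕ i) + B q (toℕ i)
    row-rotation i = trans (row (i ↑ˡ n) ⟨ i , false ⟩ (vertex-rotation i) v) (cong₂ _+_
      (sumFin-cong n λ j → cong₂ _*_ (cayAdj-same false i j) (v-rotation j))
      (sumFin-cong n λ j → cong₂ _*_ (cayAdj-cross false i j) (v-reflection j)))

    row-reflection : ∀ i → sumFin (n ℕ.+ n) (λ l → A (n ↑ʳ i) l * v l) ≡ B p (toℕ i) + C q (toℕ i)
    row-reflection i = trans (row (n ↑ʳ i) ⟨ i , true ⟩ (vertex-reflection i) v) (cong₂ _+_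
      (sumFin-cong n λ j → cong₂ _*_ (cayAdj-cross true i j) (v-rotation j))
      (sumFin-cong n λ j → cong₂ _*_ (cayAdj-same true i j) (v-reflection j)))

  kernel⇒solution : NonzeroKernel A → PeriodicSolution n f
  kernel⇒solution (v , (x , vx≢0) , Av≡0) = solution (splitAt n x) (Fin.join-splitAt n n x)
    where
    p q : Seq
    p k = v ((k mod n) ↑ˡ n)
    q k = v (n ↑ʳ (k mod n))
    mod-periodic : ∀ k → (n ℕ.+ k) mod n ≡ k mod n
    mod-periodic k = mod-cong (n ℕ.+ k) k n (trans (cong (_% n) (ℕ.+-comm n k)) (ℕ.[m+n]%n≡m%n k n))
    pn : Periodic n p
    pn k = cong (λ r → v (r ↑ˡ n)) (mod-periodic k)
    qn : Periodic n q
    qn k = cong (λ r → v (n ↑ʳ r)) (mod-periodic k)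
    v-rotation : ∀ j → v (j ↑ˡ n) ≡ p (toℕ j)
    v-rotation j = cong (λ r → v (r ↑ˡ n)) (sym (mod-toℕ j))
    v-reflection : ∀ j → v (n ↑ʳ j) ≡ q (toℕ j)
    v-reflection j = cong (λ r → v (n ↑ʳ r)) (sym (mod-toℕ j))
    extend : ∀ {φ} → Periodic n φ → (∀ (j : Fin n) → φ (toℕ j) ≡ 0ℤ) → ∀ i → φ i ≡ 0ℤ
    extend {φ} φn φ≗0 i = trans (periodic-% {n} {φ} φn i) (trans (cong φ (sym (toℕ-mod i n))) (φ≗0 (i mod n)))
    Cp+Bq : ∀ i → C p i + B q i ≡ 0ℤ
    Cp+Bq = extend {λ i → C p i + B q i} (λ i → cong₂ _+_ (C-periodic p i) (B-periodic q i))
      λ j → trans (sym (row-rotation v p q v-rotation v-reflection j)) (Av≡0 (j ↑ˡ n))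
    Bp+Cq : ∀ i → B p i + C q i ≡ 0ℤ
    Bp+Cq = extend {λ i → B p i + C q i} (λ i → cong₂ _+_ (B-periodic p i) (C-periodic q i))
      λ j → trans (sym (row-reflection v p q v-rotation v-reflection j)) (Av≡0 (n ↑ʳ j))
    solution : ∀ (s : Fin n ⊎ Fin n) → join n n s ≡ x → PeriodicSolution n f
    solution (inj₁ i) i≡x = p , pn , (toℕ i , λ pi≡0 → vx≢0 (trans (cong v (sym i≡x)) (trans (v-rotation i) pi≡0)))
      , kernel-kills {p} {q} pn Cp+Bq Bp+Cq
    -- The block matrix is unchanged when both halves are exchanged, so q may take the role of p.
    solution (inj₂ i) i≡x = q , qn , (toℕ i , λ qi≡0 → vx≢0 (trans (cong v (sym i≡x)) (trans (v-reflection i) qi≡0)))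
      , kernel-kills {q} {p} qn (λ i → trans (ℤ.+-comm (C q i) (B p i)) (Bp+Cq i))
          (λ i → trans (ℤ.+-comm (B q i) (C p i)) (Cp+Bq i))

  pair⇒kernel : ∀ p q → Periodic n p → (∃[ i ] p i ≢ 0ℤ) →
    (∀ i → C p i + B q i ≡ 0ℤ) → (∀ i → B p i + C q i ≡ 0ℤ) → NonzeroKernel A
  pair⇒kernel p q pn (i , pi≢0) Cp+Bq Bp+Cq = v , ((i mod n) ↑ˡ n , v≢0) ,
    λ k → Av≡0 (splitAt n k) (Fin.join-splitAt n n k)
    where
    v : Fin (n ℕ.+ n) → ℤ
    v l = [ p ∘ toℕ , q ∘ toℕ ]′ (splitAt n l)
    v-rotation : ∀ j → v (j ↑ˡ n) ≡ p (toℕ j)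
    v-rotation j = cong [ p ∘ toℕ , q ∘ toℕ ]′ (Fin.splitAt-↑ˡ n j n)
    v-reflection : ∀ j → v (n ↑ʳ j) ≡ q (toℕ j)
    v-reflection j = cong [ p ∘ toℕ , q ∘ toℕ ]′ (Fin.splitAt-↑ʳ n n j)
    v≢0 : v ((i mod n) ↑ˡ n) ≢ 0ℤ
    v≢0 v≡0 = pi≢0 (trans (periodic-% {n} {p} pn i)
      (trans (cong p (sym (toℕ-mod i n))) (trans (sym (v-rotation (i mod n))) v≡0)))
    Av≡0 : ∀ {k} (s : Fin n ⊎ Fin n) → join n n s ≡ k → sumFin (n ℕ.+ n) (λ l → A k l * v l) ≡ 0ℤ
    Av≡0 (inj₁ j) refl = trans (row-rotation v p q v-rotation v-reflection j) (Cp+Bq (toℕ j))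
    Av≡0 (inj₂ j) refl = trans (row-reflection v p q v-rotation v-reflection j) (Bp+Cq (toℕ j))

  -- Put ψ = (C + B) φ, so that (C - B) ψ = 0. If ψ = 0, then (φ, φ) lies in the kernel, otherwise
  -- (ψ, - ψ) does.
  solution⇒kernel : PeriodicSolution n f → NonzeroKernel A
  solution⇒kernel (φ , φn , φ≢0 , fφ≗0) = kernel (periodic-zero⊎nonzero {n} {ψ} ψn)
    where
    ψ : Seq
    ψ i = C φ i + B φ i
    ψn : Periodic n ψ
    ψn i = cong₂ _+_ (C-periodic φ i) (B-periodic φ i)
    Cψ+B[-ψ] : ∀ i → C ψ i + B (λ j → - ψ j) i ≡ 0ℤ
    Cψ+B[-ψ] i = begin
      C ψ i + B (λ j → - ψ j) i
        ≡⟨ cong₂ _+_ (transform-+ rotations (C φ) (B φ) i) (trans (transform-neg reflections ψ i)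
             (cong -_ (transform-+ reflections (C φ) (B φ) i))) ⟩
      (C (C φ) i + C (B φ) i) + - (B (C φ) i + B (B φ) i)
        ≡⟨ cong (λ x → (C (C φ) i + x) + - (B (C φ) i + B (B φ) i)) (CB≗BC φ i) ⟩
      (C (C φ) i + B (C φ) i) + - (B (C φ) i + B (B φ) i)
        ≡⟨ cancel (C (C φ) i) (B (C φ) i) (B (B φ) i) ⟩
      C (C φ) i - B (B φ) i
        ≡⟨ trans (sym (f-act {φ} φn i)) (fφ≗0 i) ⟩
      0ℤ ∎
      where
      open ≡-Reasoning
      cancel : ∀ a b c → (a + b) + - (b + c) ≡ a - c
      cancel = solve-∀
    Bψ+C[-ψ] : ∀ i → B ψ i + C (λ j → - ψ j) i ≡ 0ℤ
    Bψ+C[-ψ] i = trans (cong (B ψ i +_) (transform-neg rotations ψ i)) (trans (flip (B ψ i) (C ψ i))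
      (cong -_ (trans (cong (C ψ i +_) (sym (transform-neg reflections ψ i))) (Cψ+B[-ψ] i))))
      where
      flip : ∀ a b → a + - b ≡ - (b + - a)
      flip = solve-∀
    kernel : (∀ i → ψ i ≡ 0ℤ) ⊎ (∃[ i ] ψ i ≢ 0ℤ) → NonzeroKernel A
    kernel (inj₁ ψ≗0) = pair⇒kernel φ φ φn φ≢0 ψ≗0 (λ i → trans (ℤ.+-comm (B φ i) (C φ i)) (ψ≗0 i))
    kernel (inj₂ ψ≢0) = pair⇒kernel ψ (λ j → - ψ j) ψn ψ≢0 Cψ+B[-ψ] Bψ+C[-ψ]

theorem1p4 : (n : ℕ) .{{_ : NonZero n}} (H : Dih n → Bool) → IsConnectingSet H →
    (Singular (adjMatrix H) ⇔ (∃[ d ] (d > 0 × d ∣ n × Φ d ∣ₚ (Ψ′ H -ₚ Ψ″ H))))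
theorem1p4 (suc ν) H connecting = mk⇔ to from
  where
  open Dihedral ν H connecting
  to : Singular (adjMatrix H) → ∃[ d ] (d > 0 × d ∣ suc ν × Φ d ∣ₚ f)
  to singular = divisor (periodicSolution⇒cyclotomic n f (kernel⇒solution (singular⇒kernel (n ℕ.+ n) A singular)))
    where
    divisor : ∃[ δ ] (suc δ ∣ n × cyclotomic (suc δ) ∣ᵖ f) → ∃[ d ] (d > 0 × d ∣ n × Φ d ∣ₚ f)
    divisor (δ , δ∣n , Φ∣f) with subst (_∣ᵖ f) (cyclotomic≡Φ (suc δ)) Φ∣f
    ... | divides q eq = suc δ , s≤s z≤n , δ∣n , q , at eq
  from : ∃[ d ] (d > 0 × d ∣ suc ν × Φ d ∣ₚ f) → Singular (adjMatrix H)
  from (suc δ , _ , δ∣n , q , Φq≈f) = kernel⇒singular (n ℕ.+ n) A (solution⇒kernel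
    (cyclotomic⇒periodicSolution n f δ δ∣n
      (subst (_∣ᵖ f) (sym (cyclotomic≡Φ (suc δ))) (divides q (mk≋ Φq≈f)))))
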